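{- For every $k \in \mathbb{N}$ there exists an effective constant $D_k > 0$ such that for every $\alpha \in \mathbb{R}$ and every $n \in \mathbb{N}$ there exist integers $1 \le b_1, \ldots, b_k \le n$ with $$\left\| \sum_{j=1}^{k} \sqrt{b_j} - \alpha \right\| \le D_k \cdot n^{ -\gamma_k},$$ where $$\gamma_k = 2^{\lfloor \log_2 (k+1) \rfloor - 1} - \tfrac{1}{2} \ge \frac{k-1}{4}.$$
   Context: $\mathbb{N} = \{1,2,\ldots\}$. For a real number $x$, $\|x\| := \min_{m \in \mathbb{Z}} |x - m|$ denotes the distance from $x$ to the nearest integer, and $\lfloor x \rfloor$ is the largest integer less than or equal to $x$. The integers $b_1,\dots,b_k$ need not be distinct. "Effective" means that the constant can in principle be computed explicitly; $D_k$ depends only on $k$ (not on $\alpha$ or $n$). -}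

module Defs where

open import Data.Nat as ℕ using (ℕ; zero; suc; z≤n; s≤s)
import Data.Nat.DivMod as ℕ
import Data.Nat.Properties as ℕ
open import Data.Nat.Logarithm using (⌊log₂_⌋)
open import Data.Integer as ℤ using (ℤ; +_; -[1+_])
import Data.Integer.DivMod as ℤ
import Data.Integer.Properties as ℤ
import Data.Integer.Solver as ℤ
open import Data.Rational
open import Data.Rational.Properties
open import Data.Rational.Solver using (module +-*-Solver)
import Data.Rational.Unnormalised as ℚᵘ
import Data.Rational.Unnormalised.Properties as ℚᵘ
open import Data.Fin using (Fin)
open import Data.Vec.Functional using (foldr)
open import Data.Product using (Σ-syntax; ∃-syntax; _×_; _,_; proj₁; proj₂)
open import Data.Sum using (_⊎_; inj₁; inj₂; [_,_]′)
open import Relation.Nullary using (yes; no)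
open import Relation.Binary.PropositionalEquality

-- Cauchy sequences of rationals.  The Σ-type in `cauchy` carries a modulus
-- of convergence, so a closed term of type ℝ is an effectively computable
-- real number.  Two sequences represent the same real number when each is
-- ≤ℝ the other.

record ℝ : Set where
  constructor mkℝ
  field
    seq    : ℕ → ℚ
    cauchy : ∀ ε → 0ℚ < ε →
             ∃[ N ] (∀ m n → N ℕ.≤ m → N ℕ.≤ n → ∣ seq m - seq n ∣ ≤ ε)

open ℝ public

infix 4 _≤ℝ_ _<ℝ_

_≤ℝ_ : ℝ → ℝ → Set
x ≤ℝ y = ∀ ε → 0ℚ < ε → ∃[ N ] (∀ n → N ℕ.≤ n → seq x n ≤ seq y n + ε)

_<ℝ_ : ℝ → ℝ → Set
x <ℝ y = Σ[ ε ∈ ℚ ] 0ℚ < ε × ∃[ N ] (∀ n → N ℕ.≤ n → seq x n + ε ≤ seq y n)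

private
  ½ε>0 : ∀ {ε} → 0ℚ < ε → 0ℚ < ε * ½
  ½ε>0 {ε} ε>0 = positive⁻¹ (ε * ½) {{pos*pos⇒pos ε {{positive ε>0}} ½}}

  ½ε+½ε : ∀ ε → ε * ½ + ε * ½ ≡ ε
  ½ε+½ε ε = trans (sym (*-distribˡ-+ ε ½ ½)) (*-identityʳ ε)

  p≤∣p∣ : ∀ p → p ≤ ∣ p ∣
  p≤∣p∣ p with ≤-total 0ℚ p
  ... | inj₁ 0≤p = ≤-reflexive (sym (0≤p⇒∣p∣≡p 0≤p))
  ... | inj₂ p≤0 = ≤-trans p≤0 (0≤∣p∣ p)

  -p≤∣p∣ : ∀ p → - p ≤ ∣ p ∣
  -p≤∣p∣ p = subst (- p ≤_) (∣-p∣≡∣p∣ p) (p≤∣p∣ (- p))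

  ∣∣-least : ∀ {p e} → p ≤ e → - p ≤ e → ∣ p ∣ ≤ e
  ∣∣-least {p} {e} p≤e -p≤e =
    [ (λ eq → subst (_≤ e) (sym eq) p≤e)
    , (λ eq → subst (_≤ e) (sym eq) -p≤e) ]′ (∣p∣≡p∨∣p∣≡-p p)

  -[p-q] : ∀ p q → - (p - q) ≡ q - p
  -[p-q] = solve 2 (λ p q → :- (p :- q) := q :- p) refl
    where open +-*-Solver

  move : ∀ {p} q {r} → p ≤ q + r → p - q ≤ r
  move {p} q {r} le = subst (p - q ≤_)
    (solve 2 (λ q r → (q :+ r) :- q := r) refl q r) (+-monoˡ-≤ (- q) le)
    where open +-*-Solver

infixl 6 _+ℝ_ _-ℝ_
infixl 7 _*ℝ_
infix  8 -ℝ_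

fromℚ : ℚ → ℝ
fromℚ p = mkℝ (λ _ → p) λ ε ε>0 → 0 , λ _ _ _ _ →
  subst (_≤ ε) (cong ∣_∣ (sym (+-inverseʳ p))) (<⇒≤ ε>0)

0ℝ : ℝ
0ℝ = fromℚ 0ℚ

_+ℝ_ : ℝ → ℝ → ℝ
x +ℝ y = mkℝ (λ n → seq x n + seq y n) λ ε ε>0 →
  let (M , hx) = cauchy x (ε * ½) (½ε>0 ε>0)
      (N , hy) = cauchy y (ε * ½) (½ε>0 ε>0)
  in M ℕ.⊔ N , λ m n m≥ n≥ →
    let open ≤-Reasoning
        open +-*-Solver
    in begin
      ∣ (seq x m + seq y m) - (seq x n + seq y n) ∣
        ≡⟨ cong ∣_∣ (solve 4 (λ a b c d →
             (a :+ b) :- (c :+ d) := (a :- c) :+ (b :- d)) refl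
             (seq x m) (seq y m) (seq x n) (seq y n)) ⟩
      ∣ (seq x m - seq x n) + (seq y m - seq y n) ∣
        ≤⟨ ∣p+q∣≤∣p∣+∣q∣ (seq x m - seq x n) (seq y m - seq y n) ⟩
      ∣ seq x m - seq x n ∣ + ∣ seq y m - seq y n ∣
        ≤⟨ +-mono-≤ (hx m n (ℕ.m⊔n≤o⇒m≤o M N m≥) (ℕ.m⊔n≤o⇒m≤o M N n≥))
                    (hy m n (ℕ.m⊔n≤o⇒n≤o M N m≥) (ℕ.m⊔n≤o⇒n≤o M N n≥)) ⟩
      ε * ½ + ε * ½
        ≡⟨ ½ε+½ε ε ⟩
      ε ∎

-ℝ_ : ℝ → ℝ
-ℝ x = mkℝ (λ n → - seq x n) λ ε ε>0 →
  let (N , h) = cauchy x ε ε>0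
  in N , λ m n m≥ n≥ → subst (_≤ ε)
       (trans (sym (∣-p∣≡∣p∣ (seq x m - seq x n)))
              (cong ∣_∣ (neg-distrib-+ (seq x m) (- seq x n))))
       (h m n m≥ n≥)

_-ℝ_ : ℝ → ℝ → ℝ
x -ℝ y = x +ℝ (-ℝ y)

private
  -- The bound is kept positive so that it can be divided by below.
  bounded : ∀ x → Σ[ B ∈ ℚ ] 0ℚ < B ×
            ∃[ N ] (∀ n → N ℕ.≤ n → ∣ seq x n ∣ ≤ B)
  bounded x =
    let (N , h) = cauchy x 1ℚ (positive⁻¹ 1ℚ)
        a = seq x N
    in ∣ a ∣ + 1ℚ , +-mono-≤-< (0≤∣p∣ a) (positive⁻¹ 1ℚ) , N , λ n n≥ →
      let open ≤-Reasoning
          open +-*-Solver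
      in begin
        ∣ seq x n ∣
          ≡⟨ cong ∣_∣ (solve 2 (λ s a → s := a :+ (s :- a)) refl (seq x n) a) ⟩
        ∣ a + (seq x n - a) ∣
          ≤⟨ ∣p+q∣≤∣p∣+∣q∣ a (seq x n - a) ⟩
        ∣ a ∣ + ∣ seq x n - a ∣
          ≤⟨ +-monoʳ-≤ ∣ a ∣ (h n N n≥ ℕ.≤-refl) ⟩
        ∣ a ∣ + 1ℚ ∎

  *-mono-abs : ∀ {p q} A B → 0ℚ < A → ∣ p ∣ ≤ A → ∣ q ∣ ≤ B → ∣ p * q ∣ ≤ A * B
  *-mono-abs {p} {q} A B A>0 p≤ q≤ = begin
    ∣ p * q ∣       ≡⟨ ∣p*q∣≡∣p∣*∣q∣ p q ⟩
    ∣ p ∣ * ∣ q ∣   ≤⟨ *-monoʳ-≤-nonNeg ∣ q ∣ {{∣-∣-nonNeg q}} p≤ ⟩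
    A * ∣ q ∣       ≤⟨ *-monoˡ-≤-nonNeg A {{nonNegative (<⇒≤ A>0)}} q≤ ⟩
    A * B           ∎
    where open ≤-Reasoning

_*ℝ_ : ℝ → ℝ → ℝ
x *ℝ y = mkℝ (λ n → seq x n * seq y n) λ ε ε>0 →
  let (A , A>0 , K , bx) = bounded x
      (B , B>0 , L , by) = bounded y
      C    = A + B
      C>0  = +-mono-< A>0 B>0
      instance
        C-pos : Positive C
        C-pos = positive C>0
        C-nz : NonZero C
        C-nz = pos⇒nonZero C
        1/C-pos : Positive (1/ C)
        1/C-pos = 1/pos⇒pos C
        ε-pos : Positive ε
        ε-pos = positive ε>0
      δ    = ε * 1/ C
      δ>0  = positive⁻¹ δ {{pos*pos⇒pos ε (1/ C)}}
      (M , hx) = cauchy x δ δ>0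
      (N , hy) = cauchy y δ δ>0
  in (K ℕ.⊔ L) ℕ.⊔ (M ℕ.⊔ N) , λ m n m≥ n≥ →
    let open ≤-Reasoning
        open +-*-Solver
        a = seq x m ; b = seq y m ; c = seq x n ; d = seq y n
        KL = K ℕ.⊔ L ; MN = M ℕ.⊔ N
        m≥KL = ℕ.m⊔n≤o⇒m≤o KL MN m≥ ; m≥MN = ℕ.m⊔n≤o⇒n≤o KL MN m≥
        n≥KL = ℕ.m⊔n≤o⇒m≤o KL MN n≥ ; n≥MN = ℕ.m⊔n≤o⇒n≤o KL MN n≥
    in begin
      ∣ a * b - c * d ∣
        ≡⟨ cong ∣_∣ (solve 4 (λ a b c d →
             a :* b :- c :* d := a :* (b :- d) :+ d :* (a :- c)) refl a b c d) ⟩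
      ∣ a * (b - d) + d * (a - c) ∣
        ≤⟨ ∣p+q∣≤∣p∣+∣q∣ (a * (b - d)) (d * (a - c)) ⟩
      ∣ a * (b - d) ∣ + ∣ d * (a - c) ∣
        ≤⟨ +-mono-≤
             (*-mono-abs {a} {b - d} A δ A>0 (bx m (ℕ.m⊔n≤o⇒m≤o K L m≥KL))
               (hy m n (ℕ.m⊔n≤o⇒n≤o M N m≥MN) (ℕ.m⊔n≤o⇒n≤o M N n≥MN)))
             (*-mono-abs {d} {a - c} B δ B>0 (by n (ℕ.m⊔n≤o⇒n≤o K L n≥KL))
               (hx m n (ℕ.m⊔n≤o⇒m≤o M N m≥MN) (ℕ.m⊔n≤o⇒m≤o M N n≥MN))) ⟩
      A * δ + B * δ
        ≡⟨ sym (*-distribʳ-+ δ A B) ⟩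
      C * (ε * 1/ C)
        ≡⟨ solve 3 (λ c e i → c :* (e :* i) := e :* (c :* i)) refl C ε (1/ C) ⟩
      ε * (C * 1/ C)
        ≡⟨ cong (ε *_) (*-inverseʳ C) ⟩
      ε * 1ℚ
        ≡⟨ *-identityʳ ε ⟩
      ε ∎

-- On the rationals: an integer nearest to p is ⌊ p ⌋ or ⌊ p ⌋ + 1.  The
-- lemmas distℤ-lower and distℤ-attained say that distℤ p = min_{m ∈ ℤ} |p - m|.
distℤ : ℚ → ℚ
distℤ p = (p - floor p / 1) ⊓ (ℤ.suc (floor p) / 1 - p)

private
  /1-mono : ∀ {i j} → i ℤ.≤ j → i / 1 ≤ j / 1
  /1-mono {i} {j} i≤j = toℚᵘ-cancel-≤
    (ℚᵘ.≤-respʳ-≃ (ℚᵘ.≃-sym (toℚᵘ-fromℚᵘ (ℚᵘ.mkℚᵘ j 0)))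
    (ℚᵘ.≤-respˡ-≃ (ℚᵘ.≃-sym (toℚᵘ-fromℚᵘ (ℚᵘ.mkℚᵘ i 0)))
    (ℚᵘ.*≤* (ℤ.*-monoʳ-≤-nonNeg (+ 1) i≤j))))

  floor≤ : ∀ p → floor p / 1 ≤ p
  floor≤ p@(mkℚ n d _) = toℚᵘ-cancel-≤
    (ℚᵘ.≤-respˡ-≃ (ℚᵘ.≃-sym (toℚᵘ-fromℚᵘ (ℚᵘ.mkℚᵘ (floor p) 0)))
    (ℚᵘ.*≤* (subst (floor p ℤ.* + suc d ℤ.≤_) (sym (ℤ.*-identityʳ n))
      (ℤ.[n/d]*d≤n n (+ suc d)))))

  ≤suc-floor : ∀ p → p ≤ ℤ.suc (floor p) / 1
  ≤suc-floor p@(mkℚ n d _) = toℚᵘ-cancel-≤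
    (ℚᵘ.≤-respʳ-≃ (ℚᵘ.≃-sym (toℚᵘ-fromℚᵘ (ℚᵘ.mkℚᵘ (ℤ.suc (floor p)) 0)))
    (ℚᵘ.*≤* (subst₂ ℤ._≤_ (sym (ℤ.*-identityʳ n))
      (cong (λ f → ℤ.suc f ℤ.* + suc d) (sym (ℤ.div-pos-is-/ℕ n (suc d))))
      (ℤ.<⇒≤ (ℤ.n<s[n/ℕd]*d n (suc d))))))

  ∣p-q∣≡∣q-p∣ : ∀ p q → ∣ p - q ∣ ≡ ∣ q - p ∣
  ∣p-q∣≡∣q-p∣ p q = trans (sym (∣-p∣≡∣p∣ (p - q))) (cong ∣_∣ (-[p-q] p q))

  0≤p-q : ∀ {p q} → q ≤ p → 0ℚ ≤ p - q
  0≤p-q {p} {q} q≤p = subst (_≤ p - q) (+-inverseʳ q) (+-monoˡ-≤ (- q) q≤p)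

distℤ-lower : ∀ p m → distℤ p ≤ ∣ p - m / 1 ∣
distℤ-lower p m with m ℤ.≤? floor p
... | yes m≤ = begin
  distℤ p             ≤⟨ p⊓q≤p (p - floor p / 1) _ ⟩
  p - floor p / 1     ≤⟨ +-monoʳ-≤ p (neg-antimono-≤ (/1-mono m≤)) ⟩
  p - m / 1           ≤⟨ p≤∣p∣ (p - m / 1) ⟩
  ∣ p - m / 1 ∣       ∎
  where open ≤-Reasoning
... | no m≰ = begin
  distℤ p                   ≤⟨ p⊓q≤q (p - floor p / 1) _ ⟩
  ℤ.suc (floor p) / 1 - p   ≤⟨ +-monoˡ-≤ (- p) (/1-mono (ℤ.i<j⇒suc[i]≤j (ℤ.≰⇒> m≰))) ⟩
  m / 1 - p                 ≤⟨ p≤∣p∣ (m / 1 - p) ⟩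
  ∣ m / 1 - p ∣             ≡⟨ ∣p-q∣≡∣q-p∣ (m / 1) p ⟩
  ∣ p - m / 1 ∣             ∎
  where open ≤-Reasoning

distℤ-attained : ∀ p → ∃[ m ] distℤ p ≡ ∣ p - m / 1 ∣
distℤ-attained p with ⊓-sel (p - floor p / 1) (ℤ.suc (floor p) / 1 - p)
... | inj₁ eq = floor p , trans eq (sym (0≤p⇒∣p∣≡p (0≤p-q (floor≤ p))))
... | inj₂ eq = ℤ.suc (floor p) , trans eq
      (trans (sym (0≤p⇒∣p∣≡p (0≤p-q (≤suc-floor p))))
             (∣p-q∣≡∣q-p∣ (ℤ.suc (floor p) / 1) p))

private
  distℤ-lipschitz : ∀ p q → distℤ p - distℤ q ≤ ∣ p - q ∣
  distℤ-lipschitz p q with distℤ-attained q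
  ... | m , eq = move (distℤ q) (begin
    distℤ p                         ≤⟨ distℤ-lower p m ⟩
    ∣ p - m / 1 ∣                   ≡⟨ cong ∣_∣ (solve 3 (λ p q m →
                                         p :- m := (q :- m) :+ (p :- q)) refl p q (m / 1)) ⟩
    ∣ (q - m / 1) + (p - q) ∣       ≤⟨ ∣p+q∣≤∣p∣+∣q∣ (q - m / 1) (p - q) ⟩
    ∣ q - m / 1 ∣ + ∣ p - q ∣       ≡⟨ cong (_+ ∣ p - q ∣) (sym eq) ⟩
    distℤ q + ∣ p - q ∣             ∎)
    where open ≤-Reasoning
          open +-*-Solver

-- On the reals: the unique continuous extension of distℤ, which is
-- 1-Lipschitz.
‖_‖ : ℝ → ℝ
‖ x ‖ = mkℝ (λ n → distℤ (seq x n)) λ ε ε>0 →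
  let (N , h) = cauchy x ε ε>0
  in N , λ m n m≥ n≥ → ∣∣-least
    (≤-trans (distℤ-lipschitz (seq x m) (seq x n)) (h m n m≥ n≥))
    (subst (_≤ ε) (sym (-[p-q] (distℤ (seq x m)) (distℤ (seq x n))))
      (≤-trans (distℤ-lipschitz (seq x n) (seq x m)) (h n m n≥ m≥)))

-- ⌊ N^{1/b} ⌋
iroot : (b : ℕ) → ℕ → ℕ
iroot b zero = zero
iroot b (suc N) with suc (iroot b N) ℕ.^ b ℕ.≤? suc N
... | yes _ = suc (iroot b N)
... | no  _ = iroot b N

iroot-lower : ∀ b .{{_ : ℕ.NonZero b}} N → iroot b N ℕ.^ b ℕ.≤ N
iroot-lower (suc b) zero = z≤n
iroot-lower b@(suc _) (suc N) with suc (iroot b N) ℕ.^ b ℕ.≤? suc N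
... | yes le = le
... | no  _  = ℕ.m≤n⇒m≤1+n (iroot-lower b N)

iroot-upper : ∀ b .{{_ : ℕ.NonZero b}} N → N ℕ.< suc (iroot b N) ℕ.^ b
iroot-upper b@(suc c) zero = ℕ.≤-reflexive (sym (ℕ.^-zeroˡ b))
iroot-upper b@(suc c) (suc N) with suc (iroot b N) ℕ.^ b ℕ.≤? suc N
... | yes _ = ℕ.≤-<-trans (iroot-upper b N)
                (ℕ.^-monoˡ-< b (ℕ.n<1+n (suc (iroot b N))))
... | no ≰  = ℕ.≰⇒> ≰

-- (p/q)^{1/b}, whose m-th approximation is the largest multiple t/(m+1) of
-- 1/(m+1) with (t/(m+1))^b ≤ p/q.
rootSeq : (b p q : ℕ) .{{_ : ℕ.NonZero q}} → ℕ → ℚ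
rootSeq b p q m = + iroot b (p ℕ.* suc m ℕ.^ b ℕ./ q) / suc m

private
  ^-cancelˡ-< : ∀ b {x y} → x ℕ.^ b ℕ.< y ℕ.^ b → x ℕ.< y
  ^-cancelˡ-< b lt = ℕ.≰⇒> λ y≤x → ℕ.<⇒≱ lt (ℕ.^-monoˡ-≤ b y≤x)

  ^-distribʳ-* : ∀ b x y → (x ℕ.* y) ℕ.^ b ≡ x ℕ.^ b ℕ.* y ℕ.^ b
  ^-distribʳ-* zero    x y = refl
  ^-distribʳ-* (suc b) x y = trans (cong (x ℕ.* y ℕ.*_) (^-distribʳ-* b x y))
    (ℕ.[m*n]*[o*p]≡[m*o]*[n*p] x y (x ℕ.^ b) (y ℕ.^ b))

  swap : ∀ x y z → x ℕ.* y ℕ.* z ≡ x ℕ.* z ℕ.* y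
  swap x y z = trans (ℕ.*-assoc x y z)
    (trans (cong (x ℕ.*_) (ℕ.*-comm y z)) (sym (ℕ.*-assoc x z y)))

  module _ (b p q : ℕ) .{{_ : ℕ.NonZero b}} .{{_ : ℕ.NonZero q}} where
    t : ℕ → ℕ
    t m = iroot b (p ℕ.* suc m ℕ.^ b ℕ./ q)

    t-lower : ∀ m → t m ℕ.^ b ℕ.* q ℕ.≤ p ℕ.* suc m ℕ.^ b
    t-lower m = ℕ.≤-trans
      (ℕ.*-monoˡ-≤ q (iroot-lower b (p ℕ.* suc m ℕ.^ b ℕ./ q)))
      (ℕ.m/n*n≤m (p ℕ.* suc m ℕ.^ b) q)

    t-upper : ∀ m → p ℕ.* suc m ℕ.^ b ℕ.< suc (t m) ℕ.^ b ℕ.* q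
    t-upper m = begin-strict
      a                             ≡⟨ ℕ.m≡m%n+[m/n]*n a q ⟩
      a ℕ.% q ℕ.+ a ℕ./ q ℕ.* q     <⟨ ℕ.+-monoˡ-< (a ℕ./ q ℕ.* q) (ℕ.m%n<n a q) ⟩
      suc (a ℕ./ q) ℕ.* q           ≤⟨ ℕ.*-monoˡ-≤ q (iroot-upper b (a ℕ./ q)) ⟩
      suc (t m) ℕ.^ b ℕ.* q         ∎
      where open ℕ.≤-Reasoning
            a = p ℕ.* suc m ℕ.^ b

    t-cross : ∀ m n → t m ℕ.* suc n ℕ.< suc (t n) ℕ.* suc m
    t-cross m n = ^-cancelˡ-< b (ℕ.*-cancelʳ-< q _ _ (begin-strict
      (t m ℕ.* suc n) ℕ.^ b ℕ.* q           ≡⟨ cong (ℕ._* q) (^-distribʳ-* b (t m) (suc n)) ⟩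
      t m ℕ.^ b ℕ.* N ℕ.* q                 ≡⟨ swap (t m ℕ.^ b) N q ⟩
      t m ℕ.^ b ℕ.* q ℕ.* N                 ≤⟨ ℕ.*-monoˡ-≤ N (t-lower m) ⟩
      p ℕ.* M ℕ.* N                         ≡⟨ swap p M N ⟩
      p ℕ.* N ℕ.* M                         <⟨ ℕ.*-monoˡ-< M (t-upper n) ⟩
      suc (t n) ℕ.^ b ℕ.* q ℕ.* M           ≡⟨ swap (suc (t n) ℕ.^ b) q M ⟩
      suc (t n) ℕ.^ b ℕ.* M ℕ.* q           ≡⟨ cong (ℕ._* q) (^-distribʳ-* b (suc (t n)) (suc m)) ⟨
      (suc (t n) ℕ.* suc m) ℕ.^ b ℕ.* q     ∎))
      where
        open ℕ.≤-Reasoning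
        M = suc m ℕ.^ b
        N = suc n ℕ.^ b
        instance _ = ℕ.m^n≢0 (suc m) b

    rootSeq-cross : ∀ m n → rootSeq b p q m - rootSeq b p q n ≤ + 1 / suc n
    rootSeq-cross m n = move (rootSeq b p q n) (toℚᵘ-cancel-≤ (begin
      toℚᵘ (+ t m / suc m)
        ≃⟨ toℚᵘ-fromℚᵘ (ℚᵘ.mkℚᵘ (+ t m) m) ⟩
      ℚᵘ.mkℚᵘ (+ t m) m
        ≤⟨ ℚᵘ.*≤* (subst₂ ℤ._≤_ (ℤ.pos-* (t m) (suc n)) (ℤ.pos-* (suc (t n)) (suc m))
             (ℤ.+≤+ (ℕ.<⇒≤ (t-cross m n)))) ⟩
      ℚᵘ.mkℚᵘ (+ suc (t n)) n
        ≃⟨ ℚᵘ.*≡* (add (+ t n) (+ suc n)) ⟩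
      ℚᵘ.mkℚᵘ (+ t n) n ℚᵘ.+ ℚᵘ.mkℚᵘ (+ 1) n
        ≃⟨ ℚᵘ.≃-sym (ℚᵘ.+-cong (toℚᵘ-fromℚᵘ (ℚᵘ.mkℚᵘ (+ t n) n))
                               (toℚᵘ-fromℚᵘ (ℚᵘ.mkℚᵘ (+ 1) n))) ⟩
      toℚᵘ (+ t n / suc n) ℚᵘ.+ toℚᵘ (+ 1 / suc n)
        ≃⟨ ℚᵘ.≃-sym (toℚᵘ-homo-+ (+ t n / suc n) (+ 1 / suc n)) ⟩
      toℚᵘ (+ t n / suc n + + 1 / suc n) ∎))
      where
        open ℚᵘ.≤-Reasoning
        add : ∀ a d → (+ 1 ℤ.+ a) ℤ.* (d ℤ.* d) ≡ (a ℤ.* d ℤ.+ + 1 ℤ.* d) ℤ.* d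
        add = ℤ.+-*-Solver.solve 2 (λ a d → (con (+ 1) :+ a) :* (d :* d)
                                 := (a :* d :+ con (+ 1) :* d) :* d) refl
          where open ℤ.+-*-Solver

  archimedean : ∀ ε → 0ℚ < ε → ∃[ N ] (∀ n → N ℕ.≤ n → + 1 / suc n ≤ ε)
  archimedean (mkℚ (+ zero) _ _)    (*<* (ℤ.+<+ ()))
  archimedean (mkℚ -[1+ _ ] _ _)    (*<* ())
  archimedean (mkℚ (+ suc a) d _) _ = d , λ n d≤n → toℚᵘ-cancel-≤
    (ℚᵘ.≤-respˡ-≃ (ℚᵘ.≃-sym (toℚᵘ-fromℚᵘ (ℚᵘ.mkℚᵘ (+ 1) n)))
    (ℚᵘ.*≤* (ℤ.+≤+ (ℕ.*-mono-≤ (s≤s (z≤n {a})) (s≤s d≤n)))))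

root : (b p q : ℕ) .{{_ : ℕ.NonZero b}} .{{_ : ℕ.NonZero q}} → ℝ
root b p q = mkℝ (rootSeq b p q) λ ε ε>0 →
  let (N , h) = archimedean ε ε>0
  in N , λ m n m≥ n≥ → ∣∣-least
    (≤-trans (rootSeq-cross b p q m n) (h n n≥))
    (subst (_≤ ε) (sym (-[p-q] (rootSeq b p q m) (rootSeq b p q n)))
      (≤-trans (rootSeq-cross b p q n m) (h m m≥)))

√_ : ℕ → ℝ
√ n = root 2 n 1

infix 9 √_
infixr 8 _^ℚ_

-- n^{a/b} is the b-th root of n^a, a/b being in lowest terms with b > 0.
_^ℚ_ : (n : ℕ) → ℚ → .{{_ : ℕ.NonZero n}} → ℝ
n ^ℚ mkℚ (+ a)    b-1 _ = root (suc b-1) (n ℕ.^ a) 1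
n ^ℚ mkℚ -[1+ a ] b-1 _ = root (suc b-1) 1 (n ℕ.^ suc a) {{_}} {{ℕ.m^n≢0 n (suc a)}}

Σℝ : ∀ {k} → (Fin k → ℝ) → ℝ
Σℝ = foldr _+ℝ_ 0ℝ

-- γ k = 2^{⌊log₂(k+1)⌋ - 1} - 1/2.  The truncated subtraction is exact for
-- k ≥ 1, where ⌊log₂(k+1)⌋ ≥ 1.
γ : ℕ → ℚ
γ k = + (2 ℕ.^ (⌊log₂ (k ℕ.+ 1) ⌋ ℕ.∸ 1)) / 1 - ½

{-# OPTIONS --safe #-}
module Submission where

-- Let ℓ = ⌊log₂ (k + 1)⌋, K = 2^ℓ - 1, and let p₀, …, p_{ℓ-1} be distinct primes.
-- For nonempty S write D_S = ∏_{i ∈ S} p_i.  All but K of the roots are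
-- taken to be √1, and the remaining ones are a_S √D_S for suitable integers
-- a_S = O(√n), one for each S.  To find them, take a convergent x_S / y_S of
-- √D_S with y_S ≈ T and let u_T = ∏_S (x_S - y_S √D_S).  Under the identity
-- embedding of ℚ(√p₀, …, √p_{ℓ-1}) every factor is ≈ 1/T, so u_T ≈ T^{-K};
-- under any other embedding (K + 1)/2 of the factors are ≈ T and the rest are
-- ≈ 1/T, so the conjugate is O(T).  Hence u_T has coefficients O(T) in the
-- basis √D_S.  Expanding α greedily in u_1, u_2, u_4, …, u_T with bounded
-- integer digits approximates it modulo 1 within O(T^{-K}) by a sum with
-- coefficients O(T); these are made positive by first shifting α by a
-- multiple of Σ_S √D_S.

open import Defs
open import Data.Nat as ℕ using (ℕ; zero; suc; z≤n; s≤s)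
import Data.Nat.DivMod as ℕ
import Data.Nat.Properties as ℕ
import Data.Nat.Solver as ℕ
open import Data.Nat.Coprimality using (Coprime)
open import Data.Nat.Divisibility using (_∣_; divides; ∣-trans; m∣m*n; n∣m*n; *-monoʳ-∣; ∣m+n∣m⇒∣n; ∣1⇒≡1; ∣⇒≤)
open import Data.Nat.Induction using (<-rec)
open import Data.Nat.Logarithm using (⌊log₂_⌋; ⌊log₂⌋-mono-≤; ⌊log₂⌊n/2⌋⌋≡⌊log₂n⌋∸1; ⌊log₂[2^n]⌋≡n)
open import Data.Nat.Primality using (Prime; euclidsLemma; prime⇒nonTrivial; prime⇒nonZero; ¬prime[1])
open import Data.Nat.Primality.Factorisation using (factorise)
open import Data.Integer as ℤ using (ℤ; +_; -[1+_])
import Data.Integer.Properties as ℤ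
import Data.Integer.Solver as ℤ
open import Data.Rational.Solver using (module +-*-Solver)
import Data.Rational.Unnormalised as ℚᵘ
import Data.Rational.Unnormalised.Properties as ℚᵘ
open import Data.Fin using (Fin; zero; suc)
open import Data.List using ([]; _∷_)
open import Data.List.Relation.Unary.All using ([]; _∷_)
open import Data.Vec using (Vec; []; _∷_; replicate)
open import Data.Vec.Functional using (foldr)
open import Data.Product using (Σ-syntax; ∃-syntax; _×_; _,_; proj₁; proj₂)
open import Data.Sum using (_⊎_; inj₁; inj₂; [_,_]′)
open import Data.Bool using (Bool; true; false; _xor_)
open import Data.Bool.Properties using (xor-assoc)
open import Data.Empty using (⊥; ⊥-elim)
open import Data.Unit using (⊤; tt)
open import Relation.Binary.Definitions using (tri<; tri≈; tri>)
open import Relation.Binary.PropositionalEquality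
open import Relation.Nullary using (yes; no; ¬_)

-- The greedy expansion needs |u_T| bounded from below as well as from above; otherwise its digits
-- are not bounded. The lower bound comes from x² - D y² being a nonzero integer while y has the
-- exact order T. There is one factor for every nonempty S because a nontrivial sign character on
-- the subsets takes both signs equally often. Under a nontrivial embedding the powers of T
-- therefore cancel, except for the one that a factor at the missing empty set would have offset.
-- The coefficient at the empty set is an integer and costs no root, so K roots serve a ring of rank
-- K + 1. A radicand a² D_S must not exceed n, so T is of order √n and 1 / T^K becomes n^(-K/2),
-- with K/2 = γ_k. Square roots occur only as sequences of rational approximations, whose products
-- obey the ring laws only up to O(1/m). Exact integer coefficients are therefore kept in a formal
-- ring, and `eval` carries the estimates at index m. The coefficients are found at one index, fixed
-- before they are known, and must serve at every later one; hence the drift of an evaluation is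
-- bounded through the size of its coefficients alone.

-- Integers inside the rationals and inequalities between rationals

module RationalArithmetic where
  open import Data.Rational hiding (NonZero)
  open import Data.Rational.Properties

  opaque
    -- Opaque, so that embedded integers act as atoms in ring identities and the normalisation of
    -- `i / 1` never unfolds.
    ι : ℤ → ℚ
    ι i = i / 1

    ι≡/1 : ∀ i → ι i ≡ i / 1
    ι≡/1 i = refl

  ⟪_⟫ : ℕ → ℚ
  ⟪ n ⟫ = ι (+ n)

  ι0≡0 : ι (+ 0) ≡ 0ℚ
  ι0≡0 = ι≡/1 (+ 0)

  ι1≡1 : ι (+ 1) ≡ 1ℚ
  ι1≡1 = ι≡/1 (+ 1)

  toℚᵘ-ι : ∀ i → toℚᵘ (ι i) ℚᵘ.≃ ℚᵘ.mkℚᵘ i 0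
  toℚᵘ-ι i = ℚᵘ.≃-trans (toℚᵘ-cong (ι≡/1 i)) (toℚᵘ-fromℚᵘ (ℚᵘ.mkℚᵘ i 0))

  ι-+ : ∀ i j → ι (i ℤ.+ j) ≡ ι i + ι j
  ι-+ i j = toℚᵘ-injective (begin
    toℚᵘ (ι (i ℤ.+ j))                  ≈⟨ toℚᵘ-ι (i ℤ.+ j) ⟩
    ℚᵘ.mkℚᵘ (i ℤ.+ j) 0                 ≈⟨ ℚᵘ.*≡* (cong (ℤ._* + 1) (sym (cong₂ ℤ._+_ (ℤ.*-identityʳ i) (ℤ.*-identityʳ j)))) ⟩
    ℚᵘ.mkℚᵘ i 0 ℚᵘ.+ ℚᵘ.mkℚᵘ j 0        ≈⟨ ℚᵘ.+-cong (toℚᵘ-ι i) (toℚᵘ-ι j) ⟨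
    toℚᵘ (ι i) ℚᵘ.+ toℚᵘ (ι j)          ≈⟨ toℚᵘ-homo-+ (ι i) (ι j) ⟨
    toℚᵘ (ι i + ι j)                    ∎)
    where open ℚᵘ.≃-Reasoning

  ι-* : ∀ i j → ι (i ℤ.* j) ≡ ι i * ι j
  ι-* i j = toℚᵘ-injective (begin
    toℚᵘ (ι (i ℤ.* j))                  ≈⟨ toℚᵘ-ι (i ℤ.* j) ⟩
    ℚᵘ.mkℚᵘ i 0 ℚᵘ.* ℚᵘ.mkℚᵘ j 0        ≈⟨ ℚᵘ.*-cong (toℚᵘ-ι i) (toℚᵘ-ι j) ⟨
    toℚᵘ (ι i) ℚᵘ.* toℚᵘ (ι j)          ≈⟨ toℚᵘ-homo-* (ι i) (ι j) ⟨
    toℚᵘ (ι i * ι j)                    ∎)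
    where open ℚᵘ.≃-Reasoning

  ι-mono : ∀ {i j} → i ℤ.≤ j → ι i ≤ ι j
  ι-mono {i} {j} i≤j = toℚᵘ-cancel-≤
    (ℚᵘ.≤-respʳ-≃ (ℚᵘ.≃-sym (toℚᵘ-ι j))
    (ℚᵘ.≤-respˡ-≃ (ℚᵘ.≃-sym (toℚᵘ-ι i))
    (ℚᵘ.*≤* (ℤ.*-monoʳ-≤-nonNeg (+ 1) i≤j))))

  ι-cancel-≤ : ∀ {i j} → ι i ≤ ι j → i ℤ.≤ j
  ι-cancel-≤ {i} {j} le = ℤ.*-cancelʳ-≤-pos i j (+ 1)
    (ℚᵘ.drop-*≤* (ℚᵘ.≤-respʳ-≃ (toℚᵘ-ι j) (ℚᵘ.≤-respˡ-≃ (toℚᵘ-ι i) (toℚᵘ-mono-≤ le))))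

  ι-neg : ∀ i → ι (ℤ.- i) ≡ - ι i
  ι-neg i = begin
    ι (ℤ.- i)                      ≡⟨ solve 2 (λ x y → y := (x :+ y) :- x) refl (ι i) (ι (ℤ.- i)) ⟩
    (ι i + ι (ℤ.- i)) - ι i        ≡⟨ cong (_- ι i) (sym (ι-+ i (ℤ.- i))) ⟩
    ι (i ℤ.- i) - ι i              ≡⟨ cong (λ z → ι z - ι i) (ℤ.+-inverseʳ i) ⟩
    ι (+ 0) - ι i                  ≡⟨ cong (_- ι i) ι0≡0 ⟩
    0ℚ - ι i                       ≡⟨ +-identityˡ (- ι i) ⟩
    - ι i                          ∎
    where
      open ≡-Reasoning
      open +-*-Solver

  ⟪⟫-+ : ∀ m n → ⟪ m ℕ.+ n ⟫ ≡ ⟪ m ⟫ + ⟪ n ⟫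
  ⟪⟫-+ m n = ι-+ (+ m) (+ n)

  ⟪⟫-* : ∀ m n → ⟪ m ℕ.* n ⟫ ≡ ⟪ m ⟫ * ⟪ n ⟫
  ⟪⟫-* m n = trans (cong ι (ℤ.pos-* m n)) (ι-* (+ m) (+ n))

  ⟪⟫-mono : ∀ {m n} → m ℕ.≤ n → ⟪ m ⟫ ≤ ⟪ n ⟫
  ⟪⟫-mono m≤n = ι-mono (ℤ.+≤+ m≤n)

  0≤⟪⟫ : ∀ n → 0ℚ ≤ ⟪ n ⟫
  0≤⟪⟫ n = subst (_≤ ⟪ n ⟫) ι0≡0 (⟪⟫-mono z≤n)

  0≤1 : 0ℚ ≤ 1ℚ
  0≤1 = nonNegative⁻¹ 1ℚ

  0<1 : 0ℚ < 1ℚ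
  0<1 = positive⁻¹ 1ℚ

  -- Reduces an inequality to an identity for the ring solver, d being a
  -- combination of quantities known to be nonnegative.
  ≤-cert : ∀ {p q} d → 0ℚ ≤ d → q ≡ p + d → p ≤ q
  ≤-cert {p} d 0≤d refl = subst (_≤ p + d) (+-identityʳ p) (+-monoʳ-≤ p 0≤d)

  0≤- : ∀ {p q} → p ≤ q → 0ℚ ≤ q - p
  0≤- {p} {q} p≤q = subst (_≤ q - p) (+-inverseʳ p) (+-monoˡ-≤ (- p) p≤q)

  0≤+ : ∀ {p q} → 0ℚ ≤ p → 0ℚ ≤ q → 0ℚ ≤ p + q
  0≤+ = +-mono-≤

  0≤* : ∀ {p q} → 0ℚ ≤ p → 0ℚ ≤ q → 0ℚ ≤ p * q
  0≤* {p} {q} 0≤p 0≤q = nonNegative⁻¹ (p * q)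
    {{nonNeg*nonNeg⇒nonNeg p {{nonNegative 0≤p}} q {{nonNegative 0≤q}}}}

  0<* : ∀ {p q} → 0ℚ < p → 0ℚ < q → 0ℚ < p * q
  0<* {p} {q} 0<p 0<q = positive⁻¹ (p * q)
    {{pos*pos⇒pos p {{positive 0<p}} q {{positive 0<q}}}}

  *-monoʳ : ∀ p {q r} → 0ℚ ≤ p → q ≤ r → p * q ≤ p * r
  *-monoʳ p 0≤p = *-monoˡ-≤-nonNeg p {{nonNegative 0≤p}}

  *-monoˡ : ∀ p {q r} → 0ℚ ≤ p → q ≤ r → q * p ≤ r * p
  *-monoˡ p 0≤p = *-monoʳ-≤-nonNeg p {{nonNegative 0≤p}}

  *-mono : ∀ {p q r s} → 0ℚ ≤ p → 0ℚ ≤ r → p ≤ q → r ≤ s → p * r ≤ q * s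
  *-mono {p} {q} {r} {s} 0≤p 0≤r p≤q r≤s =
    ≤-trans (*-monoʳ p 0≤p r≤s) (*-monoˡ s (≤-trans 0≤r r≤s) p≤q)

  *-cancelʳ : ∀ {p q} r → 0ℚ < r → p * r ≤ q * r → p ≤ q
  *-cancelʳ r 0<r = *-cancelʳ-≤-pos r {{positive 0<r}}

  ≤*1≤ : ∀ {p q} → 0ℚ ≤ p → 1ℚ ≤ q → p ≤ p * q
  ≤*1≤ {p} 0≤p 1≤q = subst (_≤ p * _) (*-identityʳ p) (*-monoʳ p 0≤p 1≤q)

  ≤+ʳ : ∀ {p q} → 0ℚ ≤ q → p ≤ p + q
  ≤+ʳ {p} {q} 0≤q = ≤-cert q 0≤q refl

  ≤+ˡ : ∀ {p q} → 0ℚ ≤ q → p ≤ q + p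
  ≤+ˡ {p} {q} 0≤q = ≤-cert q 0≤q (+-comm q p)

  p≤∣p∣ : ∀ p → p ≤ ∣ p ∣
  p≤∣p∣ p with ≤-total 0ℚ p
  ... | inj₁ 0≤p = ≤-reflexive (sym (0≤p⇒∣p∣≡p 0≤p))
  ... | inj₂ p≤0 = ≤-trans p≤0 (0≤∣p∣ p)

  ∣p-q∣≡∣q-p∣ : ∀ p q → ∣ p - q ∣ ≡ ∣ q - p ∣
  ∣p-q∣≡∣q-p∣ p q = trans (sym (∣-p∣≡∣p∣ (p - q)))
    (cong ∣_∣ (solve 2 (λ p q → :- (p :- q) := q :- p) refl p q))
    where open +-*-Solver

  ∣-∣-triangle : ∀ p q r → ∣ p - r ∣ ≤ ∣ p - q ∣ + ∣ q - r ∣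
  ∣-∣-triangle p q r = subst (λ z → ∣ z ∣ ≤ ∣ p - q ∣ + ∣ q - r ∣)
    (solve 3 (λ p q r → (p :- q) :+ (q :- r) := p :- r) refl p q r)
    (∣p+q∣≤∣p∣+∣q∣ (p - q) (q - r))
    where open +-*-Solver

  ∣p∣≤∣p-q∣+∣q∣ : ∀ p q → ∣ p ∣ ≤ ∣ p - q ∣ + ∣ q ∣
  ∣p∣≤∣p-q∣+∣q∣ p q = subst (λ z → ∣ z ∣ ≤ ∣ p - q ∣ + ∣ q ∣)
    (solve 2 (λ p q → (p :- q) :+ q := p) refl p q)
    (∣p+q∣≤∣p∣+∣q∣ (p - q) q)
    where open +-*-Solver

  ∣ι∣ : ∀ i → ∣ ι i ∣ ≡ ⟪ ℤ.∣ i ∣ ⟫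
  ∣ι∣ (+ n)    = 0≤p⇒∣p∣≡p (0≤⟪⟫ n)
  ∣ι∣ -[1+ n ] = trans (cong ∣_∣ (ι-neg (+ suc n))) (trans (∣-p∣≡∣p∣ ⟪ suc n ⟫) (0≤p⇒∣p∣≡p (0≤⟪⟫ (suc n))))

  ⟪⟫-cancel-≤ : ∀ {m n} → ⟪ m ⟫ ≤ ⟪ n ⟫ → m ℕ.≤ n
  ⟪⟫-cancel-≤ le = ℤ.drop‿+≤+ (ι-cancel-≤ le)

-- Square-free radicands and rational approximation of their square roots

module Convergents where
  open import Data.Rational hiding (NonZero)
  open import Data.Rational.Properties
  open RationalArithmetic

  -- Euclid's argument: a common prime factor of n + 1 and n would divide 1.
  coprimePrime : ∀ n → 1 ℕ.≤ n → ∃[ p ] Prime p × ¬ p ∣ n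
  coprimePrime n 1≤n with factorise (suc n)
  ... | record { factors = [] ; isFactorisation = eq } =
    ⊥-elim (ℕ.<-irrefl (sym (ℕ.suc-injective eq)) 1≤n)
  ... | record { factors = p ∷ ps ; isFactorisation = eq ; factorsPrime = p-prime ∷ _ } =
    p , p-prime , λ p∣n → ¬prime[1] (subst Prime (∣1⇒≡1
      (∣m+n∣m⇒∣n (subst (p ∣_) (trans (sym eq) (ℕ.+-comm 1 n)) (m∣m*n _)) p∣n)) p-prime)

  -- Euclid's sequence: each new prime divides one more than the product of the earlier ones. The
  -- primes are distinct, but they need not be the first j primes.
  primorial⁺ : ℕ → ∃[ P ] 1 ℕ.≤ P
  primorial⁺ zero    = 1 , ℕ.≤-refl
  primorial⁺ (suc j) =
    let (P , 1≤P)           = primorial⁺ j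
        (p , p-prime , _)   = coprimePrime P 1≤P
    in p ℕ.* P , ℕ.*-mono-≤ (ℕ.>-nonZero⁻¹ p {{prime⇒nonZero p-prime}}) 1≤P

  opaque
    primorial : ℕ → ℕ
    primorial j = proj₁ (primorial⁺ j)

    1≤primorial : ∀ j → 1 ℕ.≤ primorial j
    1≤primorial j = proj₂ (primorial⁺ j)

    prime : ℕ → ℕ
    prime j = proj₁ (coprimePrime (primorial j) (1≤primorial j))

    prime-isPrime : ∀ j → Prime (prime j)
    prime-isPrime j = proj₁ (proj₂ (coprimePrime (primorial j) (1≤primorial j)))

    prime∤primorial : ∀ j → ¬ prime j ∣ primorial j
    prime∤primorial j = proj₂ (proj₂ (coprimePrime (primorial j) (1≤primorial j)))

    primorial-suc : ∀ j → primorial (suc j) ≡ prime j ℕ.* primorial j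
    primorial-suc j = refl

  1≤prime : ∀ j → 1 ℕ.≤ prime j
  1≤prime j = ℕ.>-nonZero⁻¹ (prime j) {{prime⇒nonZero (prime-isPrime j)}}

  -- The number D_S. The head of the vector decides about the prime of highest index, in the order
  -- in which `Multiquadratic` adjoins the roots.
  rad : ∀ {j} → Vec Bool j → ℕ
  rad []                  = 1
  rad (false ∷ S)         = rad S
  rad {suc j} (true ∷ S)  = prime j ℕ.* rad S

  rad∣primorial : ∀ {j} (S : Vec Bool j) → rad S ∣ primorial j
  rad∣primorial [] = divides (primorial 0) (sym (ℕ.*-identityʳ _))
  rad∣primorial {suc j} (false ∷ S) = subst (rad S ∣_) (sym (primorial-suc j))
    (∣-trans (rad∣primorial S) (n∣m*n (prime j)))
  rad∣primorial {suc j} (true ∷ S) = subst (rad (true ∷ S) ∣_) (sym (primorial-suc j))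
    (*-monoʳ-∣ (prime j) (rad∣primorial S))

  1≤rad : ∀ {j} (S : Vec Bool j) → 1 ℕ.≤ rad S
  1≤rad []          = ℕ.≤-refl
  1≤rad (false ∷ S) = 1≤rad S
  1≤rad {suc j} (true ∷ S) = ℕ.*-mono-≤ (1≤prime j) (1≤rad S)

  rad≤primorial : ∀ {j} (S : Vec Bool j) → rad S ℕ.≤ primorial j
  rad≤primorial {j} S = ∣⇒≤ {{ℕ.>-nonZero (1≤primorial j)}} (rad∣primorial S)

  NonEmpty : ∀ {j} → Vec Bool j → Set
  NonEmpty []          = ⊥
  NonEmpty (false ∷ S) = NonEmpty S
  NonEmpty (true ∷ S)  = ⊤

  IrrationalRoot : ℕ → Set
  IrrationalRoot D = ∀ y z → 1 ℕ.≤ y → z ℕ.* z ≢ D ℕ.* (y ℕ.* y)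

  -- Infinite descent on y: p divides z, hence n y², hence y because it does not divide n; dividing
  -- z and y by p leaves a solution with smaller y.
  prime*-irrational : ∀ {p n} → Prime p → ¬ p ∣ n → IrrationalRoot (p ℕ.* n)
  prime*-irrational {p} {n} p-prime p∤n =
    <-rec (λ y → ∀ z → 1 ℕ.≤ y → z ℕ.* z ≢ p ℕ.* n ℕ.* (y ℕ.* y)) descent
    where
    open ℕ.+-*-Solver
    instance
      _ = prime⇒nonTrivial p-prime
      _ = prime⇒nonZero p-prime
    p∣sq : ∀ x → p ∣ x ℕ.* x → p ∣ x
    p∣sq x h = [ (λ d → d) , (λ d → d) ]′ (euclidsLemma x x p-prime h)
    descent : ∀ y → (∀ {y′} → y′ ℕ.< y → ∀ z → 1 ℕ.≤ y′ → z ℕ.* z ≢ p ℕ.* n ℕ.* (y′ ℕ.* y′)) →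
              ∀ z → 1 ℕ.≤ y → z ℕ.* z ≢ p ℕ.* n ℕ.* (y ℕ.* y)
    descent y rec z 1≤y eq
      with p∣sq z (subst (p ∣_) (trans (sym (ℕ.*-assoc p n (y ℕ.* y))) (sym eq)) (m∣m*n (n ℕ.* (y ℕ.* y))))
    ... | divides z′ refl
      with euclidsLemma n (y ℕ.* y) p-prime (divides (z′ ℕ.* z′) (ℕ.*-cancelˡ-≡ (n ℕ.* (y ℕ.* y)) (z′ ℕ.* z′ ℕ.* p) p
             (trans (sym (ℕ.*-assoc p n (y ℕ.* y))) (trans (sym eq)
               (solve 2 (λ z p → (z :* p) :* (z :* p) := p :* (z :* z :* p)) refl z′ p)))))
    ... | inj₁ p∣n = p∤n p∣n
    ... | inj₂ p∣yy with p∣sq y p∣yy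
    ... | divides zero     refl = ℕ.<⇒≢ 1≤y refl
    ... | divides y′@(suc _) refl = rec (ℕ.m<m*n y′ p (ℕ.nonTrivial⇒n>1 p)) z′ (s≤s z≤n)
      (ℕ.*-cancelˡ-≡ (z′ ℕ.* z′) (p ℕ.* n ℕ.* (y′ ℕ.* y′)) (p ℕ.* p) {{ℕ.m*n≢0 p p}}
        (trans (solve 2 (λ z p → p :* p :* (z :* z) := (z :* p) :* (z :* p)) refl z′ p)
        (trans eq (solve 3 (λ y p n → p :* n :* ((y :* p) :* (y :* p)) := p :* p :* (p :* n :* (y :* y))) refl y′ p n))))

  -- The member of S of highest index occurs exactly once in D_S, since the remaining factor divides
  -- the product of the earlier primes.
  rad-irrational : ∀ {j} (S : Vec Bool j) → NonEmpty S → IrrationalRoot (rad S)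
  rad-irrational (false ∷ S) ne = rad-irrational S ne
  rad-irrational {suc j} (true ∷ S) _ = prime*-irrational (prime-isPrime j)
    λ d → prime∤primorial j (∣-trans d (rad∣primorial S))

  -- x / y < √D < x′ / y′ are the neighbours of √D among the fractions with
  -- denominator at most T.
  record Bracket (D T : ℕ) : Set where
    field
      {x y A x′ y′ B} : ℕ
      1≤y   : 1 ℕ.≤ y
      1≤y′  : 1 ℕ.≤ y′
      y≤T   : y ℕ.≤ T
      y′≤T  : y′ ℕ.≤ T
      T<y+y′ : T ℕ.< y ℕ.+ y′
      1≤A   : 1 ℕ.≤ A
      1≤B   : 1 ℕ.≤ B
      below : x ℕ.* x ℕ.+ A ≡ D ℕ.* (y ℕ.* y)
      above : D ℕ.* (y′ ℕ.* y′) ℕ.+ B ≡ x′ ℕ.* x′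
      adjacent : x′ ℕ.* y ≡ x ℕ.* y′ ℕ.+ 1

  gap : ∀ {a b} → a ℕ.< b → ∃[ c ] 1 ℕ.≤ c × a ℕ.+ c ≡ b
  gap {a} {b} a<b = b ℕ.∸ a , ℕ.m<n⇒0<n∸m a<b , ℕ.m+[n∸m]≡n (ℕ.<⇒≤ a<b)

  -- Walk down the Farey sequences: at order 1 the neighbours are the integers around √D, and
  -- raising the order changes a neighbour only when the mediant, of denominator y + y′, becomes
  -- admissible. Irrationality keeps the mediant off √D.
  bracket : ∀ D → 1 ℕ.≤ D → IrrationalRoot D → ∀ T → Bracket D (suc T)
  bracket D 1≤D irr zero =
    let r = iroot 2 D
        (A , 1≤A , below) = gap {r ℕ.* r} {D ℕ.* 1} (ℕ.≤∧≢⇒<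
          (subst₂ ℕ._≤_ (cong (r ℕ.*_) (ℕ.*-identityʳ r)) (sym (ℕ.*-identityʳ D)) (iroot-lower 2 D))
          (irr 1 r ℕ.≤-refl))
        (B , 1≤B , above) = gap {D ℕ.* 1} {suc r ℕ.* suc r}
          (subst₂ ℕ._<_ (sym (ℕ.*-identityʳ D)) (cong (suc r ℕ.*_) (ℕ.*-identityʳ (suc r))) (iroot-upper 2 D))
    in record
      { x = r ; x′ = suc r ; 1≤y = ℕ.≤-refl ; 1≤y′ = ℕ.≤-refl ; y≤T = ℕ.≤-refl ; y′≤T = ℕ.≤-refl ; T<y+y′ = ℕ.≤-refl
      ; 1≤A = 1≤A ; 1≤B = 1≤B ; below = below ; above = above
      ; adjacent = solve 1 (λ r → (con 1 :+ r) :* con 1 := r :* con 1 :+ con 1) refl r }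
    where open ℕ.+-*-Solver
  bracket D 1≤D irr (suc T) with bracket D 1≤D irr T
  ... | record { x = x ; y = y ; x′ = x′ ; y′ = y′ ; 1≤y = 1≤y ; 1≤y′ = 1≤y′ ; y≤T = y≤T ; y′≤T = y′≤T ; T<y+y′ = T<y+y′
               ; 1≤A = 1≤A ; 1≤B = 1≤B ; below = below ; above = above ; adjacent = adjacent }
    with suc (suc (suc T)) ℕ.≤? y ℕ.+ y′
  ... | yes le = record
    { x = x ; x′ = x′ ; 1≤y = 1≤y ; 1≤y′ = 1≤y′ ; y≤T = ℕ.m≤n⇒m≤1+n y≤T ; y′≤T = ℕ.m≤n⇒m≤1+n y′≤T ; T<y+y′ = le
    ; 1≤A = 1≤A ; 1≤B = 1≤B ; below = below ; above = above ; adjacent = adjacent }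
  ... | no ≰ with ℕ.<-cmp ((x ℕ.+ x′) ℕ.* (x ℕ.+ x′)) (D ℕ.* ((y ℕ.+ y′) ℕ.* (y ℕ.+ y′)))
  ... | tri< lt _ _ = let (C , 1≤C , eq) = gap lt in record
    { x = x ℕ.+ x′ ; x′ = x′ ; 1≤y = ℕ.m≤n⇒m≤n+o y′ 1≤y ; 1≤y′ = 1≤y′ ; y≤T = ℕ.≤-pred (ℕ.≰⇒> ≰) ; y′≤T = ℕ.m≤n⇒m≤1+n y′≤T
    ; T<y+y′ = ℕ.≤-trans (s≤s T<y+y′) (subst (ℕ._≤ y ℕ.+ y′ ℕ.+ y′) (ℕ.+-comm (y ℕ.+ y′) 1) (ℕ.+-monoʳ-≤ (y ℕ.+ y′) 1≤y′))
    ; 1≤A = 1≤C ; 1≤B = 1≤B ; below = eq ; above = above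
    ; adjacent = trans (ℕ.*-distribˡ-+ x′ y y′) (trans (cong (ℕ._+ x′ ℕ.* y′) adjacent)
        (solve 3 (λ a b c → a :* b :+ con 1 :+ c :* b := (a :+ c) :* b :+ con 1) refl x y′ x′)) }
    where open ℕ.+-*-Solver
  ... | tri≈ _ eq _ = ⊥-elim (irr (y ℕ.+ y′) (x ℕ.+ x′) (ℕ.m≤n⇒m≤n+o y′ 1≤y) eq)
  ... | tri> _ _ gt = let (C , 1≤C , eq) = gap gt in record
    { x = x ; x′ = x ℕ.+ x′ ; 1≤y = 1≤y ; 1≤y′ = ℕ.m≤n⇒m≤n+o y′ 1≤y ; y≤T = ℕ.m≤n⇒m≤1+n y≤T ; y′≤T = ℕ.≤-pred (ℕ.≰⇒> ≰)
    ; T<y+y′ = ℕ.+-mono-≤ 1≤y T<y+y′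
    ; 1≤A = 1≤A ; 1≤B = 1≤C ; below = below ; above = eq
    ; adjacent = trans (ℕ.*-distribʳ-+ y x x′) (trans (cong (x ℕ.* y ℕ.+_) adjacent)
        (solve 3 (λ a b c → a :* b :+ (a :* c :+ con 1) := a :* (b :+ c) :+ con 1) refl x y y′)) }
    where open ℕ.+-*-Solver

  -- A B = D (x′ y - x y′)² - (x x′ - D y y′)², where x′ y - x y′ = 1.
  defects≤ : ∀ {D T} (b : Bracket D T) → Bracket.A b ℕ.* Bracket.B b ℕ.≤ D
  defects≤ {D} b = ℤ.drop‿+≤+ (subst₂ ℤ._≤_ (sym (ℤ.pos-* A B)) identity
      (ℤ.≤-trans (ℤ.≤-reflexive (sym (ℤ.+-identityʳ _))) (ℤ.+-monoʳ-≤ (+ A ℤ.* + B) (sq≥0 C))))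
    where
    open Bracket b
    open ℤ.+-*-Solver
    C = + x ℤ.* + x′ ℤ.- + D ℤ.* (+ y ℤ.* + y′)
    sq≥0 : ∀ i → + 0 ℤ.≤ i ℤ.* i
    sq≥0 (+ n)    = subst (+ 0 ℤ.≤_) (ℤ.pos-* n n) (ℤ.+≤+ z≤n)
    sq≥0 -[1+ n ] = ℤ.+≤+ z≤n
    eqA : + A ≡ + D ℤ.* (+ y ℤ.* + y) ℤ.- + x ℤ.* + x
    eqA = trans (solve 2 (λ a x → a := (x :* x :+ a) :- x :* x) refl (+ A) (+ x))
      (cong (ℤ._- + x ℤ.* + x) (trans (cong (ℤ._+ + A) (sym (ℤ.pos-* x x))) (trans (cong +_ below)
        (trans (ℤ.pos-* D (y ℕ.* y)) (cong (+ D ℤ.*_) (ℤ.pos-* y y))))))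
    eqB : + B ≡ + x′ ℤ.* + x′ ℤ.- + D ℤ.* (+ y′ ℤ.* + y′)
    eqB = trans (solve 3 (λ b d y → b := (d :* (y :* y) :+ b) :- d :* (y :* y)) refl (+ B) (+ D) (+ y′))
      (cong (ℤ._- + D ℤ.* (+ y′ ℤ.* + y′)) (trans (cong (ℤ._+ + B)
        (sym (trans (ℤ.pos-* D (y′ ℕ.* y′)) (cong (+ D ℤ.*_) (ℤ.pos-* y′ y′)))))
        (trans (cong +_ above) (ℤ.pos-* x′ x′))))
    det : + x′ ℤ.* + y ≡ + x ℤ.* + y′ ℤ.+ + 1
    det = trans (sym (ℤ.pos-* x′ y)) (trans (cong +_ adjacent) (cong (ℤ._+ + 1) (ℤ.pos-* x y′)))
    identity : + A ℤ.* + B ℤ.+ C ℤ.* C ≡ + D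
    identity = trans (cong₂ (λ a b → a ℤ.* b ℤ.+ C ℤ.* C) eqA eqB)
      (trans (solve 5 (λ d x y u v →
          (d :* (y :* y) :- x :* x) :* (u :* u :- d :* (v :* v)) :+ (x :* u :- d :* (y :* v)) :* (x :* u :- d :* (y :* v))
          := d :* ((u :* y :- x :* v) :* (u :* y :- x :* v))) refl (+ D) (+ x) (+ y) (+ x′) (+ y′))
      (trans (cong (λ e → + D ℤ.* ((e ℤ.- + x ℤ.* + y′) ℤ.* (e ℤ.- + x ℤ.* + y′))) det)
        (solve 2 (λ d e → d :* ((e :+ con (+ 1) :- e) :* (e :+ con (+ 1) :- e)) := d) refl (+ D) (+ x ℤ.* + y′))))

  record Convergent (D T : ℕ) : Set where
    field
      {x y defect} : ℕ
      1≤y      : 1 ℕ.≤ y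
      y≤T      : y ℕ.≤ T
      T≤2y     : T ℕ.≤ 2 ℕ.* y
      1≤defect : 1 ℕ.≤ defect
      defect≤D : defect ℕ.≤ D
      pell     : x ℕ.* x ℕ.+ defect ≡ D ℕ.* (y ℕ.* y) ⊎ D ℕ.* (y ℕ.* y) ℕ.+ defect ≡ x ℕ.* x

  -- Since y + y′ > T, the neighbour with the larger denominator has denominator at least T/2. Both
  -- defects are positive integers with product at most D, so each of them is at most D.
  convergent : ∀ {D} → 1 ℕ.≤ D → IrrationalRoot D → ∀ T → 1 ℕ.≤ T → Convergent D T
  convergent {D} 1≤D irr (suc T) _ with bracket D 1≤D irr T
  ... | b = choose (ℕ.≤-total y′ y)
    where
    open Bracket b
    choose : y′ ℕ.≤ y ⊎ y ℕ.≤ y′ → Convergent D (suc T)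
    choose (inj₁ y′≤y) = record
      { x = x ; 1≤y = 1≤y ; y≤T = y≤T ; 1≤defect = 1≤A ; pell = inj₁ below
      ; T≤2y = ℕ.≤-trans (ℕ.<⇒≤ T<y+y′) (ℕ.+-monoʳ-≤ y (ℕ.m≤n⇒m≤n+o 0 y′≤y))
      ; defect≤D = ℕ.≤-trans (ℕ.m≤m*n A B {{ℕ.>-nonZero 1≤B}}) (defects≤ b) }
    choose (inj₂ y≤y′) = record
      { x = x′ ; 1≤y = 1≤y′ ; y≤T = y′≤T ; 1≤defect = 1≤B ; pell = inj₂ above
      ; T≤2y = ℕ.≤-trans (ℕ.<⇒≤ T<y+y′) (ℕ.+-mono-≤ y≤y′ (ℕ.m≤m+n y′ 0))
      ; defect≤D = ℕ.≤-trans (ℕ.m≤n*m B A {{ℕ.>-nonZero 1≤A}}) (defects≤ b) }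

-- Rational approximations of square roots and equality in the limit

module Limits where
  open import Data.Rational hiding (NonZero)
  open import Data.Rational.Properties
  open RationalArithmetic
  open Convergents

  /suc-* : ∀ t m → (+ t / suc m) * ⟪ suc m ⟫ ≡ ⟪ t ⟫
  /suc-* t m = toℚᵘ-injective (begin
    toℚᵘ ((+ t / suc m) * ⟪ suc m ⟫)            ≈⟨ toℚᵘ-homo-* (+ t / suc m) ⟪ suc m ⟫ ⟩
    toℚᵘ (+ t / suc m) ℚᵘ.* toℚᵘ ⟪ suc m ⟫      ≈⟨ ℚᵘ.*-cong (toℚᵘ-fromℚᵘ (ℚᵘ.mkℚᵘ (+ t) m)) (toℚᵘ-ι (+ suc m)) ⟩
    ℚᵘ.mkℚᵘ (+ t) m ℚᵘ.* ℚᵘ.mkℚᵘ (+ suc m) 0    ≈⟨ ℚᵘ.*≡* (solve 2 (λ a b → a :* b :* con (+ 1) := a :* (b :* con (+ 1))) refl (+ t) (+ suc m)) ⟩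
    ℚᵘ.mkℚᵘ (+ t) 0                             ≈⟨ toℚᵘ-ι (+ t) ⟨
    toℚᵘ ⟪ t ⟫                                  ∎)
    where
    open ℚᵘ.≃-Reasoning
    open ℤ.+-*-Solver

  0<⟪suc⟫ : ∀ m → 0ℚ < ⟪ suc m ⟫
  0<⟪suc⟫ m = <-≤-trans 0<1 (subst (_≤ ⟪ suc m ⟫) ι1≡1 (⟪⟫-mono (s≤s (z≤n {m}))))

  ⟪2⟫ : ⟪ 2 ⟫ ≡ 1ℚ + 1ℚ
  ⟪2⟫ = ι≡/1 (+ 2)

  1≤⟪⟫ : ∀ {n} → 1 ℕ.≤ n → 1ℚ ≤ ⟪ n ⟫
  1≤⟪⟫ {n} 1≤n = subst (_≤ ⟪ n ⟫) ι1≡1 (⟪⟫-mono 1≤n)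

  opaque
    sqrtApprox : ℕ → ℕ → ℚ
    sqrtApprox b m = rootSeq 2 b 1 m

    sqrtApprox≡ : ∀ b m → rootSeq 2 b 1 m ≡ sqrtApprox b m
    sqrtApprox≡ b m = refl

  module SqrtApprox (b : ℕ) (1≤b : 1 ℕ.≤ b) (m : ℕ) where
    private
      M = suc m
      t = iroot 2 (b ℕ.* M ℕ.^ 2 ℕ./ 1)
      r = sqrtApprox b m
      open +-*-Solver

      sq : ∀ x → x ℕ.^ 2 ≡ x ℕ.* x
      sq x = cong (x ℕ.*_) (ℕ.*-identityʳ x)

      t²≤ : t ℕ.* t ℕ.≤ b ℕ.* (M ℕ.* M)
      t²≤ = subst₂ ℕ._≤_ (sq t) (trans (ℕ.n/1≡n _) (cong (b ℕ.*_) (sq M))) (iroot-lower 2 (b ℕ.* M ℕ.^ 2 ℕ./ 1))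

      <t+1² : b ℕ.* (M ℕ.* M) ℕ.< suc t ℕ.* suc t
      <t+1² = subst₂ ℕ._<_ (trans (ℕ.n/1≡n _) (cong (b ℕ.*_) (sq M))) (sq (suc t)) (iroot-upper 2 (b ℕ.* M ℕ.^ 2 ℕ./ 1))

      rM : r * ⟪ M ⟫ ≡ ⟪ t ⟫
      rM = trans (cong (_* ⟪ M ⟫) (sym (sqrtApprox≡ b m))) (/suc-* t m)

      r²M² : r * r * (⟪ M ⟫ * ⟪ M ⟫) ≡ ⟪ t ℕ.* t ⟫
      r²M² = trans (solve 2 (λ r m → r :* r :* (m :* m) := (r :* m) :* (r :* m)) refl r ⟪ M ⟫)
        (trans (cong₂ _*_ rM rM) (sym (⟪⟫-* t t)))

      bM² : ⟪ b ⟫ * (⟪ M ⟫ * ⟪ M ⟫) ≡ ⟪ b ℕ.* (M ℕ.* M) ⟫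
      bM² = sym (trans (⟪⟫-* b (M ℕ.* M)) (cong (⟪ b ⟫ *_) (⟪⟫-* M M)))

      0<M : 0ℚ < ⟪ M ⟫
      0<M = 0<⟪suc⟫ m

      M≤t : M ℕ.≤ t
      M≤t = ℕ.≮⇒≥ λ t<M → ℕ.<-irrefl refl (ℕ.<-≤-trans <t+1²
        (ℕ.≤-trans (ℕ.*-mono-≤ t<M t<M) (ℕ.m≤n*m (M ℕ.* M) b {{ℕ.>-nonZero 1≤b}})))

    r²≤b : r * r ≤ ⟪ b ⟫
    r²≤b = *-cancelʳ (⟪ M ⟫ * ⟪ M ⟫) (0<* 0<M 0<M) (subst₂ _≤_ (sym r²M²) (sym bM²) (⟪⟫-mono t²≤))

    1≤r : 1ℚ ≤ r
    1≤r = *-cancelʳ ⟪ M ⟫ 0<M (subst₂ _≤_ (sym (*-identityˡ ⟪ M ⟫)) (sym rM) (⟪⟫-mono M≤t))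

    0≤r : 0ℚ ≤ r
    0≤r = ≤-trans 0≤1 1≤r

    r≤b : r ≤ ⟪ b ⟫
    r≤b = ≤-trans (≤*1≤ 0≤r 1≤r) r²≤b

    -- As t is the floor of M √b, the inequality b M² < (t + 1)² gives (b - r²) M² ≤ 2 t = 2 r M.
    -- Division by M leaves 2 r, which is at most 2 b.
    r²-near : ∣ r * r - ⟪ b ⟫ ∣ * ⟪ M ⟫ ≤ ⟪ 2 ℕ.* b ⟫
    r²-near = begin
      ∣ r * r - ⟪ b ⟫ ∣ * ⟪ M ⟫  ≡⟨ cong (_* ⟪ M ⟫) (trans (∣p-q∣≡∣q-p∣ (r * r) ⟪ b ⟫) (0≤p⇒∣p∣≡p (0≤- r²≤b))) ⟩
      (⟪ b ⟫ - r * r) * ⟪ M ⟫    ≤⟨ *-cancelʳ ⟪ M ⟫ 0<M (≤-cert (⟪ t ℕ.+ t ⟫ + ⟪ t ℕ.* t ⟫ - ⟪ b ℕ.* (M ℕ.* M) ⟫) (0≤- below) certificate) ⟩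
      r + r                      ≤⟨ +-mono-≤ r≤b r≤b ⟩
      ⟪ b ⟫ + ⟪ b ⟫              ≡⟨ sym (⟪⟫-+ b b) ⟩
      ⟪ b ℕ.+ b ⟫                ≡⟨ cong (λ z → ⟪ b ℕ.+ z ⟫) (sym (ℕ.+-identityʳ b)) ⟩
      ⟪ 2 ℕ.* b ⟫                ∎
      where
      open ≤-Reasoning
      below : ⟪ b ℕ.* (M ℕ.* M) ⟫ ≤ ⟪ t ℕ.+ t ⟫ + ⟪ t ℕ.* t ⟫
      below = subst (⟪ b ℕ.* (M ℕ.* M) ⟫ ≤_) (⟪⟫-+ (t ℕ.+ t) (t ℕ.* t)) (⟪⟫-mono (ℕ.≤-pred
        (subst (b ℕ.* (M ℕ.* M) ℕ.<_) (cong suc (trans (cong (t ℕ.+_) (ℕ.*-suc t t)) (sym (ℕ.+-assoc t t (t ℕ.* t))))) <t+1²)))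
      certificate : (r + r) * ⟪ M ⟫ ≡ (⟪ b ⟫ - r * r) * ⟪ M ⟫ * ⟪ M ⟫ + (⟪ t ℕ.+ t ⟫ + ⟪ t ℕ.* t ⟫ - ⟪ b ℕ.* (M ℕ.* M) ⟫)
      certificate = trans (solve 3 (λ r b m → (r :+ r) :* m :=
          (b :- r :* r) :* m :* m :+ (r :* m :+ r :* m :+ r :* r :* (m :* m) :- b :* (m :* m))) refl r ⟪ b ⟫ ⟪ M ⟫)
        (cong (λ z → (⟪ b ⟫ - r * r) * ⟪ M ⟫ * ⟪ M ⟫ + z)
          (cong₂ _-_ (cong₂ _+_ (trans (cong₂ _+_ rM rM) (sym (⟪⟫-+ t t))) r²M²) bM²))

  infix 4 _≈_

  -- Equality of the limits, with rate of convergence O(1/m).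
  record _≈_ (F G : ℕ → ℚ) : Set where
    constructor near
    field
      rate  : ℕ
      close : ∀ m → ∣ F m - G m ∣ * ⟪ suc m ⟫ ≤ ⟪ rate ⟫

  record Bounded (F : ℕ → ℚ) : Set where
    constructor within
    field
      bound : ℕ
      le    : ∀ m → ∣ F m ∣ ≤ ⟪ bound ⟫

  ≡⇒≈ : ∀ {F G} → (∀ m → F m ≡ G m) → F ≈ G
  ≡⇒≈ {F} {G} eq = near 0 λ m → ≤-reflexive (trans
    (cong (λ z → ∣ z ∣ * ⟪ suc m ⟫) (trans (cong (_- G m) (eq m)) (+-inverseʳ (G m))))
    (trans (*-zeroˡ ⟪ suc m ⟫) (sym ι0≡0)))

  ≈-sym : ∀ {F G} → F ≈ G → G ≈ F
  ≈-sym {F} {G} (near K h) = near K λ m → subst (λ z → z * ⟪ suc m ⟫ ≤ ⟪ K ⟫) (∣p-q∣≡∣q-p∣ (F m) (G m)) (h m)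

  ≈-add : ∀ {F G F′ G′} H H′ → (∀ m → ∣ H m - H′ m ∣ ≤ ∣ F m - G m ∣ + ∣ F′ m - G′ m ∣) → F ≈ G → F′ ≈ G′ → H ≈ H′
  ≈-add {F} {G} {F′} {G′} H H′ le (near K h) (near K′ h′) = near (K ℕ.+ K′) λ m → begin
    ∣ H m - H′ m ∣ * ⟪ suc m ⟫                                       ≤⟨ *-monoˡ ⟪ suc m ⟫ (0≤⟪⟫ (suc m)) (le m) ⟩
    (∣ F m - G m ∣ + ∣ F′ m - G′ m ∣) * ⟪ suc m ⟫                    ≡⟨ *-distribʳ-+ ⟪ suc m ⟫ ∣ F m - G m ∣ ∣ F′ m - G′ m ∣ ⟩
    ∣ F m - G m ∣ * ⟪ suc m ⟫ + ∣ F′ m - G′ m ∣ * ⟪ suc m ⟫          ≤⟨ +-mono-≤ (h m) (h′ m) ⟩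
    ⟪ K ⟫ + ⟪ K′ ⟫                                                   ≡⟨ sym (⟪⟫-+ K K′) ⟩
    ⟪ K ℕ.+ K′ ⟫                                                     ∎
    where open ≤-Reasoning

  ≈-trans : ∀ {F G H} → F ≈ G → G ≈ H → F ≈ H
  ≈-trans {F} {G} {H} f g = ≈-add {F} {G} {G} {H} F H (λ m → ∣-∣-triangle (F m) (G m) (H m)) f g

  ≈-+ : ∀ {F G F′ G′} → F ≈ G → F′ ≈ G′ → (λ m → F m + F′ m) ≈ (λ m → G m + G′ m)
  ≈-+ {F} {G} {F′} {G′} = ≈-add {F} {G} {F′} {G′} (λ m → F m + F′ m) (λ m → G m + G′ m) λ m →
    subst (λ z → ∣ z ∣ ≤ ∣ F m - G m ∣ + ∣ F′ m - G′ m ∣)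
      (solve 4 (λ f g f′ g′ → (f :- g) :+ (f′ :- g′) := (f :+ f′) :- (g :+ g′)) refl (F m) (G m) (F′ m) (G′ m))
      (∣p+q∣≤∣p∣+∣q∣ (F m - G m) (F′ m - G′ m))
    where open +-*-Solver

  ≈-scale : ∀ {F G C} → Bounded C → F ≈ G → (λ m → C m * F m) ≈ (λ m → C m * G m)
  ≈-scale {F} {G} {C} (within B hB) (near K h) = near (B ℕ.* K) λ m → begin
    ∣ C m * F m - C m * G m ∣ * ⟪ suc m ⟫      ≡⟨ cong (λ z → ∣ z ∣ * ⟪ suc m ⟫) (solve 3 (λ c f g → c :* f :- c :* g := c :* (f :- g)) refl (C m) (F m) (G m)) ⟩
    ∣ C m * (F m - G m) ∣ * ⟪ suc m ⟫          ≡⟨ cong (_* ⟪ suc m ⟫) (∣p*q∣≡∣p∣*∣q∣ (C m) (F m - G m)) ⟩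
    ∣ C m ∣ * ∣ F m - G m ∣ * ⟪ suc m ⟫        ≡⟨ *-assoc ∣ C m ∣ ∣ F m - G m ∣ ⟪ suc m ⟫ ⟩
    ∣ C m ∣ * (∣ F m - G m ∣ * ⟪ suc m ⟫)      ≤⟨ *-mono (0≤∣p∣ (C m)) (0≤* (0≤∣p∣ (F m - G m)) (0≤⟪⟫ (suc m))) (hB m) (h m) ⟩
    ⟪ B ⟫ * ⟪ K ⟫                              ≡⟨ sym (⟪⟫-* B K) ⟩
    ⟪ B ℕ.* K ⟫                                ∎
    where
    open ≤-Reasoning
    open +-*-Solver

  ≈-* : ∀ {F G F′ G′} → Bounded F → Bounded G′ → F ≈ G → F′ ≈ G′ → (λ m → F m * F′ m) ≈ (λ m → G m * G′ m)
  ≈-* {F} {G} {F′} {G′} bF bG′ h h′ = ≈-trans {G = λ m → F m * G′ m} (≈-scale {F′} {G′} {F} bF h′)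
    (≈-trans {G = λ m → G′ m * F m} (≡⇒≈ (λ m → *-comm (F m) (G′ m)))
    (≈-trans {G = λ m → G′ m * G m} (≈-scale {F} {G} {G′} bG′ h) (≡⇒≈ (λ m → *-comm (G′ m) (G m)))))

  bounded-+ : ∀ {F G} → Bounded F → Bounded G → Bounded (λ m → F m + G m)
  bounded-+ {F} {G} (within A hA) (within B hB) = within (A ℕ.+ B) λ m → ≤-trans (∣p+q∣≤∣p∣+∣q∣ (F m) (G m))
    (subst (∣ F m ∣ + ∣ G m ∣ ≤_) (sym (⟪⟫-+ A B)) (+-mono-≤ (hA m) (hB m)))

  bounded-* : ∀ {F G} → Bounded F → Bounded G → Bounded (λ m → F m * G m)
  bounded-* {F} {G} (within A hA) (within B hB) = within (A ℕ.* B) λ m → subst₂ _≤_ (sym (∣p*q∣≡∣p∣*∣q∣ (F m) (G m))) (sym (⟪⟫-* A B))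
    (*-mono (0≤∣p∣ (F m)) (0≤∣p∣ (G m)) (hA m) (hB m))

  bounded-const : ∀ i → Bounded (λ _ → ι i)
  bounded-const i = within ℤ.∣ i ∣ λ _ → ≤-reflexive (∣ι∣ i)

  record Eventually (P : ℕ → Set) : Set where
    constructor from
    field
      start : ℕ
      holds : ∀ m → start ℕ.≤ m → P m

  eventually-× : ∀ {P Q} → Eventually P → Eventually Q → Eventually (λ m → P m × Q m)
  eventually-× (from M p) (from N q) = from (M ℕ.⊔ N) λ m le →
    p m (ℕ.m⊔n≤o⇒m≤o M N le) , q m (ℕ.m⊔n≤o⇒n≤o M N le)

  eventually-map : ∀ {P Q} → (∀ m → P m → Q m) → Eventually P → Eventually Q
  eventually-map f (from N p) = from N λ m le → f m (p m le)

  -- The start is `suc K` times k, where K is the rate; the successor gives a positive factor to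
  -- cancel even when the rate is 0.
  ≈⇒eventually : ∀ {F G} → F ≈ G → ∀ k → Eventually (λ m → ∣ F m - G m ∣ * ⟪ k ⟫ ≤ 1ℚ)
  ≈⇒eventually {F} {G} (near K h) k = from (suc K ℕ.* k) λ m le → *-cancelʳ ⟪ suc K ⟫ (0<⟪suc⟫ K) (begin
    ∣ F m - G m ∣ * ⟪ k ⟫ * ⟪ suc K ⟫     ≡⟨ *-assoc ∣ F m - G m ∣ ⟪ k ⟫ ⟪ suc K ⟫ ⟩
    ∣ F m - G m ∣ * (⟪ k ⟫ * ⟪ suc K ⟫)   ≡⟨ cong (∣ F m - G m ∣ *_) (trans (*-comm ⟪ k ⟫ ⟪ suc K ⟫) (sym (⟪⟫-* (suc K) k))) ⟩
    ∣ F m - G m ∣ * ⟪ suc K ℕ.* k ⟫       ≤⟨ *-monoʳ ∣ F m - G m ∣ (0≤∣p∣ (F m - G m)) (⟪⟫-mono (ℕ.m≤n⇒m≤1+n le)) ⟩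
    ∣ F m - G m ∣ * ⟪ suc m ⟫             ≤⟨ h m ⟩
    ⟪ K ⟫                                 ≤⟨ ⟪⟫-mono (ℕ.n≤1+n K) ⟩
    ⟪ suc K ⟫                             ≡⟨ sym (*-identityˡ ⟪ suc K ⟫) ⟩
    1ℚ * ⟪ suc K ⟫                        ∎)
    where open ≤-Reasoning

-- A formal multiquadratic ring and its conjugations

module MultiquadraticRing where
  open import Data.Rational hiding (NonZero)
  open import Data.Rational.Properties
  open RationalArithmetic
  open Convergents
  open Limits

  root² : ∀ b → 1 ℕ.≤ b → (λ m → sqrtApprox b m * sqrtApprox b m) ≈ (λ _ → ⟪ b ⟫)
  root² b 1≤b = near (2 ℕ.* b) λ m → SqrtApprox.r²-near b 1≤b m

  bounded-sqrt : ∀ b → 1 ℕ.≤ b → Bounded (sqrtApprox b)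
  bounded-sqrt b 1≤b = within b λ m → subst (_≤ ⟪ b ⟫) (sym (0≤p⇒∣p∣≡p (SqrtApprox.0≤r b 1≤b m))) (SqrtApprox.r≤b b 1≤b m)

  -- ℤ[√p₀, …, √p_{j-1}]; a pair (a , b) stands for a + b √p_{j-1}.
  Multiquadratic : ℕ → Set
  Multiquadratic zero    = ℤ
  Multiquadratic (suc j) = Multiquadratic j × Multiquadratic j

  infixl 6 _⊞_
  infixl 7 _⊠_ _•_

  _⊞_ : ∀ {j} → Multiquadratic j → Multiquadratic j → Multiquadratic j
  _⊞_ {zero}  a b             = a ℤ.+ b
  _⊞_ {suc j} (a , b) (c , d) = a ⊞ c , b ⊞ d

  _•_ : ∀ {j} → ℤ → Multiquadratic j → Multiquadratic j
  _•_ {zero}  n a       = n ℤ.* a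
  _•_ {suc j} n (a , b) = n • a , n • b

  _⊠_ : ∀ {j} → Multiquadratic j → Multiquadratic j → Multiquadratic j
  _⊠_ {zero}  a b             = a ℤ.* b
  _⊠_ {suc j} (a , b) (c , d) = (a ⊠ c) ⊞ (+ prime j • (b ⊠ d)) , (a ⊠ d) ⊞ (b ⊠ c)

  -- The element n √D_S.
  monomial : ∀ {j} → Vec Bool j → ℤ → Multiquadratic j
  monomial []          n = n
  monomial (false ∷ S) n = monomial S n , monomial S (+ 0)
  monomial (true ∷ S)  n = monomial S (+ 0) , monomial S n

  none : ∀ {j} → Vec Bool j
  none = replicate _ false

  constant : ∀ {j} → ℤ → Multiquadratic j
  constant = monomial none

  signed : Bool → ℚ → ℚ
  signed false x = x
  signed true  x = - x

  ∣signed∣ : ∀ s x → ∣ signed s x ∣ ≡ ∣ x ∣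
  ∣signed∣ false x = refl
  ∣signed∣ true  x = ∣-p∣≡∣p∣ x

  signed² : ∀ s x → signed s x * signed s x ≡ x * x
  signed² false x = refl
  signed² true  x = solve 1 (λ x → :- x :* :- x := x :* x) refl x
    where open +-*-Solver

  signed-* : ∀ s t x y → signed s x * signed t y ≡ signed (s xor t) (x * y)
  signed-* false false x y = refl
  signed-* false true  x y = sym (neg-distribʳ-* x y)
  signed-* true  false x y = sym (neg-distribˡ-* x y)
  signed-* true  true  x y = solve 2 (λ x y → :- x :* :- y := x :* y) refl x y
    where open +-*-Solver

  θ : Bool → ℕ → ℕ → ℚ
  θ s j m = signed s (sqrtApprox (prime j) m)

  θ² : ∀ s j → (λ m → θ s j m * θ s j m) ≈ (λ _ → ⟪ prime j ⟫)
  θ² s j = ≈-trans (≡⇒≈ λ m → signed² s (sqrtApprox (prime j) m)) (root² (prime j) (1≤prime j))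

  bounded-signed : ∀ {F} s → Bounded F → Bounded (λ m → signed s (F m))
  bounded-signed {F} s (within B h) = within B λ m → subst (_≤ ⟪ B ⟫) (sym (∣signed∣ s (F m))) (h m)

  bounded-θ : ∀ s j → Bounded (θ s j)
  bounded-θ s j = bounded-signed s (bounded-sqrt (prime j) (1≤prime j))

  1≤∣θ∣ : ∀ s j m → 1ℚ ≤ ∣ θ s j m ∣
  1≤∣θ∣ s j m = subst (1ℚ ≤_) (sym (∣signed∣ s (sqrtApprox (prime j) m)))
    (≤-trans (SqrtApprox.1≤r (prime j) (1≤prime j) m) (p≤∣p∣ (sqrtApprox (prime j) m)))

  -- The conjugate of an element under the embedding √p_i ↦ ±√p_i given by σ.
  eval : ∀ {j} → Vec Bool j → Multiquadratic j → ℕ → ℚ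
  eval []              a       m = ι a
  eval {suc j} (s ∷ σ) (a , b) m = eval σ a m + θ s j m * eval σ b m

  eval-⊞ : ∀ {j} (σ : Vec Bool j) u v m → eval σ (u ⊞ v) m ≡ eval σ u m + eval σ v m
  eval-⊞ [] a b m = ι-+ a b
  eval-⊞ {suc j} (s ∷ σ) (a , b) (c , d) m =
    trans (cong₂ (λ x y → x + θ s j m * y) (eval-⊞ σ a c m) (eval-⊞ σ b d m))
      (solve 5 (λ t a b c d → (a :+ c) :+ t :* (b :+ d) := (a :+ t :* b) :+ (c :+ t :* d)) refl
        (θ s j m) (eval σ a m) (eval σ b m) (eval σ c m) (eval σ d m))
    where open +-*-Solver

  eval-• : ∀ {j} (σ : Vec Bool j) n u m → eval σ (n • u) m ≡ ι n * eval σ u m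
  eval-• [] n a m = ι-* n a
  eval-• {suc j} (s ∷ σ) n (a , b) m =
    trans (cong₂ (λ x y → x + θ s j m * y) (eval-• σ n a m) (eval-• σ n b m))
      (solve 4 (λ t n a b → n :* a :+ t :* (n :* b) := n :* (a :+ t :* b)) refl
        (θ s j m) (ι n) (eval σ a m) (eval σ b m))
    where open +-*-Solver

  bounded-eval : ∀ {j} (σ : Vec Bool j) u → Bounded (eval σ u)
  bounded-eval []              a       = bounded-const a
  bounded-eval {suc j} (s ∷ σ) (a , b) =
    bounded-+ (bounded-eval σ a) (bounded-* (bounded-θ s j) (bounded-eval σ b))

  -- Multiplicative only in the limit, because the square of `θ s j m` merely tends to `prime j`.
  -- Apart from that replacement and the induction, both sides agree as polynomials.
  eval-⊠ : ∀ {j} (σ : Vec Bool j) u v → eval σ (u ⊠ v) ≈ (λ m → eval σ u m * eval σ v m)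
  eval-⊠ [] a b = ≡⇒≈ λ _ → ι-* a b
  eval-⊠ {suc j} (s ∷ σ) (a , b) (c , d) = ≈-trans (≡⇒≈ expand)
    (≈-trans (≈-+ (≈-+ (eval-⊠ σ a c)
                       (≈-* (bounded-const (+ prime j)) (bounded-* (bounded-eval σ b) (bounded-eval σ d))
                            (≈-sym (θ² s j)) (eval-⊠ σ b d)))
                  (≈-scale (bounded-θ s j) (≈-+ (eval-⊠ σ a d) (eval-⊠ σ b c))))
             (≡⇒≈ collect))
    where
    open +-*-Solver
    T = θ s j
    expand : ∀ m → eval (s ∷ σ) ((a , b) ⊠ (c , d)) m ≡
      (eval σ (a ⊠ c) m + ⟪ prime j ⟫ * eval σ (b ⊠ d) m) + T m * (eval σ (a ⊠ d) m + eval σ (b ⊠ c) m)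
    expand m = cong₂ (λ x y → x + T m * y)
      (trans (eval-⊞ σ (a ⊠ c) (+ prime j • (b ⊠ d)) m) (cong (_+_ (eval σ (a ⊠ c) m)) (eval-• σ (+ prime j) (b ⊠ d) m)))
      (eval-⊞ σ (a ⊠ d) (b ⊠ c) m)
    collect : ∀ m →
      (eval σ a m * eval σ c m + T m * T m * (eval σ b m * eval σ d m)) + T m * (eval σ a m * eval σ d m + eval σ b m * eval σ c m)
      ≡ (eval σ a m + T m * eval σ b m) * (eval σ c m + T m * eval σ d m)
    collect m = solve 5 (λ t a b c d →
        (a :* c :+ t :* t :* (b :* d)) :+ t :* (a :* d :+ b :* c) := (a :+ t :* b) :* (c :+ t :* d)) refl
      (T m) (eval σ a m) (eval σ b m) (eval σ c m) (eval σ d m)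

  -- Approximates √D_S by a product over the primes in S, since this is what `eval` yields exactly
  -- on a monomial. It agrees with `sqrtApprox (rad S)` only in the limit.
  sqrtProduct : ∀ {j} → Vec Bool j → ℕ → ℚ
  sqrtProduct []          m = 1ℚ
  sqrtProduct (false ∷ S) m = sqrtProduct S m
  sqrtProduct {suc j} (true ∷ S) m = sqrtApprox (prime j) m * sqrtProduct S m

  -- The sign of √D_S under the embedding σ: the parity of the intersection of σ and S, a character
  -- in either argument.
  χ : ∀ {j} → Vec Bool j → Vec Bool j → Bool
  χ []      []          = false
  χ (s ∷ σ) (false ∷ S) = χ σ S
  χ (s ∷ σ) (true ∷ S)  = s xor χ σ S

  1≤sqrtProduct : ∀ {j} (S : Vec Bool j) m → 1ℚ ≤ sqrtProduct S m
  1≤sqrtProduct []          m = ≤-refl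
  1≤sqrtProduct (false ∷ S) m = 1≤sqrtProduct S m
  1≤sqrtProduct {suc j} (true ∷ S) m = ≤-trans (1≤sqrtProduct S m) (subst (_≤ sqrtApprox (prime j) m * sqrtProduct S m)
    (*-identityˡ (sqrtProduct S m))
    (*-monoˡ (sqrtProduct S m) (≤-trans 0≤1 (1≤sqrtProduct S m)) (SqrtApprox.1≤r (prime j) (1≤prime j) m)))

  sqrtProduct² : ∀ {j} (S : Vec Bool j) → (λ m → sqrtProduct S m * sqrtProduct S m) ≈ (λ _ → ⟪ rad S ⟫)
  bounded-sqrtProduct : ∀ {j} (S : Vec Bool j) → Bounded (sqrtProduct S)

  sqrtProduct² []          = ≡⇒≈ λ _ → trans (*-identityˡ 1ℚ) (sym ι1≡1)
  sqrtProduct² (false ∷ S) = sqrtProduct² S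
  sqrtProduct² {suc j} (true ∷ S) = ≈-trans (≡⇒≈ λ m →
      solve 2 (λ r s → (r :* s) :* (r :* s) := (r :* r) :* (s :* s)) refl (sqrtApprox (prime j) m) (sqrtProduct S m))
    (≈-trans (≈-* (bounded-* (bounded-sqrt (prime j) (1≤prime j)) (bounded-sqrt (prime j) (1≤prime j))) (bounded-const (+ rad S))
              (root² (prime j) (1≤prime j)) (sqrtProduct² S))
             (≡⇒≈ λ _ → sym (⟪⟫-* (prime j) (rad S))))
    where open +-*-Solver

  bounded-sqrtProduct []          = within 1 λ m → ≤-reflexive (trans (0≤p⇒∣p∣≡p 0≤1) (sym ι1≡1))
  bounded-sqrtProduct (false ∷ S) = bounded-sqrtProduct S
  bounded-sqrtProduct {suc j} (true ∷ S) = bounded-* (bounded-sqrt (prime j) (1≤prime j)) (bounded-sqrtProduct S)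

  sqrtProduct≤rad : ∀ {j} (S : Vec Bool j) m → sqrtProduct S m ≤ ⟪ rad S ⟫
  sqrtProduct≤rad [] m = ≤-reflexive (sym ι1≡1)
  sqrtProduct≤rad (false ∷ S) m = sqrtProduct≤rad S m
  sqrtProduct≤rad {suc j} (true ∷ S) m = subst (sqrtApprox (prime j) m * sqrtProduct S m ≤_) (sym (⟪⟫-* (prime j) (rad S)))
    (*-mono (SqrtApprox.0≤r (prime j) (1≤prime j) m) (≤-trans 0≤1 (1≤sqrtProduct S m))
            (SqrtApprox.r≤b (prime j) (1≤prime j) m) (sqrtProduct≤rad S m))

  0+t*0 : ∀ t → 0ℚ + t * 0ℚ ≡ 0ℚ
  0+t*0 = solve 1 (λ t → con 0ℚ :+ t :* con 0ℚ := con 0ℚ) refl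
    where open +-*-Solver

  eval-monomial0 : ∀ {j} (σ S : Vec Bool j) m → eval σ (monomial S (+ 0)) m ≡ 0ℚ
  eval-monomial0 [] [] m = ι0≡0
  eval-monomial0 (s ∷ σ) (false ∷ S) m = trans
    (cong₂ (λ x y → x + θ s _ m * y) (eval-monomial0 σ S m) (eval-monomial0 σ S m)) (0+t*0 (θ s _ m))
  eval-monomial0 (s ∷ σ) (true ∷ S) m = trans
    (cong₂ (λ x y → x + θ s _ m * y) (eval-monomial0 σ S m) (eval-monomial0 σ S m)) (0+t*0 (θ s _ m))
  eval-monomial : ∀ {j} (σ S : Vec Bool j) n m → eval σ (monomial S n) m ≡ ι n * signed (χ σ S) (sqrtProduct S m)
  eval-monomial [] [] n m = sym (*-identityʳ (ι n))
  eval-monomial {suc j} (s ∷ σ) (false ∷ S) n m = trans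
    (cong₂ (λ x y → x + θ s j m * y) (eval-monomial σ S n m) (eval-monomial0 σ S m))
    (solve 2 (λ t x → x :+ t :* con 0ℚ := x) refl (θ s j m) (ι n * signed (χ σ S) (sqrtProduct S m)))
    where open +-*-Solver
  eval-monomial {suc j} (s ∷ σ) (true ∷ S) n m = trans
    (cong₂ (λ x y → x + θ s j m * y) (eval-monomial0 σ S m) (eval-monomial σ S n m))
    (trans (solve 3 (λ t n x → con 0ℚ :+ t :* (n :* x) := n :* (t :* x)) refl (θ s j m) (ι n) (signed (χ σ S) (sqrtProduct S m)))
      (cong (ι n *_) (signed-* s (χ σ S) (sqrtApprox (prime j) m) (sqrtProduct S m))))
    where open +-*-Solver

  χ-∅ʳ : ∀ {j} (σ : Vec Bool j) → χ σ none ≡ false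
  χ-∅ʳ []      = refl
  χ-∅ʳ (s ∷ σ) = χ-∅ʳ σ

  χ-∅ˡ : ∀ {j} (S : Vec Bool j) → χ none S ≡ false
  χ-∅ˡ []          = refl
  χ-∅ˡ (false ∷ S) = χ-∅ˡ S
  χ-∅ˡ (true ∷ S)  = χ-∅ˡ S

  sqrtProduct-∅ : ∀ j m → sqrtProduct (none {j}) m ≡ 1ℚ
  sqrtProduct-∅ zero    m = refl
  sqrtProduct-∅ (suc j) m = sqrtProduct-∅ j m

  eval-constant : ∀ {j} (σ : Vec Bool j) n m → eval σ (constant n) m ≡ ι n
  eval-constant {j} σ n m = trans (eval-monomial σ none n m) (trans
    (cong₂ (λ s x → ι n * signed s x) (χ-∅ʳ σ) (sqrtProduct-∅ j m)) (*-identityʳ (ι n)))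

  Coefficients≤ : ∀ {j} → ℚ → Multiquadratic j → Set
  Coefficients≤ {zero}  B a       = ∣ ι a ∣ ≤ B
  Coefficients≤ {suc j} B (a , b) = Coefficients≤ B a × Coefficients≤ B b

  -- Conjugation is inverted one root at a time: in a + b √p, the part a is the half-sum and b √p
  -- the half-difference of the values at ±√p, and √p ≥ 1. So the same B survives every level,
  -- whereas multiplying out the product defining u_T would only bound its coefficients by a power
  -- of T.
  coefficients≤ : ∀ {j} (u : Multiquadratic j) B →
    (∀ σ → Eventually (λ m → ∣ eval σ u m ∣ ≤ B)) → Coefficients≤ B u
  coefficients≤ {zero}  a B h with h []
  -- An integer evaluates to itself at every index, so a single late index decides.
  ... | from N le = le N ℕ.≤-refl
  coefficients≤ {suc j} (a , b) B h = coefficients≤ a B boundA , coefficients≤ b B boundB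
    where
    open +-*-Solver
    both : ∀ σ → Eventually (λ m → ∣ eval (false ∷ σ) (a , b) m ∣ ≤ B × ∣ eval (true ∷ σ) (a , b) m ∣ ≤ B)
    both σ = eventually-× (h (false ∷ σ)) (h (true ∷ σ))
    halve : ∀ {p q r} → p + p ≡ q + r → ∣ q ∣ ≤ B → ∣ r ∣ ≤ B → ∣ p ∣ ≤ B
    halve {p} {q} {r} eq hq hr = *-cancelʳ (1ℚ + 1ℚ) (+-mono-< 0<1 0<1) (begin
      ∣ p ∣ * (1ℚ + 1ℚ)              ≡⟨ sym (∣p*q∣≡∣p∣*∣q∣ p (1ℚ + 1ℚ)) ⟩
      ∣ p * (1ℚ + 1ℚ) ∣              ≡⟨ cong ∣_∣ (trans (solve 1 (λ p → p :* (con 1ℚ :+ con 1ℚ) := p :+ p) refl p) eq) ⟩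
      ∣ q + r ∣                      ≤⟨ ∣p+q∣≤∣p∣+∣q∣ q r ⟩
      ∣ q ∣ + ∣ r ∣                  ≤⟨ +-mono-≤ hq hr ⟩
      B + B                          ≡⟨ solve 1 (λ p → p :+ p := p :* (con 1ℚ :+ con 1ℚ)) refl B ⟩
      B * (1ℚ + 1ℚ)                  ∎)
      where open ≤-Reasoning
    boundA : ∀ σ → Eventually (λ m → ∣ eval σ a m ∣ ≤ B)
    boundA σ with both σ
    ... | from N le = from N λ m N≤m → halve
      (solve 3 (λ a b r → a :+ a := (a :+ r :* b) :+ (a :+ :- r :* b)) refl (eval σ a m) (eval σ b m) (sqrtApprox (prime j) m))
      (proj₁ (le m N≤m)) (proj₂ (le m N≤m))
    boundB : ∀ σ → Eventually (λ m → ∣ eval σ b m ∣ ≤ B)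
    boundB σ with both σ
    ... | from N le = from N λ m N≤m → ≤-trans
      (subst (∣ eval σ b m ∣ ≤_) (sym (∣p*q∣≡∣p∣*∣q∣ (eval σ b m) (sqrtApprox (prime j) m)))
        (≤*1≤ (0≤∣p∣ (eval σ b m)) (1≤∣θ∣ false j m)))
      (halve {r = - eval (true ∷ σ) (a , b) m}
        (solve 3 (λ a b r → b :* r :+ b :* r := (a :+ r :* b) :+ :- (a :+ :- r :* b)) refl (eval σ a m) (eval σ b m) (sqrtApprox (prime j) m))
        (proj₁ (le m N≤m)) (subst (_≤ B) (sym (∣-p∣≡∣p∣ (eval (true ∷ σ) (a , b) m))) (proj₂ (le m N≤m))))

  module _ {A : Set} (_∙_ : A → A → A) where
    -- A fold over all subsets, used for `_⊠_`, `_*_` and `_+_`. The common bracketing lets an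
    -- evaluation pass through a product node by node.
    Π : ∀ {j} → (Vec Bool j → A) → A
    Π {zero}  f = f []
    Π {suc j} f = Π (λ S → f (false ∷ S)) ∙ Π (λ S → f (true ∷ S))

    module _ (ε : A) where
      -- The nonempty subsets are those of the earlier primes together with every subset that
      -- contains the newest prime.
      Π⁺ : ∀ {j} → ((S : Vec Bool j) → NonEmpty S → A) → A
      Π⁺ {zero}  f = ε
      Π⁺ {suc j} f = Π⁺ (λ S → f (false ∷ S)) ∙ Π (λ S → f (true ∷ S) tt)

  module _ {j} (σ : Vec Bool j) where
    bounded-Π : ∀ {i} (f : Vec Bool i → Multiquadratic j) → Bounded (λ m → Π _*_ (λ S → eval σ (f S) m))
    bounded-Π {zero}  f = bounded-eval σ (f [])
    bounded-Π {suc i} f = bounded-* (bounded-Π (λ S → f (false ∷ S))) (bounded-Π (λ S → f (true ∷ S)))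

    eval-Π : ∀ {i} (f : Vec Bool i → Multiquadratic j) → eval σ (Π _⊠_ f) ≈ (λ m → Π _*_ (λ S → eval σ (f S) m))
    eval-Π {zero}  f = ≡⇒≈ λ _ → refl
    eval-Π {suc i} f = ≈-trans (eval-⊠ σ (Π _⊠_ (λ S → f (false ∷ S))) (Π _⊠_ (λ S → f (true ∷ S))))
      (≈-* (bounded-eval σ (Π _⊠_ (λ S → f (false ∷ S)))) (bounded-Π (λ S → f (true ∷ S)))
           (eval-Π (λ S → f (false ∷ S))) (eval-Π (λ S → f (true ∷ S))))

    eval-Π⁺ : ∀ {i} (f : (S : Vec Bool i) → NonEmpty S → Multiquadratic j) →
              eval σ (Π⁺ _⊠_ (constant (+ 1)) f) ≈ (λ m → Π⁺ _*_ 1ℚ (λ S ne → eval σ (f S ne) m))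
    eval-Π⁺ {zero}  f = ≡⇒≈ λ m → trans (eval-constant σ (+ 1) m) ι1≡1
    eval-Π⁺ {suc i} f = ≈-trans (eval-⊠ σ (Π⁺ _⊠_ (constant (+ 1)) (λ S → f (false ∷ S))) (Π _⊠_ (λ S → f (true ∷ S) tt)))
      (≈-* (bounded-eval σ (Π⁺ _⊠_ (constant (+ 1)) (λ S → f (false ∷ S)))) (bounded-Π (λ S → f (true ∷ S) tt))
           (eval-Π⁺ (λ S → f (false ∷ S))) (eval-Π (λ S → f (true ∷ S) tt)))

-- Sizes of products over subsets under each embedding

module ConjugateProducts where
  open import Data.Rational hiding (NonZero)
  open import Data.Rational.Properties
  open RationalArithmetic
  open Convergents
  open Limits
  open MultiquadraticRing

  Π-mono : ∀ {j} (f g : Vec Bool j → ℚ) → (∀ S → 0ℚ ≤ f S) → (∀ S → f S ≤ g S) →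
           0ℚ ≤ Π _*_ f × Π _*_ f ≤ Π _*_ g
  Π-mono {zero}  f g 0≤f f≤g = 0≤f [] , f≤g []
  Π-mono {suc j} f g 0≤f f≤g =
    let (p , q) = Π-mono (λ S → f (false ∷ S)) (λ S → g (false ∷ S)) (λ S → 0≤f (false ∷ S)) (λ S → f≤g (false ∷ S))
        (r , s) = Π-mono (λ S → f (true ∷ S)) (λ S → g (true ∷ S)) (λ S → 0≤f (true ∷ S)) (λ S → f≤g (true ∷ S))
    in 0≤* p r , *-mono p r q s

  *-swap : ∀ a b c → a * b * c ≡ a * c * b
  *-swap = solve 3 (λ a b c → a :* b :* c := a :* c :* b) refl
    where open +-*-Solver

  interchange : ∀ a b c d → (a * b) * (c * d) ≡ (a * c) * (b * d)
  interchange = solve 4 (λ a b c d → (a :* b) :* (c :* d) := (a :* c) :* (b :* d)) refl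
    where open +-*-Solver

  Π-* : ∀ {j} (f g : Vec Bool j → ℚ) → Π _*_ (λ S → f S * g S) ≡ Π _*_ f * Π _*_ g
  Π-* {zero}  f g = refl
  Π-* {suc j} f g = trans (cong₂ _*_ (Π-* (λ S → f (false ∷ S)) (λ S → g (false ∷ S))) (Π-* (λ S → f (true ∷ S)) (λ S → g (true ∷ S))))
    (interchange (Π _*_ (λ S → f (false ∷ S))) (Π _*_ (λ S → g (false ∷ S))) (Π _*_ (λ S → f (true ∷ S))) (Π _*_ (λ S → g (true ∷ S))))

  Π⁺-mono : ∀ {j} (f g : (S : Vec Bool j) → NonEmpty S → ℚ) → (∀ S ne → 0ℚ ≤ f S ne) → (∀ S ne → f S ne ≤ g S ne) →
            0ℚ ≤ Π⁺ _*_ 1ℚ f × Π⁺ _*_ 1ℚ f ≤ Π⁺ _*_ 1ℚ g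
  Π⁺-mono {zero}  f g 0≤f f≤g = 0≤1 , ≤-refl
  Π⁺-mono {suc j} f g 0≤f f≤g =
    let (p , q) = Π⁺-mono (λ S → f (false ∷ S)) (λ S → g (false ∷ S)) (λ S → 0≤f (false ∷ S)) (λ S → f≤g (false ∷ S))
        (r , s) = Π-mono (λ S → f (true ∷ S) tt) (λ S → g (true ∷ S) tt) (λ S → 0≤f (true ∷ S) tt) (λ S → f≤g (true ∷ S) tt)
    in 0≤* p r , *-mono p r q s

  Π⁺-* : ∀ {j} (f g : (S : Vec Bool j) → NonEmpty S → ℚ) →
         Π⁺ _*_ 1ℚ (λ S ne → f S ne * g S ne) ≡ Π⁺ _*_ 1ℚ f * Π⁺ _*_ 1ℚ g
  Π⁺-* {zero}  f g = refl
  Π⁺-* {suc j} f g = trans (cong₂ _*_ (Π⁺-* (λ S → f (false ∷ S)) (λ S → g (false ∷ S))) (Π-* (λ S → f (true ∷ S) tt) (λ S → g (true ∷ S) tt)))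
    (interchange (Π⁺ _*_ 1ℚ (λ S → f (false ∷ S))) (Π⁺ _*_ 1ℚ (λ S → g (false ∷ S))) (Π _*_ (λ S → f (true ∷ S) tt)) (Π _*_ (λ S → g (true ∷ S) tt)))

  -- pow j c = c ^ 2ʲ and pow⁺ j c = c ^ (2ʲ - 1).
  pow : ℕ → ℚ → ℚ
  pow j c = Π _*_ {j} (λ _ → c)

  pow⁺ : ℕ → ℚ → ℚ
  pow⁺ j c = Π⁺ _*_ 1ℚ {j} (λ _ _ → c)

  pow≡pow⁺* : ∀ j c → pow j c ≡ pow⁺ j c * c
  pow≡pow⁺* zero    c = sym (*-identityˡ c)
  pow≡pow⁺* (suc j) c = trans (cong (_* pow j c) (pow≡pow⁺* j c))
    (trans (*-assoc (pow⁺ j c) c (pow j c)) (trans (cong (pow⁺ j c *_) (*-comm c (pow j c))) (sym (*-assoc (pow⁺ j c) (pow j c) c))))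

  pow-pos : ∀ j {c} → 0ℚ < c → 0ℚ < pow j c
  pow-pos zero    0<c = 0<c
  pow-pos (suc j) 0<c = 0<* (pow-pos j 0<c) (pow-pos j 0<c)

  pow⁺-pos : ∀ j {c} → 0ℚ < c → 0ℚ < pow⁺ j c
  pow⁺-pos zero    0<c = 0<1
  pow⁺-pos (suc j) 0<c = 0<* (pow⁺-pos j 0<c) (pow-pos j 0<c)

  pow-1 : ∀ j → pow j 1ℚ ≡ 1ℚ
  pow-1 zero    = refl
  pow-1 (suc j) = trans (cong₂ _*_ (pow-1 j) (pow-1 j)) (*-identityˡ 1ℚ)

  pow⁺-1 : ∀ j → pow⁺ j 1ℚ ≡ 1ℚ
  pow⁺-1 zero    = refl
  pow⁺-1 (suc j) = trans (cong₂ _*_ (pow⁺-1 j) (pow-1 j)) (*-identityˡ 1ℚ)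

  pow⁺-* : ∀ j c d → pow⁺ j (c * d) ≡ pow⁺ j c * pow⁺ j d
  pow⁺-* j c d = Π⁺-* {j} (λ _ _ → c) (λ _ _ → d)

  ¬NonEmpty-∅ : ∀ j → ¬ NonEmpty (none {j})
  ¬NonEmpty-∅ (suc j) = ¬NonEmpty-∅ j

  ∅⊎NonEmpty : ∀ {j} (σ : Vec Bool j) → σ ≡ none ⊎ NonEmpty σ
  ∅⊎NonEmpty []          = inj₁ refl
  ∅⊎NonEmpty (true ∷ σ)  = inj₂ tt
  ∅⊎NonEmpty (false ∷ σ) with ∅⊎NonEmpty σ
  ... | inj₁ eq = inj₁ (cong (false ∷_) eq)
  ... | inj₂ ne = inj₂ ne

  -- The sizes g of x - y√D at the two embeddings √D ↦ √D (false) and √D ↦ -√D (true).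
  record Tame (T C : ℚ) (g : Bool → ℚ) : Set where
    field
      nonneg : ∀ s → 0ℚ ≤ g s
      upper  : g false * T ≤ C
      lower  : 1ℚ ≤ C * (g false * T)
      conj   : g true ≤ C * T

  module _ (T C : ℚ) (0<T : 0ℚ < T) (0<C : 0ℚ < C) where
    open Tame
    private
      0≤T : 0ℚ ≤ T
      0≤T = <⇒≤ 0<T

    module _ {j} (g : Vec Bool j → Bool → ℚ) (tame : ∀ S → Tame T C (g S)) (h : Vec Bool j → ℚ) where
      Π-trivial : (∀ S → h S ≡ g S false) → Π _*_ h * pow j T ≤ pow j C
      Π-trivial eq = subst (_≤ pow j C) (Π-* h (λ _ → T)) (proj₂ (Π-mono (λ S → h S * T) (λ _ → C)
        (λ S → 0≤* (subst (0ℚ ≤_) (sym (eq S)) (nonneg (tame S) false)) 0≤T)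
        (λ S → subst (λ z → z * T ≤ C) (sym (eq S)) (upper (tame S)))))

      Π-conjugate : (∀ S → h S ≡ g S true) → Π _*_ h ≤ pow j C * pow j T
      Π-conjugate eq = subst (Π _*_ h ≤_) (Π-* {j} (λ _ → C) (λ _ → T)) (proj₂ (Π-mono h (λ _ → C * T)
        (λ S → subst (0ℚ ≤_) (sym (eq S)) (nonneg (tame S) true))
        (λ S → subst (_≤ C * T) (sym (eq S)) (conj (tame S)))))

      Π-nonneg : ∀ (s : Vec Bool j → Bool) → (∀ S → h S ≡ g S (s S)) → 0ℚ ≤ Π _*_ h
      Π-nonneg s eq = proj₁ (Π-mono h h (λ S → subst (0ℚ ≤_) (sym (eq S)) (nonneg (tame S) (s S))) (λ _ → ≤-refl))

    -- Used with p a power of T: the product a of small factors offsets the product b of large ones.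
    cancel-opposite : ∀ {a b A B p} → 0ℚ < p → 0ℚ ≤ a → 0ℚ ≤ b → a * p ≤ A → b ≤ B * p → a * b ≤ A * B
    cancel-opposite {a} {b} {A} {B} {p} 0<p 0≤a 0≤b ha hb = *-cancelʳ p 0<p
      (subst₂ _≤_ (solve 3 (λ a b p → a :* p :* b := a :* b :* p) refl a b p) (sym (*-assoc A B p))
        (*-mono (0≤* 0≤a (<⇒≤ 0<p)) 0≤b ha hb))
      where open +-*-Solver

    -- Half of the factors of the product sit at √D ↦ √D and half at √D ↦ -√D.
    Π-balanced : ∀ {j} (σ : Vec Bool j) → NonEmpty σ → ∀ e (g : Vec Bool j → Bool → ℚ) → (∀ S → Tame T C (g S)) →
                 (h : Vec Bool j → ℚ) → (∀ S → h S ≡ g S (e xor χ σ S)) → Π _*_ h ≤ pow j C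
    Π-balanced {suc j} (s ∷ σ) ne e g tame h eq = split s ne (∅⊎NonEmpty σ) eq
      where
      h₀ h₁ : Vec Bool j → ℚ
      h₀ S = h (false ∷ S)
      h₁ S = h (true ∷ S)
      g₀ g₁ : Vec Bool j → Bool → ℚ
      g₀ S = g (false ∷ S)
      g₁ S = g (true ∷ S)
      t₀ : ∀ S → Tame T C (g₀ S)
      t₀ S = tame (false ∷ S)
      t₁ : ∀ S → Tame T C (g₁ S)
      t₁ S = tame (true ∷ S)
      split : ∀ s → NonEmpty (s ∷ σ) → σ ≡ none ⊎ NonEmpty σ → (∀ S → h S ≡ g S (e xor χ (s ∷ σ) S)) → Π _*_ h ≤ pow (suc j) C
      -- If σ is nontrivial on the earlier primes, each half is balanced by itself. The half
      -- containing the newest prime sees all signs twisted by s, which is why the induction carries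
      -- a global sign e.
      split s _ (inj₂ ne) eq = *-mono
        (Π-nonneg g₀ t₀ h₀ _ (λ S → eq (false ∷ S))) (Π-nonneg g₁ t₁ h₁ _ (λ S → eq (true ∷ S)))
        (Π-balanced σ ne e g₀ t₀ h₀ (λ S → eq (false ∷ S)))
        (Π-balanced σ ne (e xor s) g₁ t₁ h₁ (λ S → trans (eq (true ∷ S)) (cong (g₁ S) (sym (xor-assoc e s (χ σ S))))))
      split false ne (inj₁ refl) eq = ⊥-elim (¬NonEmpty-∅ j ne)
      -- If σ flips only the newest root, the sign is constant on each half and opposite on the two
      -- halves, so the halves offset each other.
      split true _ (inj₁ refl) eq = opposite e eq₀ eq₁
        where
        eq₀ : ∀ S → h₀ S ≡ g₀ S (e xor false)
        eq₀ S = trans (eq (false ∷ S)) (cong (λ c → g₀ S (e xor c)) (χ-∅ˡ S))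
        eq₁ : ∀ S → h₁ S ≡ g₁ S (e xor true)
        eq₁ S = trans (eq (true ∷ S)) (cong (λ c → g₁ S (e xor (true xor c))) (χ-∅ˡ S))
        opposite : ∀ e → (∀ S → h₀ S ≡ g₀ S (e xor false)) → (∀ S → h₁ S ≡ g₁ S (e xor true)) → Π _*_ h ≤ pow (suc j) C
        opposite false eq₀ eq₁ = cancel-opposite (pow-pos j 0<T)
          (Π-nonneg g₀ t₀ h₀ _ eq₀) (Π-nonneg g₁ t₁ h₁ _ eq₁)
          (Π-trivial g₀ t₀ h₀ eq₀) (Π-conjugate g₁ t₁ h₁ eq₁)
        opposite true eq₀ eq₁ = subst (_≤ pow (suc j) C) (*-comm (Π _*_ h₁) (Π _*_ h₀)) (cancel-opposite (pow-pos j 0<T)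
          (Π-nonneg g₁ t₁ h₁ _ eq₁) (Π-nonneg g₀ t₀ h₀ _ eq₀)
          (Π-trivial g₁ t₁ h₁ eq₁) (Π-conjugate g₀ t₀ h₀ eq₀))

    module _ {j} (g : (S : Vec Bool j) → NonEmpty S → Bool → ℚ) (tame : ∀ S ne → Tame T C (g S ne))
             (h : (S : Vec Bool j) → NonEmpty S → ℚ) where
      Π⁺-nonneg : ∀ (s : ∀ S → Bool) → (∀ S ne → h S ne ≡ g S ne (s S)) → 0ℚ ≤ Π⁺ _*_ 1ℚ h
      Π⁺-nonneg s eq = proj₁ (Π⁺-mono h h (λ S ne → subst (0ℚ ≤_) (sym (eq S ne)) (nonneg (tame S ne) (s S))) (λ _ _ → ≤-refl))

      Π⁺-upper : (∀ S ne → h S ne ≡ g S ne false) → Π⁺ _*_ 1ℚ h * pow⁺ j T ≤ pow⁺ j C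
      Π⁺-upper eq = subst (_≤ pow⁺ j C) (Π⁺-* h (λ _ _ → T)) (proj₂ (Π⁺-mono (λ S ne → h S ne * T) (λ _ _ → C)
        (λ S ne → 0≤* (subst (0ℚ ≤_) (sym (eq S ne)) (nonneg (tame S ne) false)) 0≤T)
        (λ S ne → subst (λ z → z * T ≤ C) (sym (eq S ne)) (upper (tame S ne)))))

      Π⁺-lower : (∀ S ne → h S ne ≡ g S ne false) → 1ℚ ≤ pow⁺ j C * (Π⁺ _*_ 1ℚ h * pow⁺ j T)
      Π⁺-lower eq = subst₂ _≤_ (pow⁺-1 j)
        (trans (Π⁺-* (λ _ _ → C) (λ S ne → h S ne * T)) (cong (pow⁺ j C *_) (Π⁺-* h (λ _ _ → T))))
        (proj₂ (Π⁺-mono (λ _ _ → 1ℚ) (λ S ne → C * (h S ne * T)) (λ _ _ → 0≤1)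
          (λ S ne → subst (λ z → 1ℚ ≤ C * (z * T)) (sym (eq S ne)) (lower (tame S ne)))))

    -- Over all subsets the two signs would balance and every power of T would cancel. The empty set
    -- has sign + and is left out, so one factor 1/T is missing and a single T remains.
    Π⁺-conjugate : ∀ {j} (σ : Vec Bool j) → NonEmpty σ → (g : (S : Vec Bool j) → NonEmpty S → Bool → ℚ) → (∀ S ne → Tame T C (g S ne)) →
                   (h : (S : Vec Bool j) → NonEmpty S → ℚ) → (∀ S ne → h S ne ≡ g S ne (χ σ S)) → Π⁺ _*_ 1ℚ h ≤ pow⁺ j C * T
    Π⁺-conjugate {suc j} (s ∷ σ) ne g tame h eq = split s ne (∅⊎NonEmpty σ) eq
      where
      h₀ = λ S ne → h (false ∷ S) ne
      h₁ = λ S → h (true ∷ S) tt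
      g₀ = λ S ne → g (false ∷ S) ne
      g₁ = λ S → g (true ∷ S) tt
      t₀ = λ S ne → tame (false ∷ S) ne
      t₁ = λ S → tame (true ∷ S) tt
      split : ∀ s → NonEmpty (s ∷ σ) → σ ≡ none ⊎ NonEmpty σ → (∀ S ne → h S ne ≡ g S ne (χ (s ∷ σ) S)) → Π⁺ _*_ 1ℚ h ≤ pow⁺ (suc j) C * T
      split s _ (inj₂ ne) eq = subst (Π⁺ _*_ 1ℚ h ≤_) (*-swap (pow⁺ j C) T (pow j C)) (*-mono
        (Π⁺-nonneg g₀ t₀ h₀ _ (λ S → eq (false ∷ S))) (Π-nonneg g₁ t₁ h₁ _ (λ S → eq (true ∷ S) tt))
        (Π⁺-conjugate σ ne g₀ t₀ h₀ (λ S → eq (false ∷ S)))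
        (Π-balanced σ ne s g₁ t₁ h₁ (λ S → eq (true ∷ S) tt)))
      split false ne (inj₁ refl) eq = ⊥-elim (¬NonEmpty-∅ j ne)
      -- There are 2ʲ - 1 small factors against 2ʲ large ones; `pow≡pow⁺*` splits off the one
      -- surplus T.
      split true _ (inj₁ refl) eq = subst (Π⁺ _*_ 1ℚ h ≤_) (sym (*-assoc (pow⁺ j C) (pow j C) T)) (cancel-opposite (pow⁺-pos j 0<T)
        (Π⁺-nonneg g₀ t₀ h₀ _ (λ S → eq (false ∷ S))) (Π-nonneg g₁ t₁ h₁ _ (λ S → eq (true ∷ S) tt))
        (Π⁺-upper g₀ t₀ h₀ (λ S ne → trans (eq (false ∷ S) ne) (cong (g₀ S ne) (χ-∅ˡ S))))
        (subst (Π _*_ h₁ ≤_) (trans (cong (pow j C *_) (trans (pow≡pow⁺* j T) (*-comm (pow⁺ j T) T))) (sym (*-assoc (pow j C) T (pow⁺ j T))))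
          (Π-conjugate g₁ t₁ h₁ (λ S → trans (eq (true ∷ S) tt) (cong (λ c → g₁ S (true xor c)) (χ-∅ˡ S))))))

-- Size of a single factor built from a convergent

module TameFactors where
  open import Data.Rational hiding (NonZero)
  open import Data.Rational.Properties
  open RationalArithmetic
  open Convergents
  open Limits
  open MultiquadraticRing
  open ConjugateProducts

  ⟪2*⟫ : ∀ n → ⟪ 2 ℕ.* n ⟫ ≡ ⟪ n ⟫ + ⟪ n ⟫
  ⟪2*⟫ n = trans (⟪⟫-* 2 n) (trans (cong (_* ⟪ n ⟫) ⟪2⟫) (solve 1 (λ n → (con 1ℚ :+ con 1ℚ) :* n := n :+ n) refl ⟪ n ⟫))
    where open +-*-Solver

  ⟪6*⟫ : ∀ n → ⟪ 6 ℕ.* n ⟫ ≡ (⟪ n ⟫ + ⟪ n ⟫ + ⟪ n ⟫) + (⟪ n ⟫ + ⟪ n ⟫ + ⟪ n ⟫)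
  ⟪6*⟫ n = trans (⟪⟫-* 6 n) (trans (cong (_* ⟪ n ⟫) (ι≡/1 (+ 6)))
    (solve 1 (λ n → con (+ 6 / 1) :* n := (n :+ n :+ n) :+ (n :+ n :+ n)) refl ⟪ n ⟫))
    where open +-*-Solver

  sq-cancel-≤ : ∀ {m n} → m ℕ.* m ℕ.≤ n ℕ.* n → m ℕ.≤ n
  sq-cancel-≤ {m} {n} le = ℕ.≮⇒≥ λ n<m → ℕ.<⇒≱ (ℕ.*-mono-< n<m n<m) le

  -- Here x² ≤ D y² + D ≤ 2 (D T)², and the factor 2 is relaxed to the square 4.
  convergent-x≤ : ∀ {D T} → 1 ℕ.≤ D → (c : Convergent D T) → Convergent.x c ℕ.≤ 2 ℕ.* (D ℕ.* T)
  convergent-x≤ {D} {T} 1≤D c = sq-cancel-≤ (begin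
    x ℕ.* x                                ≤⟨ x²≤ pell ⟩
    D ℕ.* (y ℕ.* y) ℕ.+ defect             ≤⟨ ℕ.+-mono-≤ (ℕ.*-monoʳ-≤ D (ℕ.*-mono-≤ y≤T y≤T)) (ℕ.≤-trans defect≤D (ℕ.m≤m*n D (T ℕ.* T) {{ℕ.>-nonZero (ℕ.*-mono-≤ 1≤T 1≤T)}})) ⟩
    D ℕ.* (T ℕ.* T) ℕ.+ D ℕ.* (T ℕ.* T)    ≤⟨ ℕ.+-mono-≤ D≤ D≤ ⟩
    DT ℕ.* DT ℕ.+ DT ℕ.* DT                ≤⟨ ℕ.m≤m+n _ (DT ℕ.* DT ℕ.+ DT ℕ.* DT) ⟩
    (DT ℕ.* DT ℕ.+ DT ℕ.* DT) ℕ.+ (DT ℕ.* DT ℕ.+ DT ℕ.* DT)  ≡⟨ solve 1 (λ n → (n :* n :+ n :* n) :+ (n :* n :+ n :* n) := (con 2 :* n) :* (con 2 :* n)) refl DT ⟩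
    (2 ℕ.* DT) ℕ.* (2 ℕ.* DT)              ∎)
    where
    open Convergent c
    open ℕ.≤-Reasoning
    open ℕ.+-*-Solver
    DT = D ℕ.* T
    1≤T = ℕ.≤-trans 1≤y y≤T
    D≤ : D ℕ.* (T ℕ.* T) ℕ.≤ DT ℕ.* DT
    D≤ = ℕ.≤-trans (ℕ.m≤n*m (D ℕ.* (T ℕ.* T)) D {{ℕ.>-nonZero 1≤D}})
      (ℕ.≤-reflexive (solve 2 (λ d t → d :* (d :* (t :* t)) := (d :* t) :* (d :* t)) refl D T))
    x²≤ : x ℕ.* x ℕ.+ defect ≡ D ℕ.* (y ℕ.* y) ⊎ D ℕ.* (y ℕ.* y) ℕ.+ defect ≡ x ℕ.* x → x ℕ.* x ℕ.≤ D ℕ.* (y ℕ.* y) ℕ.+ defect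
    x²≤ (inj₁ eq) = ℕ.≤-trans (ℕ.≤-trans (ℕ.m≤m+n (x ℕ.* x) defect) (ℕ.≤-reflexive eq)) (ℕ.m≤m+n _ defect)
    x²≤ (inj₂ eq) = ℕ.≤-reflexive (sym eq)

  module _ {D T P : ℕ} (1≤D : 1 ℕ.≤ D) (D≤P : D ℕ.≤ P) (c : Convergent D T) (r : ℚ) (1≤r : 1ℚ ≤ r) (r≤D : r ≤ ⟪ D ⟫)
           (r²≈D : ∣ r * r - ⟪ D ⟫ ∣ * ⟪ 2 ℕ.* (T ℕ.* T) ⟫ ≤ 1ℚ) where
    open Convergent c
    private
      open +-*-Solver
      X Y A E : ℚ
      X = ⟪ x ⟫
      Y = ⟪ y ⟫
      A = ⟪ defect ⟫
      E = Y * Y * (r * r - ⟪ D ⟫)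
      t d : ℚ
      t = ⟪ T ⟫
      d = ⟪ D ⟫

      0≤r : 0ℚ ≤ r
      0≤r = ≤-trans 0≤1 1≤r
      0≤Y : 0ℚ ≤ Y
      0≤Y = 0≤⟪⟫ y

      a s : ℚ
      a = X - Y * r
      s = X + Y * r

      0≤s : 0ℚ ≤ s
      0≤s = 0≤+ (0≤⟪⟫ x) (0≤* 0≤Y 0≤r)

      norm : ∣ a ∣ * s ≡ ∣ X * X - Y * Y * (r * r) ∣
      norm = trans (cong (∣ a ∣ *_) (sym (0≤p⇒∣p∣≡p 0≤s))) (trans (sym (∣p*q∣≡∣p∣*∣q∣ a s))
        (cong ∣_∣ (solve 3 (λ x y r → (x :- y :* r) :* (x :+ y :* r) := x :* x :- y :* y :* (r :* r)) refl X Y r)))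

      pellℚ : ∣ X * X - d * (Y * Y) ∣ ≡ A
      pellℚ = trans (cong ∣_∣ (cong₂ _-_ (sym (⟪⟫-* x x)) (sym (trans (⟪⟫-* D (y ℕ.* y)) (cong (d *_) (⟪⟫-* y y)))))) (go pell)
        where
        diff : ∀ {m n} → m ℕ.+ defect ≡ n → ∣ ⟪ n ⟫ - ⟪ m ⟫ ∣ ≡ A
        diff {m} refl = trans (cong ∣_∣ (trans (cong (_- ⟪ m ⟫) (⟪⟫-+ m defect)) (solve 2 (λ m a → (m :+ a) :- m := a) refl ⟪ m ⟫ A)))
          (0≤p⇒∣p∣≡p (0≤⟪⟫ defect))
        go : x ℕ.* x ℕ.+ defect ≡ D ℕ.* (y ℕ.* y) ⊎ D ℕ.* (y ℕ.* y) ℕ.+ defect ≡ x ℕ.* x → ∣ ⟪ x ℕ.* x ⟫ - ⟪ D ℕ.* (y ℕ.* y) ⟫ ∣ ≡ A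
        go (inj₁ eq) = trans (∣p-q∣≡∣q-p∣ ⟪ x ℕ.* x ⟫ ⟪ D ℕ.* (y ℕ.* y) ⟫) (diff eq)
        go (inj₂ eq) = diff eq

      -- Replacing √D by r changes x² - D y² by E. The accuracy 1 / (2 T²) demanded of r² keeps E
      -- within 1/2, so a defect of at least 1 cannot be wiped out.
      E+E≤1 : ∣ E ∣ + ∣ E ∣ ≤ 1ℚ
      E+E≤1 = begin
        ∣ E ∣ + ∣ E ∣                                          ≡⟨ cong (λ z → z + z) (trans (∣p*q∣≡∣p∣*∣q∣ (Y * Y) e) (cong (_* ∣ e ∣) (0≤p⇒∣p∣≡p (0≤* 0≤Y 0≤Y)))) ⟩
        Y * Y * ∣ e ∣ + Y * Y * ∣ e ∣                          ≤⟨ +-mono-≤ Y≤t Y≤t ⟩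
        t * t * ∣ e ∣ + t * t * ∣ e ∣                          ≡⟨ solve 2 (λ u e → u :* e :+ u :* e := e :* (u :+ u)) refl (t * t) ∣ e ∣ ⟩
        ∣ e ∣ * (t * t + t * t)                                ≡⟨ cong (∣ e ∣ *_) (sym (trans (⟪2*⟫ (T ℕ.* T)) (cong (λ z → z + z) (⟪⟫-* T T)))) ⟩
        ∣ e ∣ * ⟪ 2 ℕ.* (T ℕ.* T) ⟫                            ≤⟨ r²≈D ⟩
        1ℚ                                                     ∎
        where
        open ≤-Reasoning
        e = r * r - ⟪ D ⟫
        Y≤t : Y * Y * ∣ e ∣ ≤ t * t * ∣ e ∣
        Y≤t = *-monoˡ ∣ e ∣ (0≤∣p∣ e) (*-mono 0≤Y 0≤Y (⟪⟫-mono y≤T) (⟪⟫-mono y≤T))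

      N : ℚ
      N = ∣ a ∣ * s

      N≤ : N ≤ A + ∣ E ∣
      N≤ = subst (_≤ A + ∣ E ∣) (sym norm) (subst (λ z → ∣ X * X - Y * Y * (r * r) ∣ ≤ z + ∣ E ∣) pellℚ
        (subst (λ z → ∣ z ∣ ≤ ∣ X * X - d * (Y * Y) ∣ + ∣ E ∣)
          (solve 4 (λ x y r d → (x :* x :- d :* (y :* y)) :- (y :* y :* (r :* r :- d)) := x :* x :- y :* y :* (r :* r)) refl X Y r d)
          (∣p-q∣≤∣p∣+∣q∣ (X * X - d * (Y * Y)) E)))

      A≤ : A ≤ N + ∣ E ∣
      A≤ = subst₂ (λ z w → z ≤ w + ∣ E ∣) pellℚ (sym norm)
        (subst (λ z → ∣ z ∣ ≤ ∣ X * X - Y * Y * (r * r) ∣ + ∣ E ∣)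
          (solve 4 (λ x y r d → (x :* x :- y :* y :* (r :* r)) :+ (y :* y :* (r :* r :- d)) := x :* x :- d :* (y :* y)) refl X Y r d)
          (∣p+q∣≤∣p∣+∣q∣ (X * X - Y * Y * (r * r)) E))

      1≤d : 1ℚ ≤ d
      1≤d = 1≤⟪⟫ 1≤D
      A≤d : A ≤ d
      A≤d = ⟪⟫-mono defect≤D

      N+N≤ : N + N ≤ (d + d + d) + (d + d + d)
      -- The terms add up to 2 N ≤ 2 d + 1 ≤ 3 d, relaxed to 6 d to share one constant with the
      -- lower estimate.
      N+N≤ = ≤-cert ((A + ∣ E ∣ - N) + (A + ∣ E ∣ - N) + (1ℚ - (∣ E ∣ + ∣ E ∣)) + ((d - A) + (d - A)) + (d - 1ℚ) + (d + d + d))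
        (0≤+ (0≤+ (0≤+ (0≤+ (0≤+ (0≤- N≤) (0≤- N≤)) (0≤- E+E≤1)) (0≤+ (0≤- A≤d) (0≤- A≤d))) (0≤- 1≤d)) (0≤+ (0≤+ (0≤⟪⟫ D) (0≤⟪⟫ D)) (0≤⟪⟫ D)))
        (solve 4 (λ n a e d → (d :+ d :+ d) :+ (d :+ d :+ d) := (n :+ n) :+ ((a :+ e :- n) :+ (a :+ e :- n) :+ (con 1ℚ :- (e :+ e)) :+ ((d :- a) :+ (d :- a)) :+ (d :- con 1ℚ) :+ (d :+ d :+ d)))
          refl N A ∣ E ∣ d)

      1≤N+N : 1ℚ ≤ N + N
      1≤N+N = ≤-cert ((N + ∣ E ∣ - A) + (N + ∣ E ∣ - A) + (1ℚ - (∣ E ∣ + ∣ E ∣)) + ((A - 1ℚ) + (A - 1ℚ)))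
        (0≤+ (0≤+ (0≤+ (0≤- A≤) (0≤- A≤)) (0≤- E+E≤1)) (0≤+ (0≤- (1≤⟪⟫ 1≤defect)) (0≤- (1≤⟪⟫ 1≤defect))))
        (solve 3 (λ n a e → n :+ n := con 1ℚ :+ ((n :+ e :- a) :+ (n :+ e :- a) :+ (con 1ℚ :- (e :+ e)) :+ ((a :- con 1ℚ) :+ (a :- con 1ℚ))))
          refl N A ∣ E ∣)

      t≤2s : t ≤ s + s
      t≤2s = begin
        t                ≤⟨ ⟪⟫-mono T≤2y ⟩
        ⟪ 2 ℕ.* y ⟫      ≡⟨ ⟪2*⟫ y ⟩
        Y + Y            ≤⟨ +-mono-≤ Y≤s Y≤s ⟩
        s + s            ∎
        where
        open ≤-Reasoning
        Y≤s : Y ≤ s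
        Y≤s = ≤-trans (≤*1≤ 0≤Y 1≤r) (≤+ˡ (0≤⟪⟫ x))

      s≤3dt : s ≤ (d + d + d) * t
      s≤3dt = begin
        X + Y * r                  ≤⟨ +-mono-≤ (⟪⟫-mono (convergent-x≤ 1≤D c)) (*-mono 0≤Y 0≤r (⟪⟫-mono y≤T) r≤D) ⟩
        ⟪ 2 ℕ.* (D ℕ.* T) ⟫ + t * d ≡⟨ cong (_+ t * d) (trans (⟪2*⟫ (D ℕ.* T)) (cong (λ z → z + z) (⟪⟫-* D T))) ⟩
        d * t + d * t + t * d      ≡⟨ solve 2 (λ d t → d :* t :+ d :* t :+ t :* d := (d :+ d :+ d) :* t) refl d t ⟩
        (d + d + d) * t            ∎
        where open ≤-Reasoning

      d*6≤P*6 : (d + d + d) + (d + d + d) ≤ ⟪ 6 ℕ.* P ⟫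
      d*6≤P*6 = subst (_≤ ⟪ 6 ℕ.* P ⟫) (⟪6*⟫ D) (⟪⟫-mono (ℕ.*-monoʳ-≤ 6 D≤P))

      0≤3d : 0ℚ ≤ d + d + d
      0≤3d = 0≤+ (0≤+ (0≤⟪⟫ D) (0≤⟪⟫ D)) (0≤⟪⟫ D)

    -- The product of |x - y r| and s = x + y r is N, which lies between constants, and s is of
    -- order T; hence |x - y r| is of order 1/T. The 6 arises in the lower bound, where 1 ≤ 2 N and
    -- s ≤ 3 D T. The bound P on D makes the constant common to all S.
    convergent-tame : Tame ⟪ T ⟫ ⟪ 6 ℕ.* P ⟫ (λ e → ∣ ⟪ x ⟫ - ⟪ y ⟫ * signed e r ∣)
    convergent-tame = record
      { nonneg = λ e → 0≤∣p∣ (X - Y * signed e r)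
      ; upper = begin
          ∣ a ∣ * t                  ≤⟨ *-monoʳ ∣ a ∣ (0≤∣p∣ a) t≤2s ⟩
          ∣ a ∣ * (s + s)            ≡⟨ *-distribˡ-+ ∣ a ∣ s s ⟩
          N + N                      ≤⟨ N+N≤ ⟩
          (d + d + d) + (d + d + d)  ≤⟨ d*6≤P*6 ⟩
          ⟪ 6 ℕ.* P ⟫                ∎
      ; lower = begin
          1ℚ                                            ≤⟨ 1≤N+N ⟩
          N + N                                         ≤⟨ +-mono-≤ N≤′ N≤′ ⟩
          ∣ a ∣ * ((d + d + d) * t) + ∣ a ∣ * ((d + d + d) * t)
            ≡⟨ solve 3 (λ a d t → a :* ((d :+ d :+ d) :* t) :+ a :* ((d :+ d :+ d) :* t) := ((d :+ d :+ d) :+ (d :+ d :+ d)) :* (a :* t)) refl ∣ a ∣ d t ⟩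
          ((d + d + d) + (d + d + d)) * (∣ a ∣ * t)     ≤⟨ *-monoˡ (∣ a ∣ * t) (0≤* (0≤∣p∣ a) (0≤⟪⟫ T)) d*6≤P*6 ⟩
          ⟪ 6 ℕ.* P ⟫ * (∣ a ∣ * t)                     ∎
      ; conj = begin
          ∣ X - Y * - r ∣          ≡⟨ cong ∣_∣ (solve 3 (λ x y r → x :- y :* (:- r) := x :+ y :* r) refl X Y r) ⟩
          ∣ s ∣                    ≡⟨ 0≤p⇒∣p∣≡p 0≤s ⟩
          s                        ≤⟨ s≤3dt ⟩
          (d + d + d) * t          ≤⟨ *-monoˡ t (0≤⟪⟫ T) (≤-trans (≤+ʳ {d + d + d} {d + d + d} 0≤3d) d*6≤P*6) ⟩
          ⟪ 6 ℕ.* P ⟫ * t          ∎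
      }
      where
      open ≤-Reasoning
      N≤′ : N ≤ ∣ a ∣ * ((d + d + d) * t)
      N≤′ = *-monoʳ ∣ a ∣ (0≤∣p∣ a) s≤3dt

  -- The number 2ʲ, built by doubling so that it follows the recursion of `Π` and indexes the terms
  -- laid out by `flatten`.
  count : ℕ → ℕ
  count zero    = 1
  count (suc j) = count j ℕ.+ count j

  count⁺ : ℕ → ℕ
  count⁺ zero    = 0
  count⁺ (suc j) = count⁺ j ℕ.+ count j

  pow-⟪⟫ : ∀ j n → pow j ⟪ n ⟫ ≡ ⟪ n ℕ.^ count j ⟫
  pow-⟪⟫ zero    n = cong ⟪_⟫ (sym (ℕ.*-identityʳ n))
  pow-⟪⟫ (suc j) n = trans (cong₂ _*_ (pow-⟪⟫ j n) (pow-⟪⟫ j n)) (trans (sym (⟪⟫-* (n ℕ.^ count j) (n ℕ.^ count j)))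
    (cong ⟪_⟫ (sym (ℕ.^-distribˡ-+-* n (count j) (count j)))))

  pow⁺-⟪⟫ : ∀ j n → pow⁺ j ⟪ n ⟫ ≡ ⟪ n ℕ.^ count⁺ j ⟫
  pow⁺-⟪⟫ zero    n = sym ι1≡1
  pow⁺-⟪⟫ (suc j) n = trans (cong₂ _*_ (pow⁺-⟪⟫ j n) (pow-⟪⟫ j n)) (trans (sym (⟪⟫-* (n ℕ.^ count⁺ j) (n ℕ.^ count j)))
    (cong ⟪_⟫ (sym (ℕ.^-distribˡ-+-* n (count⁺ j) (count j)))))

  ∣Π∣ : ∀ {j} (f : Vec Bool j → ℚ) → ∣ Π _*_ f ∣ ≡ Π _*_ (λ S → ∣ f S ∣)
  ∣Π∣ {zero}  f = refl
  ∣Π∣ {suc j} f = trans (∣p*q∣≡∣p∣*∣q∣ (Π _*_ (λ S → f (false ∷ S))) (Π _*_ (λ S → f (true ∷ S))))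
    (cong₂ _*_ (∣Π∣ (λ S → f (false ∷ S))) (∣Π∣ (λ S → f (true ∷ S))))

  ∣Π⁺∣ : ∀ {j} (f : (S : Vec Bool j) → NonEmpty S → ℚ) → ∣ Π⁺ _*_ 1ℚ f ∣ ≡ Π⁺ _*_ 1ℚ (λ S ne → ∣ f S ne ∣)
  ∣Π⁺∣ {zero}  f = 0≤p⇒∣p∣≡p 0≤1
  ∣Π⁺∣ {suc j} f = trans (∣p*q∣≡∣p∣*∣q∣ (Π⁺ _*_ 1ℚ (λ S → f (false ∷ S))) (Π _*_ (λ S → f (true ∷ S) tt)))
    (cong₂ _*_ (∣Π⁺∣ (λ S → f (false ∷ S))) (∣Π∣ (λ S → f (true ∷ S) tt)))

  eventually-∀ : ∀ {j} {P : Vec Bool j → ℕ → Set} → (∀ S → Eventually (P S)) → Eventually (λ m → ∀ S → P S m)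
  eventually-∀ {zero} h with h []
  ... | from N p = from N λ { m le [] → p m le }
  eventually-∀ {suc j} h with eventually-∀ (λ S → h (false ∷ S)) | eventually-∀ (λ S → h (true ∷ S))
  ... | from M p | from N q = from (M ℕ.⊔ N) λ
    { m le (false ∷ S) → p m (ℕ.m⊔n≤o⇒m≤o M N le) S
    ; m le (true ∷ S)  → q m (ℕ.m⊔n≤o⇒n≤o M N le) S }

-- The products u_T: their coefficients and two-sided size

module Units where
  open import Data.Rational hiding (NonZero)
  open import Data.Rational.Properties
  open RationalArithmetic
  open Convergents
  open Limits
  open MultiquadraticRing
  open ConjugateProducts
  open TameFactors

  0<⟪⟫ : ∀ {n} → 1 ℕ.≤ n → 0ℚ < ⟪ n ⟫
  0<⟪⟫ 1≤n = <-≤-trans 0<1 (1≤⟪⟫ 1≤n)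

  module _ (ℓ : ℕ) where
    private
      P = primorial ℓ
      c = 6 ℕ.* P
      a = c ℕ.^ count⁺ ℓ

      1≤c : 1 ℕ.≤ c
      1≤c = ℕ.≤-trans (1≤primorial ℓ) (ℕ.m≤n*m P 6)

      1≤a : 1 ℕ.≤ a
      1≤a = ℕ.m^n>0 c {{ℕ.>-nonZero 1≤c}} (count⁺ ℓ)

    opaque
      -- With a = c^K bounding the product of the factors, doubling a pays for halving the lower
      -- bound when passing from that product to `unit`; the extra 1 absorbs the error in the upper
      -- bounds.
      unitBound : ℕ
      unitBound = suc (2 ℕ.* a)

      1≤unitBound : 1 ℕ.≤ unitBound
      1≤unitBound = s≤s z≤n

    private
      opaque
        unfolding unitBound
        unitBound≡ : ⟪ unitBound ⟫ ≡ 1ℚ + (⟪ a ⟫ + ⟪ a ⟫)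
        unitBound≡ = trans (⟪⟫-+ 1 (2 ℕ.* a)) (cong₂ _+_ ι1≡1 (⟪2*⟫ a))

    module _ (T : ℕ) (1≤T : 1 ℕ.≤ T) where
      private
        conv : ∀ (S : Vec Bool ℓ) → NonEmpty S → Convergent (rad S) T
        conv S ne = convergent (1≤rad S) (rad-irrational S ne) T 1≤T

        module C S ne = Convergent (conv S ne)

        factor : (S : Vec Bool ℓ) → NonEmpty S → Multiquadratic ℓ
        factor S ne = constant (+ C.x S ne) ⊞ monomial S (ℤ.- + C.y S ne)

        size : ℕ → (S : Vec Bool ℓ) → NonEmpty S → Bool → ℚ
        size m S ne e = ∣ ⟪ C.x S ne ⟫ - ⟪ C.y S ne ⟫ * signed e (sqrtProduct S m) ∣

        eval-factor : ∀ σ S ne m → ∣ eval σ (factor S ne) m ∣ ≡ size m S ne (χ σ S)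
        eval-factor σ S ne m = cong ∣_∣ (trans (eval-⊞ σ (constant (+ x)) (monomial S (ℤ.- + y)) m)
          (cong₂ _+_ (eval-constant σ (+ x) m) (trans (eval-monomial σ S (ℤ.- + y) m)
            (trans (cong (_* signed (χ σ S) (sqrtProduct S m)) (ι-neg (+ y)))
              (sym (neg-distribˡ-* ⟪ y ⟫ (signed (χ σ S) (sqrtProduct S m))))))))
          where open Convergent (conv S ne)

        tame : Eventually (λ m → ∀ S ne → Tame ⟪ T ⟫ ⟪ c ⟫ (size m S ne))
        tame = eventually-map
          (λ m close S ne → convergent-tame (1≤rad S) (rad≤primorial S) (conv S ne)
             (sqrtProduct S m) (1≤sqrtProduct S m) (sqrtProduct≤rad S m) (close S))
          (eventually-∀ (λ (S : Vec Bool ℓ) → ≈⇒eventually (sqrtProduct² S) (2 ℕ.* (T ℕ.* T))))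

        product : Vec Bool ℓ → ℕ → ℚ
        product σ m = Π⁺ _*_ 1ℚ (λ S ne → eval σ (factor S ne) m)

        ∣product∣ : ∀ σ m → ∣ product σ m ∣ ≡ Π⁺ _*_ 1ℚ (λ S ne → ∣ eval σ (factor S ne) m ∣)
        ∣product∣ σ m = ∣Π⁺∣ (λ S ne → eval σ (factor S ne) m)

      opaque
        -- A unit of measurement for the greedy expansion. It need not be invertible, because the
        -- defects need not be 1.
        unit : Multiquadratic ℓ
        unit = Π⁺ _⊠_ (constant (+ 1)) factor

      private
        0<T : 0ℚ < ⟪ T ⟫
        0<T = 0<⟪⟫ 1≤T
        0<c : 0ℚ < ⟪ c ⟫
        0<c = 0<⟪⟫ 1≤c
        t : ℚ
        t = pow⁺ ℓ ⟪ T ⟫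
        tⁿ : ℕ
        tⁿ = T ℕ.^ count⁺ ℓ

        t≡ : t ≡ ⟪ tⁿ ⟫
        t≡ = pow⁺-⟪⟫ ℓ T

        1≤tⁿ : 1 ℕ.≤ tⁿ
        1≤tⁿ = ℕ.m^n>0 T {{ℕ.>-nonZero 1≤T}} (count⁺ ℓ)

        0≤t : 0ℚ ≤ t
        0≤t = subst (0ℚ ≤_) (sym t≡) (0≤⟪⟫ tⁿ)

        a≡ : pow⁺ ℓ ⟪ c ⟫ ≡ ⟪ a ⟫
        a≡ = pow⁺-⟪⟫ ℓ c

        opaque
          unfolding unit
          unit≈ : ∀ σ → eval σ unit ≈ product σ
          unit≈ σ = eval-Π⁺ σ factor

        product∅-bounds : ∀ {m} → (∀ S ne → Tame ⟪ T ⟫ ⟪ c ⟫ (size m S ne)) →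
                          ∣ product none m ∣ * t ≤ ⟪ a ⟫ × 1ℚ ≤ ⟪ a ⟫ * (∣ product none m ∣ * t)
        product∅-bounds {m} tm =
          subst₂ (λ x y → x * t ≤ y) (sym (∣product∣ none m)) a≡ (Π⁺-upper ⟪ T ⟫ ⟪ c ⟫ 0<T 0<c (size m) tm _ eq)
          , subst₂ (λ x y → 1ℚ ≤ y * (x * t)) (sym (∣product∣ none m)) a≡ (Π⁺-lower ⟪ T ⟫ ⟪ c ⟫ 0<T 0<c (size m) tm _ eq)
          where
          eq : ∀ S ne → ∣ eval none (factor S ne) m ∣ ≡ size m S ne false
          eq S ne = trans (eval-factor none S ne m) (cong (size m S ne) (χ-∅ˡ S))

        product≤ : ∀ σ {m} → (∀ S ne → Tame ⟪ T ⟫ ⟪ c ⟫ (size m S ne)) → ∣ product σ m ∣ ≤ ⟪ a ⟫ * ⟪ T ⟫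
        product≤ σ {m} tm with ∅⊎NonEmpty σ
        ... | inj₂ ne = subst₂ (λ x y → x ≤ y * ⟪ T ⟫) (sym (∣product∣ σ m)) a≡
                (Π⁺-conjugate ⟪ T ⟫ ⟪ c ⟫ 0<T 0<c σ ne (size m) tm _ (λ S ne → eval-factor σ S ne m))
        ... | inj₁ refl = ≤-trans (≤*1≤ (0≤∣p∣ (product none m)) (subst (1ℚ ≤_) (sym t≡) (1≤⟪⟫ 1≤tⁿ)))
                (≤-trans (proj₁ (product∅-bounds tm)) (≤*1≤ (0≤⟪⟫ a) (1≤⟪⟫ 1≤T)))

      unit-conjugates : ∀ σ → Eventually (λ m → ∣ eval σ unit m ∣ ≤ ⟪ unitBound ⟫ * ⟪ T ⟫)
      unit-conjugates σ = eventually-map (λ m (tm , close) → bound m (product≤ σ tm) close)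
        (eventually-× tame (≈⇒eventually (unit≈ σ) 1))
        where
        open +-*-Solver
        bound : ∀ m → ∣ product σ m ∣ ≤ ⟪ a ⟫ * ⟪ T ⟫ → ∣ eval σ unit m - product σ m ∣ * ⟪ 1 ⟫ ≤ 1ℚ →
                ∣ eval σ unit m ∣ ≤ ⟪ unitBound ⟫ * ⟪ T ⟫
        bound m p≤ close = begin
          ∣ eval σ unit m ∣                                            ≤⟨ ∣p∣≤∣p-q∣+∣q∣ (eval σ unit m) (product σ m) ⟩
          ∣ eval σ unit m - product σ m ∣ + ∣ product σ m ∣            ≤⟨ +-mono-≤ (subst (_≤ 1ℚ) (trans (cong (∣ eval σ unit m - product σ m ∣ *_) ι1≡1) (*-identityʳ ∣ eval σ unit m - product σ m ∣)) close) p≤ ⟩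
          1ℚ + ⟪ a ⟫ * ⟪ T ⟫                                           ≤⟨ ≤-cert ((⟪ T ⟫ - 1ℚ) + ⟪ a ⟫ * ⟪ T ⟫) (0≤+ (0≤- (1≤⟪⟫ 1≤T)) (0≤* (0≤⟪⟫ a) (0≤⟪⟫ T)))
                                                                           (solve 2 (λ a t → (con 1ℚ :+ (a :+ a)) :* t := (con 1ℚ :+ a :* t) :+ ((t :- con 1ℚ) :+ a :* t)) refl ⟪ a ⟫ ⟪ T ⟫) ⟩
          (1ℚ + (⟪ a ⟫ + ⟪ a ⟫)) * ⟪ T ⟫                               ≡⟨ cong (_* ⟪ T ⟫) (sym unitBound≡) ⟩
          ⟪ unitBound ⟫ * ⟪ T ⟫                                        ∎
          where open ≤-Reasoning

      unit-coefficients : Coefficients≤ (⟪ unitBound ⟫ * ⟪ T ⟫) unit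
      unit-coefficients = coefficients≤ unit (⟪ unitBound ⟫ * ⟪ T ⟫) unit-conjugates

      -- The evaluation of `unit` is eventually within 1 / (2 a T^K) of the product of its factors.
      -- That is half the lower bound 1 / (a T^K) for the product, so half of it survives.
      unit-size : Eventually (λ m → ∣ eval none unit m ∣ * t ≤ ⟪ unitBound ⟫ × 1ℚ ≤ ⟪ unitBound ⟫ * (∣ eval none unit m ∣ * t))
      unit-size = eventually-map (λ m (tm , close) → bounds m (product∅-bounds tm) close)
        (eventually-× tame (≈⇒eventually (unit≈ none) (2 ℕ.* (a ℕ.* tⁿ))))
        where
        open +-*-Solver
        bounds : ∀ m → ∣ product none m ∣ * t ≤ ⟪ a ⟫ × 1ℚ ≤ ⟪ a ⟫ * (∣ product none m ∣ * t) →
                 ∣ eval none unit m - product none m ∣ * ⟪ 2 ℕ.* (a ℕ.* tⁿ) ⟫ ≤ 1ℚ →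
                 ∣ eval none unit m ∣ * t ≤ ⟪ unitBound ⟫ × 1ℚ ≤ ⟪ unitBound ⟫ * (∣ eval none unit m ∣ * t)
        bounds m (upper , lower) close =
          subst (v * t ≤_) (sym unitBound≡) (≤-cert ((e + p - v) * t + (A - p * t) + (1ℚ - (A * (e * t) + A * (e * t))) + ((A - 1ℚ) * (e * t) + A * (e * t)) + A)
            (0≤+ (0≤+ (0≤+ (0≤+ (0≤* (0≤- v≤) 0≤t) (0≤- upper)) (0≤- close′)) (0≤+ (0≤* (0≤- (1≤⟪⟫ 1≤a)) 0≤et) (0≤* (0≤⟪⟫ a) 0≤et))) (0≤⟪⟫ a))
            (solve 5 (λ v e p t a → con 1ℚ :+ (a :+ a) := v :* t :+ ((e :+ p :- v) :* t :+ (a :- p :* t) :+ (con 1ℚ :- (a :* (e :* t) :+ a :* (e :* t)))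
               :+ ((a :- con 1ℚ) :* (e :* t) :+ a :* (e :* t)) :+ a)) refl v e p t A))
          , subst (λ z → 1ℚ ≤ z * (v * t)) (sym unitBound≡) (≤-cert
              ((A * (p * t) - 1ℚ) + (A * (p * t) - 1ℚ) + ((A * t + A * t) * (e + v - p)) + (1ℚ - (A * (e * t) + A * (e * t))) + v * t)
              (0≤+ (0≤+ (0≤+ (0≤+ (0≤- lower) (0≤- lower)) (0≤* (0≤+ 0≤At 0≤At) (0≤- p≤))) (0≤- close′)) (0≤* (0≤∣p∣ (eval none unit m)) 0≤t))
              (solve 5 (λ v e p t a → (con 1ℚ :+ (a :+ a)) :* (v :* t) := con 1ℚ :+ ((a :* (p :* t) :- con 1ℚ) :+ (a :* (p :* t) :- con 1ℚ)
                :+ ((a :* t :+ a :* t) :* (e :+ v :- p)) :+ (con 1ℚ :- (a :* (e :* t) :+ a :* (e :* t))) :+ v :* t)) refl v e p t A))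
          where
          v = ∣ eval none unit m ∣
          p = ∣ product none m ∣
          e = ∣ eval none unit m - product none m ∣
          A = ⟪ a ⟫
          0≤et : 0ℚ ≤ e * t
          0≤et = 0≤* (0≤∣p∣ (eval none unit m - product none m)) 0≤t
          0≤At : 0ℚ ≤ A * t
          0≤At = 0≤* (0≤⟪⟫ a) 0≤t
          v≤ : v ≤ e + p
          v≤ = ∣p∣≤∣p-q∣+∣q∣ (eval none unit m) (product none m)
          p≤ : p ≤ e + v
          p≤ = subst (λ z → p ≤ z + v) (∣p-q∣≡∣q-p∣ (product none m) (eval none unit m)) (∣p∣≤∣p-q∣+∣q∣ (product none m) (eval none unit m))
          close′ : A * (e * t) + A * (e * t) ≤ 1ℚ
          close′ = subst (_≤ 1ℚ) (trans (cong (e *_) (trans (⟪2*⟫ (a ℕ.* tⁿ)) (cong (λ z → z + z) (trans (⟪⟫-* a tⁿ) (cong (A *_) (sym t≡))))))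
            (solve 3 (λ e a t → e :* (a :* t :+ a :* t) := a :* (e :* t) :+ a :* (e :* t)) refl e A t)) close

-- Greedy expansion in the units at powers of two

module GreedyExpansion where
  open import Data.Rational hiding (NonZero)
  open import Data.Rational.Properties
  open RationalArithmetic
  open Convergents
  open Limits
  open MultiquadraticRing
  open ConjugateProducts
  open TameFactors
  open Units

  distℤ≤1 : ∀ p → distℤ p ≤ 1ℚ
  distℤ≤1 p = *-cancelʳ (1ℚ + 1ℚ) (+-mono-< 0<1 0<1) (begin
    distℤ p * (1ℚ + 1ℚ)                  ≡⟨ solve 1 (λ d → d :* (con 1ℚ :+ con 1ℚ) := d :+ d) refl (distℤ p) ⟩
    distℤ p + distℤ p                    ≤⟨ +-mono-≤ (p⊓q≤p (p - f / 1) (ℤ.suc f / 1 - p)) (p⊓q≤q (p - f / 1) (ℤ.suc f / 1 - p)) ⟩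
    (p - f / 1) + (ℤ.suc f / 1 - p)      ≡⟨ cong₂ (λ x y → (p - x) + (y - p)) (sym (ι≡/1 f)) (trans (sym (ι≡/1 (ℤ.suc f))) (ι-+ (+ 1) f)) ⟩
    (p - ι f) + (⟪ 1 ⟫ + ι f - p)        ≡⟨ solve 3 (λ p f o → (p :- f) :+ (o :+ f :- p) := o) refl p (ι f) ⟪ 1 ⟫ ⟩
    ⟪ 1 ⟫                                ≡⟨ ι1≡1 ⟩
    1ℚ                                   ≤⟨ ≤+ʳ 0≤1 ⟩
    1ℚ + 1ℚ                              ≡⟨ sym (*-identityˡ (1ℚ + 1ℚ)) ⟩
    1ℚ * (1ℚ + 1ℚ)                       ∎)
    where
    open ≤-Reasoning
    open +-*-Solver
    f = floor p

  nearest : ∀ p → ∃[ c ] ∣ p - ι c ∣ ≤ 1ℚ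
  nearest p with distℤ-attained p
  ... | c , eq = c , subst (_≤ 1ℚ) (trans eq (cong (λ z → ∣ p - z ∣) (sym (ι≡/1 c)))) (distℤ≤1 p)

  quotient : ∀ r v → v ≢ 0ℚ → ∃[ c ] ∣ r - ι c * v ∣ ≤ ∣ v ∣
  quotient r v v≢0 =
    let (c , h) = nearest (r * 1/ v) in c , (begin
      ∣ r - ι c * v ∣                       ≡⟨ cong (λ z → ∣ z - ι c * v ∣) (sym (trans (*-assoc r (1/ v) v) (trans (cong (r *_) (*-inverseˡ v)) (*-identityʳ r)))) ⟩
      ∣ r * 1/ v * v - ι c * v ∣            ≡⟨ cong ∣_∣ (solve 3 (λ x c v → x :* v :- c :* v := (x :- c) :* v) refl (r * 1/ v) (ι c) v) ⟩
      ∣ (r * 1/ v - ι c) * v ∣              ≡⟨ ∣p*q∣≡∣p∣*∣q∣ (r * 1/ v - ι c) v ⟩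
      ∣ r * 1/ v - ι c ∣ * ∣ v ∣            ≤⟨ *-monoˡ ∣ v ∣ (0≤∣p∣ v) h ⟩
      1ℚ * ∣ v ∣                            ≡⟨ *-identityˡ ∣ v ∣ ⟩
      ∣ v ∣                                 ∎)
    where
    open ≤-Reasoning
    open +-*-Solver
    instance _ = ≢-nonZero v≢0

  coefficients-⊞ : ∀ {j A B} (u v : Multiquadratic j) → Coefficients≤ A u → Coefficients≤ B v → Coefficients≤ (A + B) (u ⊞ v)
  coefficients-⊞ {zero} a b ha hb = ≤-trans (subst (λ z → ∣ z ∣ ≤ ∣ ι a ∣ + ∣ ι b ∣) (sym (ι-+ a b)) (∣p+q∣≤∣p∣+∣q∣ (ι a) (ι b))) (+-mono-≤ ha hb)
  coefficients-⊞ {suc j} (a , b) (c , d) (ha , hb) (hc , hd) = coefficients-⊞ a c ha hc , coefficients-⊞ b d hb hd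

  coefficients-• : ∀ {j B} n (u : Multiquadratic j) → Coefficients≤ B u → Coefficients≤ (∣ ι n ∣ * B) (n • u)
  coefficients-• {zero} n a h = subst (_≤ ∣ ι n ∣ * _) (sym (trans (cong ∣_∣ (ι-* n a)) (∣p*q∣≡∣p∣*∣q∣ (ι n) (ι a)))) (*-monoʳ ∣ ι n ∣ (0≤∣p∣ (ι n)) h)
  coefficients-• {suc j} n (a , b) (ha , hb) = coefficients-• n a ha , coefficients-• n b hb

  coefficients-weaken : ∀ {j A B} (u : Multiquadratic j) → A ≤ B → Coefficients≤ A u → Coefficients≤ B u
  coefficients-weaken {zero}  a       A≤B h         = ≤-trans h A≤B
  coefficients-weaken {suc j} (a , b) A≤B (ha , hb) = coefficients-weaken a A≤B ha , coefficients-weaken b A≤B hb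

  coefficients-0 : ∀ j {B} → 0ℚ ≤ B → Coefficients≤ {j} B (constant (+ 0))
  coefficients-0 zero {B} 0≤B = subst (_≤ B) (sym (trans (cong ∣_∣ ι0≡0) (0≤p⇒∣p∣≡p ≤-refl))) 0≤B
  coefficients-0 (suc j)  0≤B = coefficients-0 j 0≤B , coefficients-0 j 0≤B

  module _ (ℓ : ℕ) where
    1≤2^ : ∀ i → 1 ℕ.≤ 2 ℕ.^ i
    1≤2^ = ℕ.m^n>0 2

    scale : ℕ → ℚ
    scale i = pow⁺ ℓ ⟪ 2 ℕ.^ i ⟫

    unitAt : ℕ → Multiquadratic ℓ
    unitAt i = unit ℓ (2 ℕ.^ i) (1≤2^ i)

    UnitSize : ℕ → ℕ → Set
    UnitSize i m = ∣ eval none (unitAt i) m ∣ * scale i ≤ ⟪ unitBound ℓ ⟫ × 1ℚ ≤ ⟪ unitBound ℓ ⟫ * (∣ eval none (unitAt i) m ∣ * scale i)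

    private
      A = unitBound ℓ
      τᴺ = 2 ℕ.^ count⁺ ℓ
      τ : ℚ
      τ = ⟪ τᴺ ⟫

    -- After division by u_T the residue is at most |u_T| ≤ A / T^K. Measured against the next scale
    -- (2 T)^K this costs 2^K, independently of the residue before, so the constant does not grow
    -- along the expansion.
    residueBound : ℕ
    residueBound = A ℕ.* τᴺ

    -- A digit is at most (|r| + |v|) / |v|, where 1 / |v| ≤ A T^K and |r|, |v| are at most
    -- `residueBound` and A over T^K.
    digitBound : ℕ
    digitBound = A ℕ.* (residueBound ℕ.+ A)

    scale-zero : scale 0 ≡ 1ℚ
    scale-zero = trans (cong (pow⁺ ℓ) ι1≡1) (pow⁺-1 ℓ)

    scale-suc : ∀ i → scale (suc i) ≡ τ * scale i
    scale-suc i = trans (cong (pow⁺ ℓ) (⟪⟫-* 2 (2 ℕ.^ i))) (trans (pow⁺-* ℓ ⟪ 2 ⟫ ⟪ 2 ℕ.^ i ⟫)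
      (cong (_* scale i) (pow⁺-⟪⟫ ℓ 2)))

    0<scale : ∀ i → 0ℚ < scale i
    0<scale i = pow⁺-pos ℓ (0<⟪⟫ (1≤2^ i))

    private
      1≤A : 1 ℕ.≤ A
      1≤A = 1≤unitBound ℓ

      1≤τᴺ : 1 ℕ.≤ τᴺ
      1≤τᴺ = 1≤2^ (count⁺ ℓ)

      -- The upper bound on the unit makes the residue shrink; the lower bound makes division
      -- possible and keeps the digit bounded.
      nextDigit : ∀ i m → UnitSize i m → ∀ r → ∣ r ∣ * scale i ≤ ⟪ residueBound ⟫ →
        ∃[ c ] ∣ ι c ∣ ≤ ⟪ digitBound ⟫ × ∣ r - ι c * eval none (unitAt i) m ∣ * scale (suc i) ≤ ⟪ residueBound ⟫
      nextDigit i m (upper , lower) r r≤ = result (quotient r v v≢0)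
        where
        open ≤-Reasoning
        open +-*-Solver
        v = eval none (unitAt i) m
        t = scale i
        0≤t : 0ℚ ≤ t
        0≤t = <⇒≤ (0<scale i)
        v≢0 : v ≢ 0ℚ
        v≢0 eq = <⇒≢ 0<1 (≤-antisym 0≤1 (≤-trans lower (≤-reflexive (trans
          (cong (λ z → ⟪ A ⟫ * (z * t)) (trans (cong ∣_∣ eq) (0≤p⇒∣p∣≡p ≤-refl)))
          (solve 2 (λ a t → a :* (con 0ℚ :* t) := con 0ℚ) refl ⟪ A ⟫ t)))))
        result : (∃[ c ] ∣ r - ι c * v ∣ ≤ ∣ v ∣) → ∃[ c ] ∣ ι c ∣ ≤ ⟪ digitBound ⟫ × ∣ r - ι c * v ∣ * scale (suc i) ≤ ⟪ residueBound ⟫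
        result (c , close) = c , digit , residue
          where
          cv≤ : ∣ ι c ∣ * ∣ v ∣ ≤ ∣ v ∣ + ∣ r ∣
          cv≤ = begin
            ∣ ι c ∣ * ∣ v ∣                ≡⟨ sym (∣p*q∣≡∣p∣*∣q∣ (ι c) v) ⟩
            ∣ ι c * v ∣                    ≤⟨ ∣p∣≤∣p-q∣+∣q∣ (ι c * v) r ⟩
            ∣ ι c * v - r ∣ + ∣ r ∣        ≤⟨ +-monoˡ-≤ ∣ r ∣ (subst (_≤ ∣ v ∣) (∣p-q∣≡∣q-p∣ r (ι c * v)) close) ⟩
            ∣ v ∣ + ∣ r ∣                  ∎
          digit : ∣ ι c ∣ ≤ ⟪ digitBound ⟫
          digit = begin
            ∣ ι c ∣                                  ≤⟨ ≤*1≤ (0≤∣p∣ (ι c)) lower ⟩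
            ∣ ι c ∣ * (⟪ A ⟫ * (∣ v ∣ * t))          ≡⟨ solve 4 (λ c a v t → c :* (a :* (v :* t)) := a :* (c :* v :* t)) refl (∣ ι c ∣) ⟪ A ⟫ (∣ v ∣) t ⟩
            ⟪ A ⟫ * (∣ ι c ∣ * ∣ v ∣ * t)            ≤⟨ *-monoʳ ⟪ A ⟫ (0≤⟪⟫ A) (*-monoˡ t 0≤t cv≤) ⟩
            ⟪ A ⟫ * ((∣ v ∣ + ∣ r ∣) * t)            ≡⟨ cong (⟪ A ⟫ *_) (solve 3 (λ v r t → (v :+ r) :* t := r :* t :+ v :* t) refl (∣ v ∣) (∣ r ∣) t) ⟩
            ⟪ A ⟫ * (∣ r ∣ * t + ∣ v ∣ * t)          ≤⟨ *-monoʳ ⟪ A ⟫ (0≤⟪⟫ A) (+-mono-≤ r≤ upper) ⟩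
            ⟪ A ⟫ * (⟪ residueBound ⟫ + ⟪ A ⟫)       ≡⟨ sym (trans (⟪⟫-* A (residueBound ℕ.+ A)) (cong (⟪ A ⟫ *_) (⟪⟫-+ residueBound A))) ⟩
            ⟪ digitBound ⟫                           ∎
          residue : ∣ r - ι c * v ∣ * scale (suc i) ≤ ⟪ residueBound ⟫
          residue = begin
            ∣ r - ι c * v ∣ * scale (suc i)   ≤⟨ *-monoˡ (scale (suc i)) (<⇒≤ (0<scale (suc i))) close ⟩
            ∣ v ∣ * scale (suc i)             ≡⟨ cong (∣ v ∣ *_) (scale-suc i) ⟩
            ∣ v ∣ * (τ * t)                   ≡⟨ solve 3 (λ v τ t → v :* (τ :* t) := v :* t :* τ) refl (∣ v ∣) τ t ⟩
            ∣ v ∣ * t * τ                     ≤⟨ *-monoˡ τ (0≤⟪⟫ τᴺ) upper ⟩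
            ⟪ A ⟫ * τ                         ≡⟨ sym (⟪⟫-* A τᴺ) ⟩
            ⟪ residueBound ⟫                  ∎

    -- The i-th term contributes at most `digitBound` · A · 2^i to a coefficient. These
    -- contributions form a geometric series, so each doubling of the bound leaves exactly enough
    -- room for the next term.
    coefficientBound : ℕ → ℕ
    coefficientBound i = digitBound ℕ.* A ℕ.* 2 ℕ.^ i

    -- Greedy expansion: each digit is the integer nearest to the quotient of the residue by the next unit.
    Expansion : ℕ → ℕ → ℚ → Set
    Expansion I m β = Σ[ c ∈ ℤ ] Σ[ y ∈ Multiquadratic ℓ ] Coefficients≤ ⟪ coefficientBound I ⟫ y ×
        ∣ β - (ι c + eval none y m) ∣ * scale I ≤ ⟪ residueBound ⟫

    expand : ∀ I m → (∀ i → i ℕ.< I → UnitSize i m) → ∀ β → Expansion I m β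
    expand zero m _ β =
      let (c , close) = nearest β in
      c , constant (+ 0) , coefficients-0 ℓ (0≤⟪⟫ (coefficientBound 0)) , (begin
        ∣ β - (ι c + eval none (constant {ℓ} (+ 0)) m) ∣ * scale 0   ≡⟨ cong₂ (λ x y → ∣ β - (ι c + x) ∣ * y) (trans (eval-constant {ℓ} none (+ 0) m) ι0≡0) scale-zero ⟩
        ∣ β - (ι c + 0ℚ) ∣ * 1ℚ                                  ≡⟨ *-identityʳ ∣ β - (ι c + 0ℚ) ∣ ⟩
        ∣ β - (ι c + 0ℚ) ∣                                       ≡⟨ cong (λ z → ∣ β - z ∣) (+-identityʳ (ι c)) ⟩
        ∣ β - ι c ∣                                              ≤⟨ close ⟩
        1ℚ                                                       ≤⟨ 1≤⟪⟫ (ℕ.*-mono-≤ 1≤A 1≤τᴺ) ⟩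
        ⟪ residueBound ⟫                                         ∎)
      where open ≤-Reasoning
    expand (suc I) m good β = refine (expand I m (λ i i<I → good i (ℕ.m<n⇒m<1+n i<I)) β)
      where
      open +-*-Solver
      refine : Expansion I m β → Expansion (suc I) m β
      refine (c , y , y≤ , r≤) =
        let (d , d≤ , r′≤) = nextDigit I m (good I ℕ.≤-refl) (β - (ι c + eval none y m)) r≤
        in c , y ⊞ d • unitAt I
           , coefficients-weaken (y ⊞ d • unitAt I) (bound d d≤)
               (coefficients-⊞ {A = ⟪ coefficientBound I ⟫} {B = ∣ ι d ∣ * (⟪ A ⟫ * ⟪ 2 ℕ.^ I ⟫)} y (d • unitAt I) y≤
                 (coefficients-• {B = ⟪ A ⟫ * ⟪ 2 ℕ.^ I ⟫} d (unitAt I) (unit-coefficients ℓ (2 ℕ.^ I) (1≤2^ I))))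
           , subst (λ z → ∣ z ∣ * scale (suc I) ≤ ⟪ residueBound ⟫) (regroup d) r′≤
        where
        v = eval none (unitAt I) m
        regroup : ∀ d → β - (ι c + eval none y m) - ι d * v ≡ β - (ι c + eval none (y ⊞ d • unitAt I) m)
        regroup d = trans (solve 4 (λ b c y w → b :- (c :+ y) :- w := b :- (c :+ (y :+ w))) refl β (ι c) (eval none y m) (ι d * v))
          (cong (λ z → β - (ι c + z)) (sym (trans (eval-⊞ none y (d • unitAt I) m) (cong (_+_ (eval none y m)) (eval-• none d (unitAt I) m)))))
        bound : ∀ d → ∣ ι d ∣ ≤ ⟪ digitBound ⟫ → ⟪ coefficientBound I ⟫ + ∣ ι d ∣ * (⟪ A ⟫ * ⟪ 2 ℕ.^ I ⟫) ≤ ⟪ coefficientBound (suc I) ⟫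
        bound d d≤ = begin
          ⟪ coefficientBound I ⟫ + ∣ ι d ∣ * (⟪ A ⟫ * ⟪ 2 ℕ.^ I ⟫)
            ≤⟨ +-monoʳ-≤ ⟪ coefficientBound I ⟫ (*-monoˡ (⟪ A ⟫ * ⟪ 2 ℕ.^ I ⟫) (0≤* (0≤⟪⟫ A) (0≤⟪⟫ (2 ℕ.^ I))) d≤) ⟩
          ⟪ coefficientBound I ⟫ + ⟪ digitBound ⟫ * (⟪ A ⟫ * ⟪ 2 ℕ.^ I ⟫)
            ≡⟨ cong (_+_ ⟪ coefficientBound I ⟫) (trans (sym (*-assoc ⟪ digitBound ⟫ ⟪ A ⟫ ⟪ 2 ℕ.^ I ⟫))
                 (sym (trans (⟪⟫-* (digitBound ℕ.* A) (2 ℕ.^ I)) (cong (_* ⟪ 2 ℕ.^ I ⟫) (⟪⟫-* digitBound A))))) ⟩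
          ⟪ coefficientBound I ⟫ + ⟪ coefficientBound I ⟫
            ≡⟨ sym (⟪2*⟫ (coefficientBound I)) ⟩
          ⟪ 2 ℕ.* coefficientBound I ⟫
            ≡⟨ cong ⟪_⟫ (trans (sym (ℕ.*-assoc 2 (digitBound ℕ.* A) (2 ℕ.^ I))) (trans (cong (ℕ._* 2 ℕ.^ I) (ℕ.*-comm 2 (digitBound ℕ.* A))) (ℕ.*-assoc (digitBound ℕ.* A) 2 (2 ℕ.^ I)))) ⟩
          ⟪ coefficientBound (suc I) ⟫ ∎
          where open ≤-Reasoning

-- From ring elements to sums of square roots

module SquareRootSums where
  open import Data.Rational hiding (NonZero)
  open import Data.Rational.Properties
  open RationalArithmetic
  open Convergents
  open Limits
  open MultiquadraticRing
  open ConjugateProducts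
  open TameFactors
  open Units
  open GreedyExpansion

  sqrt-lipschitz : ∀ {p q} → 1ℚ ≤ p → 1ℚ ≤ q → ∣ p - q ∣ ≤ ∣ p * p - q * q ∣
  sqrt-lipschitz {p} {q} 1≤p 1≤q = begin
    ∣ p - q ∣                 ≤⟨ ≤*1≤ (0≤∣p∣ (p - q)) (≤-trans 1≤p (≤-trans (≤+ʳ (≤-trans 0≤1 1≤q)) (p≤∣p∣ (p + q)))) ⟩
    ∣ p - q ∣ * ∣ p + q ∣     ≡⟨ sym (∣p*q∣≡∣p∣*∣q∣ (p - q) (p + q)) ⟩
    ∣ (p - q) * (p + q) ∣     ≡⟨ cong ∣_∣ (solve 2 (λ p q → (p :- q) :* (p :+ q) := p :* p :- q :* q) refl p q) ⟩
    ∣ p * p - q * q ∣         ∎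
    where
    open ≤-Reasoning
    open +-*-Solver

  -- On values at least 1 the square root is Lipschitz, so comparing the squares costs nothing in
  -- the rate.
  ≈-sqrt : ∀ {F G} → (∀ m → 1ℚ ≤ F m) → (∀ m → 1ℚ ≤ G m) → (λ m → F m * F m) ≈ (λ m → G m * G m) → F ≈ G
  ≈-sqrt {F} {G} 1≤F 1≤G (near K h) = near K λ m →
    ≤-trans (*-monoˡ ⟪ suc m ⟫ (0≤⟪⟫ (suc m)) (sqrt-lipschitz (1≤F m) (1≤G m))) (h m)

  sqrt-drift : ∀ b → 1 ℕ.≤ b → ∀ {N m m′} → N ℕ.≤ m → N ℕ.≤ m′ →
               ∣ sqrtApprox b m - sqrtApprox b m′ ∣ * ⟪ suc N ⟫ ≤ ⟪ 4 ℕ.* b ⟫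
  sqrt-drift b 1≤b {N} {m} {m′} N≤m N≤m′ = begin
    ∣ r - r′ ∣ * ⟪ suc N ⟫                          ≤⟨ *-monoˡ ⟪ suc N ⟫ (0≤⟪⟫ (suc N)) (sqrt-lipschitz (SqrtApprox.1≤r b 1≤b m) (SqrtApprox.1≤r b 1≤b m′)) ⟩
    ∣ r * r - r′ * r′ ∣ * ⟪ suc N ⟫                 ≤⟨ *-monoˡ ⟪ suc N ⟫ (0≤⟪⟫ (suc N)) (∣-∣-triangle (r * r) ⟪ b ⟫ (r′ * r′)) ⟩
    (∣ r * r - ⟪ b ⟫ ∣ + ∣ ⟪ b ⟫ - r′ * r′ ∣) * ⟪ suc N ⟫   ≡⟨ *-distribʳ-+ ⟪ suc N ⟫ (∣ r * r - ⟪ b ⟫ ∣) (∣ ⟪ b ⟫ - r′ * r′ ∣) ⟩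
    ∣ r * r - ⟪ b ⟫ ∣ * ⟪ suc N ⟫ + ∣ ⟪ b ⟫ - r′ * r′ ∣ * ⟪ suc N ⟫   ≤⟨ +-mono-≤ (at m N≤m) (subst (λ z → z * ⟪ suc N ⟫ ≤ ⟪ 2 ℕ.* b ⟫) (∣p-q∣≡∣q-p∣ (r′ * r′) ⟪ b ⟫) (at m′ N≤m′)) ⟩
    ⟪ 2 ℕ.* b ⟫ + ⟪ 2 ℕ.* b ⟫                       ≡⟨ sym (⟪⟫-+ (2 ℕ.* b) (2 ℕ.* b)) ⟩
    ⟪ 2 ℕ.* b ℕ.+ 2 ℕ.* b ⟫                         ≡⟨ cong ⟪_⟫ (sym (ℕ.*-distribʳ-+ b 2 2)) ⟩
    ⟪ 4 ℕ.* b ⟫                                     ∎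
    where
    open ≤-Reasoning
    r = sqrtApprox b m
    r′ = sqrtApprox b m′
    at : ∀ m → N ℕ.≤ m → ∣ sqrtApprox b m * sqrtApprox b m - ⟪ b ⟫ ∣ * ⟪ suc N ⟫ ≤ ⟪ 2 ℕ.* b ⟫
    at m N≤m = ≤-trans (*-monoʳ (∣ sqrtApprox b m * sqrtApprox b m - ⟪ b ⟫ ∣) (0≤∣p∣ _) (⟪⟫-mono (s≤s N≤m))) (SqrtApprox.r²-near b 1≤b m)

  -- The product of all 1 + p_i, which bounds the sum of all √D_S.
  weight : ℕ → ℕ
  weight zero    = 1
  weight (suc j) = weight j ℕ.+ prime j ℕ.* weight j

  -- Follows the product rule for x + r y: the changes of x and of y, and the change of the
  -- approximation r to √p_j, at most 4 p_j over the index, multiplied by the size of y.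
  drift : ℕ → ℕ
  drift zero    = 0
  drift (suc j) = drift j ℕ.+ (prime j ℕ.* drift j ℕ.+ 4 ℕ.* prime j ℕ.* weight j)

  eval-bound : ∀ {j B} (y : Multiquadratic j) → Coefficients≤ B y → ∀ m → ∣ eval none y m ∣ ≤ B * ⟪ weight j ⟫
  eval-bound {zero} {B} a h m = subst (∣ ι a ∣ ≤_) (sym (trans (cong (B *_) ι1≡1) (*-identityʳ B))) h
  eval-bound {suc j} {B} (a , b) (ha , hb) m = begin
    ∣ eval none a m + r * eval none b m ∣               ≤⟨ ∣p+q∣≤∣p∣+∣q∣ (eval none a m) (r * eval none b m) ⟩
    ∣ eval none a m ∣ + ∣ r * eval none b m ∣           ≡⟨ cong (_+_ (∣ eval none a m ∣)) (trans (∣p*q∣≡∣p∣*∣q∣ r (eval none b m)) (cong (_* ∣ eval none b m ∣) (0≤p⇒∣p∣≡p 0≤r))) ⟩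
    ∣ eval none a m ∣ + r * ∣ eval none b m ∣           ≤⟨ +-mono-≤ (eval-bound a ha m) (*-mono 0≤r (0≤∣p∣ (eval none b m)) (SqrtApprox.r≤b (prime j) (1≤prime j) m) (eval-bound b hb m)) ⟩
    B * ⟪ weight j ⟫ + ⟪ prime j ⟫ * (B * ⟪ weight j ⟫) ≡⟨ solve 3 (λ b w p → b :* w :+ p :* (b :* w) := b :* (w :+ p :* w)) refl B ⟪ weight j ⟫ ⟪ prime j ⟫ ⟩
    B * (⟪ weight j ⟫ + ⟪ prime j ⟫ * ⟪ weight j ⟫)     ≡⟨ cong (B *_) (sym (trans (⟪⟫-+ (weight j) (prime j ℕ.* weight j)) (cong (_+_ ⟪ weight j ⟫) (⟪⟫-* (prime j) (weight j))))) ⟩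
    B * ⟪ weight (suc j) ⟫                              ∎
    where
    open ≤-Reasoning
    open +-*-Solver using (solve; _:=_; _:+_; _:*_)
    r = sqrtApprox (prime j) m
    0≤r = SqrtApprox.0≤r (prime j) (1≤prime j) m

  -- The bound sees y only through B. This allows the index of the expansion to be chosen before y
  -- has been computed there.
  eval-drift : ∀ {j B} (y : Multiquadratic j) → Coefficients≤ B y → ∀ {N m m′} → N ℕ.≤ m → N ℕ.≤ m′ →
               ∣ eval none y m - eval none y m′ ∣ * ⟪ suc N ⟫ ≤ B * ⟪ drift j ⟫
  eval-drift {zero} {B} a h {N} _ _ = ≤-reflexive (trans (cong (λ z → ∣ z ∣ * ⟪ suc N ⟫) (+-inverseʳ (ι a)))
    (trans (*-zeroˡ ⟪ suc N ⟫) (sym (trans (cong (B *_) ι0≡0) (*-zeroʳ B)))))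
  eval-drift {suc j} {B} (a , b) (ha , hb) {N} {m} {m′} N≤m N≤m′ = begin
    ∣ (x + r * y) - (x′ + r′ * y′) ∣ * n
      ≡⟨ cong (λ z → ∣ z ∣ * n) (solve 6 (λ x r y x′ r′ y′ → (x :+ r :* y) :- (x′ :+ r′ :* y′) := (x :- x′) :+ (r :* (y :- y′) :+ (r :- r′) :* y′)) refl x r y x′ r′ y′) ⟩
    ∣ (x - x′) + (r * (y - y′) + (r - r′) * y′) ∣ * n
      ≤⟨ *-monoˡ n (0≤⟪⟫ (suc N)) (≤-trans (∣p+q∣≤∣p∣+∣q∣ (x - x′) (r * (y - y′) + (r - r′) * y′))
           (+-monoʳ-≤ (∣ x - x′ ∣) (∣p+q∣≤∣p∣+∣q∣ (r * (y - y′)) ((r - r′) * y′)))) ⟩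
    (∣ x - x′ ∣ + (∣ r * (y - y′) ∣ + ∣ (r - r′) * y′ ∣)) * n
      ≡⟨ cong₂ (λ u v → (∣ x - x′ ∣ + (u + v)) * n) (trans (∣p*q∣≡∣p∣*∣q∣ r (y - y′)) (cong (_* ∣ y - y′ ∣) (0≤p⇒∣p∣≡p 0≤r))) (∣p*q∣≡∣p∣*∣q∣ (r - r′) y′) ⟩
    (∣ x - x′ ∣ + (r * ∣ y - y′ ∣ + ∣ r - r′ ∣ * ∣ y′ ∣)) * n
      ≡⟨ solve 6 (λ a r b c d n → (a :+ (r :* b :+ c :* d)) :* n := a :* n :+ (r :* (b :* n) :+ (c :* n) :* d)) refl (∣ x - x′ ∣) r (∣ y - y′ ∣) (∣ r - r′ ∣) (∣ y′ ∣) n ⟩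
    ∣ x - x′ ∣ * n + (r * (∣ y - y′ ∣ * n) + (∣ r - r′ ∣ * n) * ∣ y′ ∣)
      ≤⟨ +-mono-≤ (eval-drift a ha N≤m N≤m′) (+-mono-≤
           (*-mono 0≤r (0≤* (0≤∣p∣ (y - y′)) (0≤⟪⟫ (suc N))) (SqrtApprox.r≤b p (1≤prime j) m) (eval-drift b hb N≤m N≤m′))
           (*-mono (0≤* (0≤∣p∣ (r - r′)) (0≤⟪⟫ (suc N))) (0≤∣p∣ y′) (sqrt-drift p (1≤prime j) N≤m N≤m′) (eval-bound b hb m′))) ⟩
    B * D + (⟪ p ⟫ * (B * D) + ⟪ 4 ℕ.* p ⟫ * (B * W))
      ≡⟨ solve 5 (λ b d p q w → b :* d :+ (p :* (b :* d) :+ q :* (b :* w)) := b :* (d :+ (p :* d :+ q :* w))) refl B D ⟪ p ⟫ ⟪ 4 ℕ.* p ⟫ W ⟩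
    B * (D + (⟪ p ⟫ * D + ⟪ 4 ℕ.* p ⟫ * W))
      ≡⟨ cong (B *_) (sym (trans (⟪⟫-+ (drift j) (p ℕ.* drift j ℕ.+ 4 ℕ.* p ℕ.* weight j)) (cong (_+_ D)
           (trans (⟪⟫-+ (p ℕ.* drift j) (4 ℕ.* p ℕ.* weight j)) (cong₂ _+_ (⟪⟫-* p (drift j)) (⟪⟫-* (4 ℕ.* p) (weight j))))))) ⟩
    B * ⟪ drift (suc j) ⟫ ∎
    where
    open ≤-Reasoning
    open +-*-Solver using (solve; _:=_; _:+_; _:*_; _:-_)
    p = prime j
    n = ⟪ suc N ⟫
    x = eval none a m
    y = eval none b m
    x′ = eval none a m′
    y′ = eval none b m′
    r = sqrtApprox p m
    r′ = sqrtApprox p m′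
    D = ⟪ drift j ⟫
    W = ⟪ weight j ⟫
    0≤r = SqrtApprox.0≤r p (1≤prime j) m

  coefficient : ∀ {j} → Multiquadratic j → Vec Bool j → ℤ
  coefficient a       []          = a
  coefficient (a , b) (false ∷ S) = coefficient a S
  coefficient (a , b) (true ∷ S)  = coefficient b S

  Π-cong : ∀ {A : Set} {_∙_ : A → A → A} {j} {f g : Vec Bool j → A} → (∀ S → f S ≡ g S) → Π _∙_ f ≡ Π _∙_ g
  Π-cong {j = zero} eq = eq []
  Π-cong {_∙_ = _∙_} {j = suc j} eq = cong₂ _∙_ (Π-cong (λ S → eq (false ∷ S))) (Π-cong (λ S → eq (true ∷ S)))

  Σ-scale : ∀ {j} c (f : Vec Bool j → ℚ) → c * Π _+_ f ≡ Π _+_ (λ S → c * f S)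
  Σ-scale {zero}  c f = refl
  Σ-scale {suc j} c f = trans (*-distribˡ-+ c (Π _+_ (λ S → f (false ∷ S))) (Π _+_ (λ S → f (true ∷ S))))
    (cong₂ _+_ (Σ-scale c (λ S → f (false ∷ S))) (Σ-scale c (λ S → f (true ∷ S))))

  Σ-split : ∀ {j} (f : Vec Bool j → ℚ) → Π _+_ f ≡ f none + Π⁺ _+_ 0ℚ (λ S _ → f S)
  Σ-split {zero}  f = sym (+-identityʳ (f []))
  Σ-split {suc j} f = trans (cong (_+ Π _+_ (λ S → f (true ∷ S))) (Σ-split (λ S → f (false ∷ S))))
    (+-assoc (f none) (Π⁺ _+_ 0ℚ (λ S _ → f (false ∷ S))) (Π _+_ (λ S → f (true ∷ S))))

  eval-sum : ∀ {j} (y : Multiquadratic j) m → eval none y m ≡ Π _+_ (λ S → ι (coefficient y S) * sqrtProduct S m)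
  eval-sum {zero}  a       m = sym (*-identityʳ (ι a))
  eval-sum {suc j} (a , b) m = cong₂ _+_ (eval-sum a m) (trans (cong (r *_) (eval-sum b m))
    (trans (Σ-scale r (λ S → ι (coefficient b S) * sqrtProduct S m)) (Π-cong {_∙_ = _+_} λ S →
      solve 3 (λ r c s → r :* (c :* s) := c :* (r :* s)) refl r (ι (coefficient b S)) (sqrtProduct S m))))
    where
    open +-*-Solver using (solve; _:=_; _:*_)
    r = sqrtApprox (prime j) m

  -- Isolates the coefficient of √1, which vanishes modulo 1 and leaves K genuine roots.
  eval-split : ∀ {j} (y : Multiquadratic j) m →
    eval none y m ≡ ι (coefficient y none) + Π⁺ _+_ 0ℚ (λ S _ → ι (coefficient y S) * sqrtProduct S m)
  eval-split {j} y m = trans (eval-sum y m) (trans (Σ-split (λ S → ι (coefficient y S) * sqrtProduct S m))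
    (cong (_+ Π⁺ _+_ 0ℚ (λ S _ → ι (coefficient y S) * sqrtProduct S m))
      (trans (cong (ι (coefficient y none) *_) (sqrtProduct-∅ j m)) (*-identityʳ (ι (coefficient y none))))))

  Σ-≈ : ∀ {j} {f g : Vec Bool j → ℕ → ℚ} → (∀ S → f S ≈ g S) → (λ m → Π _+_ (λ S → f S m)) ≈ (λ m → Π _+_ (λ S → g S m))
  Σ-≈ {zero}  h = h []
  Σ-≈ {suc j} h = ≈-+ (Σ-≈ (λ S → h (false ∷ S))) (Σ-≈ (λ S → h (true ∷ S)))

  Σ⁺-≈ : ∀ {j} {f g : (S : Vec Bool j) → NonEmpty S → ℕ → ℚ} → (∀ S ne → f S ne ≈ g S ne) →
         (λ m → Π⁺ _+_ 0ℚ (λ S ne → f S ne m)) ≈ (λ m → Π⁺ _+_ 0ℚ (λ S ne → g S ne m))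
  Σ⁺-≈ {zero}  h = ≡⇒≈ λ _ → refl
  Σ⁺-≈ {suc j} h = ≈-+ (Σ⁺-≈ (λ S → h (false ∷ S))) (Σ-≈ (λ S → h (true ∷ S) tt))

  -- The approximations on the two sides are rounded differently, so they are compared through their
  -- squares, both of which tend to a² D_S.
  sqrt-square* : ∀ {j} (S : Vec Bool j) a → 1 ℕ.≤ a → sqrtApprox (a ℕ.* a ℕ.* rad S) ≈ (λ m → ⟪ a ⟫ * sqrtProduct S m)
  sqrt-square* S a 1≤a = ≈-sqrt (SqrtApprox.1≤r b 1≤b)
      (λ m → ≤-trans (1≤⟪⟫ 1≤a) (≤*1≤ (0≤⟪⟫ a) (1≤sqrtProduct S m)))
      (≈-trans (root² b 1≤b) (≈-sym (≈-trans (≡⇒≈ λ m → interchange ⟪ a ⟫ (sqrtProduct S m) ⟪ a ⟫ (sqrtProduct S m))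
        (≈-trans (≈-scale (bounded-* (bounded-const (+ a)) (bounded-const (+ a))) (sqrtProduct² S))
          (≡⇒≈ λ m → sym (trans (⟪⟫-* (a ℕ.* a) (rad S)) (cong (_* ⟪ rad S ⟫) (⟪⟫-* a a))))))))
    where
    b = a ℕ.* a ℕ.* rad S
    1≤b = ℕ.*-mono-≤ (ℕ.*-mono-≤ 1≤a 1≤a) (1≤rad S)

  append : ∀ {A : Set} {m n} → (Fin m → A) → (Fin n → A) → Fin (m ℕ.+ n) → A
  append {m = zero}  f g i       = g i
  append {m = suc m} f g zero    = f zero
  append {m = suc m} f g (suc i) = append (λ i → f (suc i)) g i

  flatten : ∀ {A : Set} {j} → (Vec Bool j → A) → Fin (count j) → A
  flatten {j = zero}  f _ = f []
  flatten {j = suc j} f   = append (flatten (λ S → f (false ∷ S))) (flatten (λ S → f (true ∷ S)))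

  flatten⁺ : ∀ {A : Set} {j} → ((S : Vec Bool j) → NonEmpty S → A) → Fin (count⁺ j) → A
  flatten⁺ {j = suc j} f = append (flatten⁺ (λ S → f (false ∷ S))) (flatten (λ S → f (true ∷ S) tt))

  append-∀ : ∀ {A : Set} {P : A → Set} {m n} {f : Fin m → A} {g : Fin n → A} →
             (∀ i → P (f i)) → (∀ i → P (g i)) → ∀ i → P (append f g i)
  append-∀ {m = zero}  p q i       = q i
  append-∀ {m = suc m} p q zero    = p zero
  append-∀ {P = P} {m = suc m} p q (suc i) = append-∀ {P = P} (λ i → p (suc i)) q i

  flatten-∀ : ∀ {A : Set} {P : A → Set} {j} {f : Vec Bool j → A} → (∀ S → P (f S)) → ∀ i → P (flatten f i)
  flatten-∀ {j = zero}  p _ = p []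
  flatten-∀ {P = P} {j = suc j} p = append-∀ {P = P} (flatten-∀ {P = P} (λ S → p (false ∷ S))) (flatten-∀ {P = P} (λ S → p (true ∷ S)))

  flatten⁺-∀ : ∀ {A : Set} {P : A → Set} {j} {f : (S : Vec Bool j) → NonEmpty S → A} → (∀ S ne → P (f S ne)) → ∀ i → P (flatten⁺ f i)
  flatten⁺-∀ {P = P} {j = suc j} p = append-∀ {P = P} (flatten⁺-∀ {P = P} (λ S → p (false ∷ S))) (flatten-∀ {P = P} (λ S → p (true ∷ S) tt))

  module _ (h : ℕ → ℚ) where
    sum : ∀ {k} → (Fin k → ℕ) → ℚ
    sum f = foldr _+_ 0ℚ (λ i → h (f i))

    sum-append : ∀ {m n} (f : Fin m → ℕ) (g : Fin n → ℕ) → sum (append f g) ≡ sum f + sum g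
    sum-append {zero}  f g = sym (+-identityˡ (sum g))
    sum-append {suc m} f g = trans (cong (_+_ (h (f zero))) (sum-append (λ i → f (suc i)) g)) (sym (+-assoc (h (f zero)) (sum (λ i → f (suc i))) (sum g)))

    sum-flatten : ∀ {j} (f : Vec Bool j → ℕ) → sum (flatten f) ≡ Π _+_ (λ S → h (f S))
    sum-flatten {zero}  f = +-identityʳ (h (f []))
    sum-flatten {suc j} f = trans (sum-append (flatten (λ S → f (false ∷ S))) (flatten (λ S → f (true ∷ S))))
      (cong₂ _+_ (sum-flatten (λ S → f (false ∷ S))) (sum-flatten (λ S → f (true ∷ S))))

    sum-flatten⁺ : ∀ {j} (f : (S : Vec Bool j) → NonEmpty S → ℕ) → sum (flatten⁺ f) ≡ Π⁺ _+_ 0ℚ (λ S ne → h (f S ne))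
    sum-flatten⁺ {zero}  f = refl
    sum-flatten⁺ {suc j} f = trans (sum-append (flatten⁺ (λ S → f (false ∷ S))) (flatten (λ S → f (true ∷ S) tt)))
      (cong₂ _+_ (sum-flatten⁺ (λ S → f (false ∷ S))) (sum-flatten (λ S → f (true ∷ S) tt)))

  seq-Σℝ : ∀ {k} (f : Fin k → ℕ) m → seq (Σℝ (λ i → √ (f i))) m ≡ sum (λ b → sqrtApprox b m) f
  seq-Σℝ {zero}  f m = refl
  seq-Σℝ {suc k} f m = cong₂ _+_ (sqrtApprox≡ (f zero) m) (seq-Σℝ (λ i → f (suc i)) m)

  sum-ones : ∀ e → (λ m → sum (λ b → sqrtApprox b m) {e} (λ _ → 1)) ≈ (λ _ → ⟪ e ⟫)
  sum-ones zero    = ≡⇒≈ λ _ → sym ι0≡0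
  sum-ones (suc e) = ≈-trans (≈-+ (≈-sqrt (SqrtApprox.1≤r 1 ℕ.≤-refl) (λ _ → 1≤⟪⟫ ℕ.≤-refl)
      (≈-trans (root² 1 ℕ.≤-refl) (≡⇒≈ λ _ → ⟪⟫-* 1 1))) (sum-ones e))
    (≡⇒≈ λ _ → sym (⟪⟫-+ 1 e))

-- Admissible radicands at level I

module Radicands where
  open import Data.Rational hiding (NonZero)
  open import Data.Rational.Properties
  open RationalArithmetic
  open Convergents
  open Limits
  open MultiquadraticRing
  open ConjugateProducts
  open TameFactors
  open Units
  open GreedyExpansion
  open SquareRootSums

  -- The element Σ_S √D_S whose multiples serve as the shift.
  ones : ∀ {j} → Multiquadratic j
  ones {zero}  = + 1
  ones {suc j} = ones , ones

  coefficients-ones : ∀ j → Coefficients≤ {j} 1ℚ ones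
  coefficients-ones zero    = ≤-reflexive (trans (∣ι∣ (+ 1)) ι1≡1)
  coefficients-ones (suc j) = coefficients-ones j , coefficients-ones j

  coefficient-shift : ∀ {j} (y : Multiquadratic j) n S → coefficient (y ⊞ n • ones) S ≡ coefficient y S ℤ.+ n
  coefficient-shift a       n []          = cong (λ i → a ℤ.+ i) (ℤ.*-identityʳ n)
  coefficient-shift (a , b) n (false ∷ S) = coefficient-shift a n S
  coefficient-shift (a , b) n (true ∷ S)  = coefficient-shift b n S

  ∣coefficient∣≤ : ∀ {j B} (y : Multiquadratic j) → Coefficients≤ ⟪ B ⟫ y → ∀ S → ℤ.∣ coefficient y S ∣ ℕ.≤ B
  ∣coefficient∣≤ {B = B} a h []                = ⟪⟫-cancel-≤ (subst (_≤ ⟪ B ⟫) (∣ι∣ a) h)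
  ∣coefficient∣≤ (a , b) (ha , hb) (false ∷ S) = ∣coefficient∣≤ a ha S
  ∣coefficient∣≤ (a , b) (ha , hb) (true ∷ S)  = ∣coefficient∣≤ b hb S

  -- The shift is B + 1 and not B, so that even the coefficient -B becomes 1 and its radicand is
  -- positive.
  shift-positive : ∀ {B} i → ℤ.∣ i ∣ ℕ.≤ B → ∃[ a ] i ℤ.+ + suc B ≡ + a × 1 ℕ.≤ a × a ℕ.≤ B ℕ.+ suc B
  shift-positive {B} (+ n)    n≤B = n ℕ.+ suc B , refl , ℕ.m≤n⇒m≤o+n n (s≤s z≤n) , ℕ.+-monoˡ-≤ (suc B) n≤B
  shift-positive {B} -[1+ n ] n<B = B ℕ.∸ n , trans (ℤ.[1+m]⊖[1+n]≡m⊖n B n) (ℤ.⊖-≥ (ℕ.<⇒≤ n<B)) , ℕ.m<n⇒0<n∸m n<B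
    , ℕ.≤-trans (ℕ.m∸n≤m B n) (ℕ.m≤m+n B (suc B))

  eventually-< : ∀ {P : ℕ → ℕ → Set} I → (∀ i → Eventually (P i)) → Eventually (λ m → ∀ i → i ℕ.< I → P i m)
  eventually-< zero    h = from 0 λ _ _ _ ()
  eventually-< {P} (suc I) h = eventually-map
    (λ m (below , at) i i<1+I → [ below i , (λ { refl → at }) ]′ (ℕ.m≤n⇒m<n∨m≡n (ℕ.≤-pred i<1+I)))
    (eventually-× (eventually-< {P} I h) (h I))

  n+suc[n]≤3*n : ∀ {n} → 1 ℕ.≤ n → n ℕ.+ suc n ℕ.≤ 3 ℕ.* n
  n+suc[n]≤3*n {n} 1≤n = ℕ.+-monoʳ-≤ n (ℕ.≤-trans (ℕ.+-monoˡ-≤ n 1≤n) (ℕ.+-monoʳ-≤ n (ℕ.m≤m+n n 0)))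

  module _ (ℓ : ℕ) where
    private
      opaque
        -- The shifted coefficients are at most 2 B + 1 ≤ 3 B, where B = `digitBound` · `unitBound`
        -- · 2^I ≥ 1.
        gain : ℕ
        gain = 3 ℕ.* (digitBound ℓ ℕ.* unitBound ℓ)

        gain-bound : ∀ I → coefficientBound ℓ I ℕ.+ suc (coefficientBound ℓ I) ℕ.≤ gain ℕ.* 2 ℕ.^ I
        gain-bound I = ℕ.≤-trans (n+suc[n]≤3*n (ℕ.*-mono-≤ (ℕ.*-mono-≤
            (ℕ.*-mono-≤ (1≤unitBound ℓ) (ℕ.≤-trans (1≤unitBound ℓ) (ℕ.m≤n+m (unitBound ℓ) (residueBound ℓ)))) (1≤unitBound ℓ)) (1≤2^ ℓ I)))
          (ℕ.≤-reflexive (sym (ℕ.*-assoc 3 (digitBound ℓ ℕ.* unitBound ℓ) (2 ℕ.^ I))))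

    -- From a ≤ `gain` · 2^I and D_S ≤ `primorial ℓ`, the radicand a² D_S is at most this constant
    -- times 4^I.
    radicandBound : ℕ
    radicandBound = gain ℕ.* gain ℕ.* primorial ℓ

    -- Besides the residue of the expansion there are three errors, each at most 1 / T^K with T =
    -- 2^I: replacing the roots by the ring element, and the drifts of that element and of α.
    errorBound : ℕ
    errorBound = residueBound ℓ ℕ.+ 3

    opaque
      unfolding gain
      1≤radicandBound : 1 ℕ.≤ radicandBound
      1≤radicandBound = ℕ.*-mono-≤ (ℕ.*-mono-≤ 1≤gain 1≤gain) (1≤primorial ℓ)
        where
        1≤gain : 1 ℕ.≤ gain
        1≤gain = ℕ.≤-trans (ℕ.m≤n+m 1 (coefficientBound ℓ 0 ℕ.+ coefficientBound ℓ 0))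
          (ℕ.≤-trans (ℕ.≤-reflexive (trans (ℕ.+-assoc (coefficientBound ℓ 0) _ 1) (cong (coefficientBound ℓ 0 ℕ.+_) (ℕ.+-comm _ 1))))
            (ℕ.≤-trans (gain-bound 0) (ℕ.≤-reflexive (ℕ.*-identityʳ gain))))

    private
      square≤ : ∀ I a (S : Vec Bool ℓ) → a ℕ.≤ coefficientBound ℓ I ℕ.+ suc (coefficientBound ℓ I) →
                a ℕ.* a ℕ.* rad S ℕ.≤ radicandBound ℕ.* (2 ℕ.^ I ℕ.* 2 ℕ.^ I)
      square≤ I a S a≤ = ℕ.≤-trans (ℕ.*-mono-≤ (ℕ.*-mono-≤ a≤′ a≤′) (rad≤primorial S)) (ℕ.≤-reflexive
        (solve 3 (λ g s p → (g :* s) :* (g :* s) :* p := g :* g :* p :* (s :* s)) refl gain (2 ℕ.^ I) (primorial ℓ)))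
        where
        open ℕ.+-*-Solver
        a≤′ = ℕ.≤-trans a≤ (gain-bound I)

    module _ (I : ℕ) (α : ℝ) (e : ℕ) where
      private
        t = scale ℓ I
        tⁿ = (2 ℕ.^ I) ℕ.^ count⁺ ℓ
        B = coefficientBound ℓ I
        H = B ℕ.+ suc B
        h = + suc B • ones {ℓ}

        t≡ : t ≡ ⟪ tⁿ ⟫
        t≡ = pow⁺-⟪⟫ ℓ (2 ℕ.^ I)

        0<t : 0ℚ < t
        0<t = 0<scale ℓ I

        0≤t : 0ℚ ≤ t
        0≤t = <⇒≤ 0<t

        α-near : Eventually (λ m → ∀ m′ → m ℕ.≤ m′ → ∣ seq α m - seq α m′ ∣ * t ≤ 1ℚ)
        α-near = let (N , close) = cauchy α (1/ t) (positive⁻¹ (1/ t) {{1/pos⇒pos t {{positive 0<t}}}}) in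
          from N λ m N≤m m′ m≤m′ → subst (∣ seq α m - seq α m′ ∣ * t ≤_) (*-inverseˡ t)
            (*-monoˡ t 0≤t (close m m′ N≤m (ℕ.≤-trans N≤m m≤m′)))
          where instance _ = pos⇒nonZero t {{positive 0<t}}

        sizes : Eventually (λ m → ∀ i → i ℕ.< I → UnitSize ℓ i m)
        sizes = eventually-< {UnitSize ℓ} I (λ i → unit-size ℓ (2 ℕ.^ i) (1≤2^ ℓ i))

        radicands : Multiquadratic ℓ → Fin (count⁺ ℓ ℕ.+ e) → ℕ
        radicands z = append (flatten⁺ {j = ℓ} (λ S _ → ℤ.∣ coefficient z S ∣ ℕ.* ℤ.∣ coefficient z S ∣ ℕ.* rad S)) (λ _ → 1)

        Valid : Multiquadratic ℓ → Set
        Valid z = ∀ S → ∃[ a ] coefficient z S ≡ + a × 1 ℕ.≤ a × a ℕ.≤ H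

        radicands-bounds : ∀ z → Valid z → ∀ i → 1 ℕ.≤ radicands z i × radicands z i ℕ.≤ radicandBound ℕ.* (2 ℕ.^ I ℕ.* 2 ℕ.^ I)
        radicands-bounds z valid = append-∀ {P = P}
            (flatten⁺-∀ {P = P} {f = λ S _ → ℤ.∣ coefficient z S ∣ ℕ.* ℤ.∣ coefficient z S ∣ ℕ.* rad S} (λ S _ → at S))
            -- A padding radicand 1 is below the bound because the expression at the empty set
            -- already lies between the two.
            (λ _ → ℕ.≤-refl , ℕ.≤-trans (proj₁ (at none)) (proj₂ (at none)))
          where
          P : ℕ → Set
          P b = 1 ℕ.≤ b × b ℕ.≤ radicandBound ℕ.* (2 ℕ.^ I ℕ.* 2 ℕ.^ I)
          at : ∀ S → P (ℤ.∣ coefficient z S ∣ ℕ.* ℤ.∣ coefficient z S ∣ ℕ.* rad S)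
          at S = let (a , eq , 1≤a , a≤H) = valid S in subst (λ c → P (ℤ.∣ c ∣ ℕ.* ℤ.∣ c ∣ ℕ.* rad S)) (sym eq)
            (ℕ.*-mono-≤ (ℕ.*-mono-≤ 1≤a 1≤a) (1≤rad S) , square≤ I a S a≤H)

        total : Multiquadratic ℓ → ℕ → ℚ
        total z m = sum (λ b → sqrtApprox b m) (radicands z)

        total≈ : ∀ z → Valid z → total z ≈ (λ m → eval none z m - ι (coefficient z none) + ⟪ e ⟫)
        total≈ z valid = ≈-trans (≡⇒≈ λ m → trans (sum-append (λ b → sqrtApprox b m) (flatten⁺ {j = ℓ} f) (λ _ → 1))
            (cong (_+ sum (λ b → sqrtApprox b m) {e} (λ _ → 1)) (sum-flatten⁺ (λ b → sqrtApprox b m) f)))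
          (≈-trans (≈-+ (Σ⁺-≈ each) (sum-ones e)) (≡⇒≈ λ m → cong (_+ ⟪ e ⟫)
            (trans (solve 2 (λ c s → s := (c :+ s) :- c) refl (ι (coefficient z none)) (rest m))
              (cong (_- ι (coefficient z none)) (sym (eval-split z m))))))
          where
          open +-*-Solver using (solve; _:=_; _:+_; _:-_)
          f : (S : Vec Bool ℓ) → NonEmpty S → ℕ
          f S _ = ℤ.∣ coefficient z S ∣ ℕ.* ℤ.∣ coefficient z S ∣ ℕ.* rad S
          rest : ℕ → ℚ
          rest m = Π⁺ _+_ 0ℚ {ℓ} (λ S _ → ι (coefficient z S) * sqrtProduct S m)
          each : ∀ S (ne : NonEmpty S) → sqrtApprox (f S ne) ≈ (λ m → ι (coefficient z S) * sqrtProduct S m)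
          each S _ = let (a , eq , 1≤a , _) = valid S in
            subst (λ c → sqrtApprox (ℤ.∣ c ∣ ℕ.* ℤ.∣ c ∣ ℕ.* rad S) ≈ (λ m → ι c * sqrtProduct S m)) (sym eq) (sqrt-square* S a 1≤a)

        -- Late enough that α has settled to within 1 / T^K, that all units used have their proper
        -- size, and that any element with coefficients at most H drifts by at most 1 / T^K from
        -- here on.
        M₀ : ℕ
        M₀ = Eventually.start α-near ℕ.⊔ Eventually.start sizes ℕ.⊔ H ℕ.* drift ℓ ℕ.* tⁿ

        expansion : Expansion ℓ I M₀ (seq α M₀ - eval none h M₀)
        expansion = expand ℓ I M₀ (Eventually.holds sizes M₀ (ℕ.≤-trans (ℕ.m≤n⊔m (Eventually.start α-near) (Eventually.start sizes)) (ℕ.m≤m⊔n _ (H ℕ.* drift ℓ ℕ.* tⁿ))))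
          (seq α M₀ - eval none h M₀)

      approximate : Σ[ b ∈ (Fin (count⁺ ℓ ℕ.+ e) → ℕ) ]
        (∀ i → 1 ℕ.≤ b i × b i ℕ.≤ radicandBound ℕ.* (2 ℕ.^ I ℕ.* 2 ℕ.^ I)) ×
        Eventually (λ m → distℤ (seq (Σℝ (λ i → √ (b i)) -ℝ α) m) * ⟪ tⁿ ⟫ ≤ ⟪ errorBound ⟫)
      approximate = assemble expansion
        where
        assemble : Expansion ℓ I M₀ (seq α M₀ - eval none h M₀) → _
        assemble (c , y , y≤ , close) = radicands z , radicands-bounds z valid
          , eventually-map (λ m (M₀≤m , tail) → bound m M₀≤m tail)
              (eventually-× {λ m → M₀ ℕ.≤ m} (from M₀ λ _ le → le) (≈⇒eventually (total≈ z valid) tⁿ))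
          where
          open +-*-Solver using (solve; _:=_; _:+_; _:-_; _:*_; :-_)
          z = y ⊞ h
          κ = coefficient z none
          -- The sum of roots is close to z - κ + e, because it omits the constant term and contains
          -- e ones, and z is close to α - c. So the difference from α is close to e - κ - c.
          M = + e ℤ.- κ ℤ.- c

          valid : Valid z
          valid S = let (a , eq , bounds) = shift-positive (coefficient y S) (∣coefficient∣≤ y y≤ S)
                    in a , trans (coefficient-shift y (+ suc B) S) eq , bounds

          z≤ : Coefficients≤ ⟪ H ⟫ z
          z≤ = coefficients-weaken z (≤-reflexive (sym (trans (⟪⟫-+ B (suc B)) (cong (_+_ ⟪ B ⟫) (sym (trans (*-identityʳ (∣ ι (+ suc B) ∣)) (∣ι∣ (+ suc B))))))))
            (coefficients-⊞ {A = ⟪ B ⟫} {B = ∣ ι (+ suc B) ∣ * 1ℚ} y h y≤ (coefficients-• {B = 1ℚ} (+ suc B) (ones {ℓ}) (coefficients-ones ℓ)))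

          ιM : ι M ≡ ⟪ e ⟫ - ι κ - ι c
          ιM = trans (ι-+ (+ e ℤ.- κ) (ℤ.- c)) (cong₂ _+_ (trans (ι-+ (+ e) (ℤ.- κ)) (cong (_+_ ⟪ e ⟫) (ι-neg κ))) (ι-neg c))

          bound : ∀ m → M₀ ℕ.≤ m → ∣ total z m - (eval none z m - ι κ + ⟪ e ⟫) ∣ * ⟪ tⁿ ⟫ ≤ 1ℚ →
                  distℤ (seq (Σℝ (λ i → √ (radicands z i)) -ℝ α) m) * ⟪ tⁿ ⟫ ≤ ⟪ errorBound ⟫
          bound m M₀≤m tail = begin
            distℤ (seq (Σℝ (λ i → √ (radicands z i)) -ℝ α) m) * ⟪ tⁿ ⟫
              ≤⟨ *-monoˡ ⟪ tⁿ ⟫ (0≤⟪⟫ tⁿ) (distℤ-lower (seq (Σℝ (λ i → √ (radicands z i)) -ℝ α) m) M) ⟩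
            ∣ seq (Σℝ (λ i → √ (radicands z i)) -ℝ α) m - M / 1 ∣ * ⟪ tⁿ ⟫
              ≡⟨ cong₂ (λ s i → ∣ (s - a) - i ∣ * ⟪ tⁿ ⟫) (seq-Σℝ (radicands z) m) (trans (sym (ι≡/1 M)) ιM) ⟩
            ∣ (total z m - a) - (⟪ e ⟫ - ι κ - ι c) ∣ * ⟪ tⁿ ⟫
              ≡⟨ cong₂ (λ u v → ∣ u ∣ * v) (solve 8 (λ s a e k c z z₀ a₀ → (s :- a) :- (e :- k :- c) :=
                   ((s :- (z :- k :+ e)) :+ (z :- z₀)) :+ ((:- (a₀ :- c :- z₀)) :+ (a₀ :- a))) refl (total z m) a ⟪ e ⟫ (ι κ) (ι c) (eval none z m) (eval none z M₀) a₀) (sym t≡) ⟩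
            ∣ (d₁ + d₂) + (- d₃ + d₄) ∣ * t
              ≤⟨ *-monoˡ t 0≤t (≤-trans (∣p+q∣≤∣p∣+∣q∣ (d₁ + d₂) (- d₃ + d₄)) (+-mono-≤ (∣p+q∣≤∣p∣+∣q∣ d₁ d₂) (∣p+q∣≤∣p∣+∣q∣ (- d₃) d₄))) ⟩
            ((∣ d₁ ∣ + ∣ d₂ ∣) + (∣ - d₃ ∣ + ∣ d₄ ∣)) * t
              ≡⟨ cong (λ x → ((∣ d₁ ∣ + ∣ d₂ ∣) + (x + ∣ d₄ ∣)) * t) (∣-p∣≡∣p∣ d₃) ⟩
            ((∣ d₁ ∣ + ∣ d₂ ∣) + (∣ d₃ ∣ + ∣ d₄ ∣)) * t
              ≡⟨ solve 5 (λ a b c d t → ((a :+ b) :+ (c :+ d)) :* t := (a :* t :+ b :* t) :+ (c :* t :+ d :* t)) refl (∣ d₁ ∣) (∣ d₂ ∣) (∣ d₃ ∣) (∣ d₄ ∣) t ⟩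
            (∣ d₁ ∣ * t + ∣ d₂ ∣ * t) + (∣ d₃ ∣ * t + ∣ d₄ ∣ * t)
              ≤⟨ +-mono-≤ (+-mono-≤ (subst (λ x → ∣ d₁ ∣ * x ≤ 1ℚ) (sym t≡) tail) stable) (+-mono-≤ close′ α-close) ⟩
            (1ℚ + 1ℚ) + (⟪ residueBound ℓ ⟫ + 1ℚ)
              ≡⟨ solve 2 (λ o r → (o :+ o) :+ (r :+ o) := r :+ (o :+ (o :+ o))) refl 1ℚ ⟪ residueBound ℓ ⟫ ⟩
            ⟪ residueBound ℓ ⟫ + (1ℚ + (1ℚ + 1ℚ))
              ≡⟨ cong (_+_ ⟪ residueBound ℓ ⟫) (sym (trans (⟪⟫-+ 1 2) (cong₂ _+_ ι1≡1 ⟪2⟫))) ⟩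
            ⟪ residueBound ℓ ⟫ + ⟪ 3 ⟫
              ≡⟨ sym (⟪⟫-+ (residueBound ℓ) 3) ⟩
            ⟪ errorBound ⟫ ∎
            where
            open ≤-Reasoning
            a = seq α m
            a₀ = seq α M₀
            -- The four errors: roots against the ring element, drift of that element from M₀ to m,
            -- residue of the expansion, drift of α.
            d₁ = total z m - (eval none z m - ι κ + ⟪ e ⟫)
            d₂ = eval none z m - eval none z M₀
            d₃ = a₀ - ι c - eval none z M₀
            d₄ = a₀ - a
            close′ : ∣ d₃ ∣ * t ≤ ⟪ residueBound ℓ ⟫
            close′ = subst (λ x → ∣ x ∣ * t ≤ ⟪ residueBound ℓ ⟫)
              (trans (solve 4 (λ a h c y → (a :- h) :- (c :+ y) := a :- c :- (y :+ h)) refl a₀ (eval none h M₀) (ι c) (eval none y M₀))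
                (cong (λ x → a₀ - ι c - x) (sym (eval-⊞ none y h M₀)))) close
            α-close : ∣ d₄ ∣ * t ≤ 1ℚ
            α-close = Eventually.holds α-near M₀ (ℕ.≤-trans (ℕ.m≤m⊔n (Eventually.start α-near) (Eventually.start sizes)) (ℕ.m≤m⊔n _ (H ℕ.* drift ℓ ℕ.* tⁿ))) m M₀≤m
            stable : ∣ d₂ ∣ * t ≤ 1ℚ
            stable = *-cancelʳ ⟪ suc M₀ ⟫ (0<⟪suc⟫ M₀) (begin
              ∣ d₂ ∣ * t * ⟪ suc M₀ ⟫            ≡⟨ *-swap (∣ d₂ ∣) t ⟪ suc M₀ ⟫ ⟩
              ∣ d₂ ∣ * ⟪ suc M₀ ⟫ * t            ≤⟨ *-monoˡ t 0≤t (eval-drift z z≤ M₀≤m ℕ.≤-refl) ⟩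
              ⟪ H ⟫ * ⟪ drift ℓ ⟫ * t            ≡⟨ trans (cong₂ _*_ (sym (⟪⟫-* H (drift ℓ))) t≡) (sym (⟪⟫-* (H ℕ.* drift ℓ) tⁿ)) ⟩
              ⟪ H ℕ.* drift ℓ ℕ.* tⁿ ⟫           ≤⟨ ⟪⟫-mono (ℕ.m≤n⇒m≤1+n (ℕ.m≤n⊔m (Eventually.start α-near ℕ.⊔ Eventually.start sizes) (H ℕ.* drift ℓ ℕ.* tⁿ))) ⟩
              ⟪ suc M₀ ⟫                         ≡⟨ sym (*-identityˡ ⟪ suc M₀ ⟫) ⟩
              1ℚ * ⟪ suc M₀ ⟫                    ∎)

-- The exponent, the constant and the assembly

module Conclusion where
  open import Data.Rational hiding (NonZero)
  open import Data.Rational.Properties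
  open RationalArithmetic
  open Convergents
  open Limits
  open MultiquadraticRing
  open ConjugateProducts
  open TameFactors
  open Units
  open GreedyExpansion
  open SquareRootSums
  open Radicands

  count≡2^ : ∀ j → count j ≡ 2 ℕ.^ j
  count≡2^ zero    = refl
  count≡2^ (suc j) = cong₂ ℕ._+_ (count≡2^ j) (trans (count≡2^ j) (sym (ℕ.+-identityʳ (2 ℕ.^ j))))

  suc-count⁺ : ∀ j → suc (count⁺ j) ≡ count j
  suc-count⁺ zero    = refl
  suc-count⁺ (suc j) = cong (ℕ._+ count j) (suc-count⁺ j)

  -- Halving n lowers both the dyadic interval and the logarithm by one. Monotonicity shows that the
  -- logarithm is positive, so the truncated predecessor can be undone.
  ⌊log₂⌋-unique : ∀ ℓ n → 2 ℕ.^ ℓ ℕ.≤ n → n ℕ.< 2 ℕ.^ suc ℓ → ⌊log₂ n ⌋ ≡ ℓ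
  ⌊log₂⌋-unique zero    1 _ _ = refl
  ⌊log₂⌋-unique zero    (suc (suc n)) _ (s≤s (s≤s ()))
  ⌊log₂⌋-unique (suc ℓ) n lo hi = unpred
    (trans (sym (⌊log₂⌊n/2⌋⌋≡⌊log₂n⌋∸1 n)) (⌊log₂⌋-unique ℓ ℕ.⌊ n /2⌋ lo′ hi′))
    (subst (ℕ._≤ ⌊log₂ n ⌋) (⌊log₂[2^n]⌋≡n (suc ℓ)) (⌊log₂⌋-mono-≤ lo))
    where
    x = 2 ℕ.^ ℓ
    double : ∀ y → 2 ℕ.* y ≡ y ℕ.+ y
    double y = cong (y ℕ.+_) (ℕ.+-identityʳ y)
    lo′ : x ℕ.≤ ℕ.⌊ n /2⌋
    lo′ = subst (ℕ._≤ ℕ.⌊ n /2⌋) (sym (ℕ.n≡⌊n+n/2⌋ x)) (ℕ.⌊n/2⌋-mono (subst (ℕ._≤ n) (double x) lo))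
    hi′ : ℕ.⌊ n /2⌋ ℕ.< 2 ℕ.^ suc ℓ
    hi′ = ℕ.≰⇒> λ le → ℕ.<⇒≱ hi (subst₂ ℕ._≤_ (sym (double (2 ℕ.^ suc ℓ))) (ℕ.⌊n/2⌋+⌈n/2⌉≡n n)
      (ℕ.+-mono-≤ le (ℕ.≤-trans le (ℕ.⌊n/2⌋≤⌈n/2⌉ n))))
    unpred : ∀ {a b} → a ℕ.∸ 1 ≡ b → suc b ℕ.≤ a → a ≡ suc b
    unpred {suc a} eq _ = cong suc eq

  crossing : (s : ℕ → ℕ) → ∀ n J → s 0 ℕ.≤ n → n ℕ.< s J → ∃[ I ] s I ℕ.≤ n × n ℕ.< s (suc I)
  crossing s n zero    lo hi = ⊥-elim (ℕ.<⇒≱ hi lo)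
  crossing s n (suc J) lo hi with s J ℕ.≤? n
  ... | yes le = J , le , hi
  ... | no ≰   = crossing s n J lo (ℕ.≰⇒> ≰)

  n<2^n : ∀ n → n ℕ.< 2 ℕ.^ n
  n<2^n zero    = ℕ.≤-refl
  n<2^n (suc n) = ℕ.≤-trans (ℕ.+-mono-≤ (ℕ.m^n>0 2 n) (n<2^n n)) (ℕ.≤-reflexive (cong (2 ℕ.^ n ℕ.+_) (sym (ℕ.+-identityʳ (2 ℕ.^ n)))))

  archimedean : ∀ ε → 0ℚ < ε → ∃[ n ] 1ℚ ≤ ⟪ n ⟫ * ε
  archimedean (mkℚ (+ zero) _ _)    (*<* (ℤ.+<+ ()))
  archimedean (mkℚ -[1+ _ ] _ _)    (*<* ())
  archimedean ε@(mkℚ (+ suc a) d _) _ = suc d , subst (1ℚ ≤_) (sym eq) (1≤⟪⟫ (s≤s z≤n))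
    where
    eq : ⟪ suc d ⟫ * ε ≡ ⟪ suc a ⟫
    eq = trans (*-comm ⟪ suc d ⟫ ε) (trans (cong (_* ⟪ suc d ⟫) (sym (↥p/↧p≡p ε))) (/suc-* (suc a) d))

  module _ (q : ℕ) (1≤q : 1 ℕ.≤ q) where
    private instance
      q≢0 : ℕ.NonZero q
      q≢0 = ℕ.>-nonZero 1≤q

    -- `rootSeq` approaches 1 / √q from below with step 1 / (m + 1); one more step lies above it.
    1≤q*[rootSeq+1/m]² : ∀ m → let s = rootSeq 2 1 q m + + 1 / suc m in 0ℚ ≤ s × 1ℚ ≤ s * s * ⟪ q ⟫
    1≤q*[rootSeq+1/m]² m = 0≤s , *-cancelʳ (⟪ M ⟫ * ⟪ M ⟫) (0<* 0<M 0<M) (begin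
        1ℚ * (⟪ M ⟫ * ⟪ M ⟫)               ≡⟨ trans (*-identityˡ (⟪ M ⟫ * ⟪ M ⟫)) (sym (⟪⟫-* M M)) ⟩
        ⟪ M ℕ.* M ⟫                        ≤⟨ ⟪⟫-mono upper ⟩
        ⟪ suc t ℕ.* suc t ℕ.* q ⟫          ≡⟨ trans (⟪⟫-* (suc t ℕ.* suc t) q) (cong (_* ⟪ q ⟫) (trans (⟪⟫-* (suc t) (suc t)) (sym (cong₂ _*_ sM sM)))) ⟩
        s * ⟪ M ⟫ * (s * ⟪ M ⟫) * ⟪ q ⟫    ≡⟨ solve 3 (λ s m q → s :* m :* (s :* m) :* q := s :* s :* q :* (m :* m)) refl s ⟪ M ⟫ ⟪ q ⟫ ⟩
        s * s * ⟪ q ⟫ * (⟪ M ⟫ * ⟪ M ⟫)    ∎)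
      where
      open ≤-Reasoning
      open +-*-Solver using (solve; _:=_; _:*_)
      M = suc m
      0<M = 0<⟪suc⟫ m
      a = 1 ℕ.* M ℕ.^ 2
      t = iroot 2 (a ℕ./ q)
      s = + t / M + + 1 / M
      sM : s * ⟪ M ⟫ ≡ ⟪ suc t ⟫
      sM = trans (*-distribʳ-+ ⟪ M ⟫ (+ t / M) (+ 1 / M)) (trans (cong₂ _+_ (/suc-* t m) (/suc-* 1 m))
        (trans (sym (⟪⟫-+ t 1)) (cong ⟪_⟫ (ℕ.+-comm t 1))))
      0≤s : 0ℚ ≤ s
      0≤s = *-cancelʳ ⟪ M ⟫ 0<M (subst₂ _≤_ (sym (*-zeroˡ ⟪ M ⟫)) (sym sM) (0≤⟪⟫ (suc t)))
      upper : M ℕ.* M ℕ.≤ suc t ℕ.* suc t ℕ.* q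
      upper = ℕ.<⇒≤ (ℕ.≤-trans (ℕ.≤-reflexive (cong suc (sym (trans (ℕ.*-identityˡ (M ℕ.^ 2)) (cong (M ℕ.*_) (ℕ.*-identityʳ M))))))
        (ℕ.≤-trans (subst (ℕ._< suc (a ℕ./ q) ℕ.* q) (sym (ℕ.m≡m%n+[m/n]*n a q)) (ℕ.+-monoˡ-< (a ℕ./ q ℕ.* q) (ℕ.m%n<n a q)))
          (ℕ.*-monoˡ-≤ q (subst (suc (a ℕ./ q) ℕ.≤_) (cong (suc t ℕ.*_) (ℕ.*-identityʳ (suc t))) (iroot-upper 2 (a ℕ./ q))))))

    1≤s⇐1≤s² : ∀ {s} → 0ℚ ≤ s → 1ℚ ≤ s * s → 1ℚ ≤ s
    1≤s⇐1≤s² {s} 0≤s 1≤s² with ≤-total 1ℚ s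
    ... | inj₁ 1≤s = 1≤s
    ... | inj₂ s≤1 = ≤-trans 1≤s² (subst (s * s ≤_) (*-identityʳ s) (*-monoʳ s 0≤s s≤1))

    -- From q ≤ F w² follows 1 / w ≤ √F / √q. The constant is F in place of √F, which keeps it an
    -- integer and is allowed because F ≥ 1.
    compare-root : ∀ {x} F w R → 0ℚ ≤ x → q ℕ.≤ F ℕ.* (w ℕ.* w) → 1 ℕ.≤ F → x * ⟪ w ⟫ ≤ ⟪ R ⟫ → ∀ m →
                   x ≤ ⟪ R ℕ.* F ⟫ * (rootSeq 2 1 q m + + 1 / suc m)
    compare-root {x} F w R 0≤x q≤ 1≤F xw≤ m = begin
      x                              ≤⟨ ≤*1≤ 0≤x (1≤s⇐1≤s² 0≤sFw 1≤[sFw]²) ⟩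
      x * (s * (⟪ F ⟫ * ⟪ w ⟫))      ≡⟨ solve 4 (λ x s f w → x :* (s :* (f :* w)) := x :* w :* (f :* s)) refl x s ⟪ F ⟫ ⟪ w ⟫ ⟩
      x * ⟪ w ⟫ * (⟪ F ⟫ * s)        ≤⟨ *-monoˡ (⟪ F ⟫ * s) (0≤* (0≤⟪⟫ F) 0≤s) xw≤ ⟩
      ⟪ R ⟫ * (⟪ F ⟫ * s)            ≡⟨ trans (sym (*-assoc ⟪ R ⟫ ⟪ F ⟫ s)) (cong (_* s) (sym (⟪⟫-* R F))) ⟩
      ⟪ R ℕ.* F ⟫ * s                ∎
      where
      open ≤-Reasoning
      open +-*-Solver using (solve; _:=_; _:*_)
      s = rootSeq 2 1 q m + + 1 / suc m
      0≤s = proj₁ (1≤q*[rootSeq+1/m]² m)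
      0≤sFw : 0ℚ ≤ s * (⟪ F ⟫ * ⟪ w ⟫)
      0≤sFw = 0≤* 0≤s (0≤* (0≤⟪⟫ F) (0≤⟪⟫ w))
      1≤[sFw]² : 1ℚ ≤ s * (⟪ F ⟫ * ⟪ w ⟫) * (s * (⟪ F ⟫ * ⟪ w ⟫))
      1≤[sFw]² = begin
        1ℚ                                                 ≤⟨ proj₂ (1≤q*[rootSeq+1/m]² m) ⟩
        s * s * ⟪ q ⟫                                      ≤⟨ *-monoʳ (s * s) (0≤* 0≤s 0≤s) (⟪⟫-mono (ℕ.≤-trans q≤ (ℕ.m≤n*m (F ℕ.* (w ℕ.* w)) F {{ℕ.>-nonZero 1≤F}}))) ⟩
        s * s * ⟪ F ℕ.* (F ℕ.* (w ℕ.* w)) ⟫                ≡⟨ cong (s * s *_) (trans (⟪⟫-* F (F ℕ.* (w ℕ.* w))) (cong (⟪ F ⟫ *_) (trans (⟪⟫-* F (w ℕ.* w)) (cong (⟪ F ⟫ *_) (⟪⟫-* w w))))) ⟩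
        s * s * (⟪ F ⟫ * (⟪ F ⟫ * (⟪ w ⟫ * ⟪ w ⟫)))        ≡⟨ solve 3 (λ s f w → s :* s :* (f :* (f :* (w :* w))) := s :* (f :* w) :* (s :* (f :* w))) refl s ⟪ F ⟫ ⟪ w ⟫ ⟩
        s * (⟪ F ⟫ * ⟪ w ⟫) * (s * (⟪ F ⟫ * ⟪ w ⟫))        ∎

    -- The extra step 1 / (m + 1) of the comparison is multiplied by the constant R F and falls
    -- below ε for large m.
    ≤ℝ-root : ∀ x y → (∀ m → seq y m ≡ rootSeq 2 1 q m) → ∀ F w R → (∀ m → 0ℚ ≤ seq x m) → q ℕ.≤ F ℕ.* (w ℕ.* w) → 1 ℕ.≤ F →
              Eventually (λ m → seq x m * ⟪ w ⟫ ≤ ⟪ R ⟫) → x ≤ℝ fromℚ ⟪ R ℕ.* F ⟫ *ℝ y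
    ≤ℝ-root x y y≡root F w R 0≤x q≤ 1≤F (from N h) ε ε>0 =
      let (n , 1≤nε) = archimedean ε ε>0 in
      N ℕ.⊔ D ℕ.* n , λ m m≥ → ≤-trans
        (compare-root F w R (0≤x m) q≤ 1≤F (h m (ℕ.m⊔n≤o⇒m≤o N (D ℕ.* n) m≥)) m)
        (≤-trans (≤-reflexive (trans (*-distribˡ-+ ⟪ D ⟫ (rootSeq 2 1 q m) (+ 1 / suc m)) (cong (λ z → ⟪ D ⟫ * z + ⟪ D ⟫ * (+ 1 / suc m)) (sym (y≡root m)))))
          (+-monoʳ-≤ (⟪ D ⟫ * seq y m) (small m n 1≤nε (ℕ.m⊔n≤o⇒n≤o N (D ℕ.* n) m≥))))
      where
      open ≤-Reasoning
      D = R ℕ.* F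
      small : ∀ m n → 1ℚ ≤ ⟪ n ⟫ * ε → D ℕ.* n ℕ.≤ m → ⟪ D ⟫ * (+ 1 / suc m) ≤ ε
      small m n 1≤nε le = *-cancelʳ ⟪ suc m ⟫ (0<⟪suc⟫ m) (begin
        ⟪ D ⟫ * (+ 1 / suc m) * ⟪ suc m ⟫     ≡⟨ trans (*-assoc ⟪ D ⟫ (+ 1 / suc m) ⟪ suc m ⟫) (trans (cong (⟪ D ⟫ *_) (trans (/suc-* 1 m) ι1≡1)) (*-identityʳ ⟪ D ⟫)) ⟩
        ⟪ D ⟫                                 ≤⟨ ≤*1≤ (0≤⟪⟫ D) 1≤nε ⟩
        ⟪ D ⟫ * (⟪ n ⟫ * ε)                   ≡⟨ trans (sym (*-assoc ⟪ D ⟫ ⟪ n ⟫ ε)) (trans (cong (_* ε) (sym (⟪⟫-* D n))) (*-comm ⟪ D ℕ.* n ⟫ ε)) ⟩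
        ε * ⟪ D ℕ.* n ⟫                       ≤⟨ *-monoʳ ε (<⇒≤ ε>0) (⟪⟫-mono (ℕ.m≤n⇒m≤1+n le)) ⟩
        ε * ⟪ suc m ⟫                         ∎)

  0≤distℤ : ∀ p → 0ℚ ≤ distℤ p
  0≤distℤ p = let (c , eq) = distℤ-attained p in subst (0ℚ ≤_) (sym eq) (0≤∣p∣ (p - c / 1))

  module _ (ℓ e : ℕ) where
    private
      K = count⁺ ℓ
      G = radicandBound ℓ
      -- Consecutive sizes G · 4^I differ by the factor 4, so the largest one not above n gives n ≤
      -- 4 G w² with w = 2^I. Raised to the power K this loses (4 G)^K.
      F = (4 ℕ.* G) ℕ.^ K
      size : ℕ → ℕ
      size I = G ℕ.* (2 ℕ.^ I ℕ.* 2 ℕ.^ I)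

      ^-distribʳ-* : ∀ k x y → (x ℕ.* y) ℕ.^ k ≡ x ℕ.^ k ℕ.* y ℕ.^ k
      ^-distribʳ-* zero    x y = refl
      ^-distribʳ-* (suc k) x y = trans (cong (x ℕ.* y ℕ.*_) (^-distribʳ-* k x y))
        (ℕ.[m*n]*[o*p]≡[m*o]*[n*p] x y (x ℕ.^ k) (y ℕ.^ k))

      power≤ : ∀ {n} w → n ℕ.≤ 4 ℕ.* G ℕ.* (w ℕ.* w) → n ℕ.^ K ℕ.≤ F ℕ.* (w ℕ.^ K ℕ.* w ℕ.^ K)
      power≤ w n≤ = ℕ.≤-trans (ℕ.^-monoˡ-≤ K n≤) (ℕ.≤-reflexive
        (trans (^-distribʳ-* K (4 ℕ.* G) (w ℕ.* w)) (cong (F ℕ.*_) (^-distribʳ-* K w w))))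

    constantD : ℕ
    constantD = errorBound ℓ ℕ.* F

    1≤constantD : 1 ℕ.≤ constantD
    1≤constantD = ℕ.*-mono-≤ (ℕ.≤-trans (s≤s z≤n) (ℕ.m≤n+m 3 (residueBound ℓ)))
      (ℕ.m^n>0 (4 ℕ.* G) {{ℕ.>-nonZero (ℕ.≤-trans (1≤radicandBound ℓ) (ℕ.m≤n*m G 4))}} K)

    -- `Q` stands for n^(-K/2) and is known only through its approximations; how the exponent is
    -- written as a reduced fraction is settled in `^ℚ-negγ`.
    module _ (α : ℝ) (n : ℕ) .{{n≢0 : ℕ.NonZero n}} (Q : ℝ)
             (Q≡root : ∀ m → seq Q m ≡ rootSeq 2 1 (n ℕ.^ K) {{ℕ.m^n≢0 n K}} m) where
      private
        1≤n : 1 ℕ.≤ n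
        1≤n = ℕ.>-nonZero⁻¹ n

        1≤G : 1 ℕ.≤ G
        1≤G = 1≤radicandBound ℓ

      Result : Set
      Result = Σ[ b ∈ (Fin (K ℕ.+ e) → ℕ) ] (∀ j → 1 ℕ.≤ b j × b j ℕ.≤ n) ×
        (‖ Σℝ (λ j → √ (b j)) -ℝ α ‖ ≤ℝ fromℚ ⟪ constantD ⟫ *ℝ Q)

      private
        conclude : ∀ w (b : Fin (K ℕ.+ e) → ℕ) → (∀ j → 1 ℕ.≤ b j × b j ℕ.≤ n) → n ℕ.≤ 4 ℕ.* G ℕ.* (w ℕ.* w) →
          Eventually (λ m → distℤ (seq (Σℝ (λ j → √ (b j)) -ℝ α) m) * ⟪ w ℕ.^ K ⟫ ≤ ⟪ errorBound ℓ ⟫) → Result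
        conclude w b bounds n≤ close = b , bounds , ≤ℝ-root (n ℕ.^ K) (ℕ.m^n>0 n K)
          ‖ Σℝ (λ j → √ (b j)) -ℝ α ‖ Q Q≡root F (w ℕ.^ K) (errorBound ℓ) (λ m → 0≤distℤ (seq (Σℝ (λ j → √ (b j)) -ℝ α) m))
          (power≤ w n≤) (ℕ.m^n>0 (4 ℕ.* G) {{ℕ.>-nonZero (ℕ.≤-trans 1≤G (ℕ.m≤n*m G 4))}} K) close

        -- Below the smallest size no level of the expansion fits; there the distance is bounded by
        -- 1, and the constant covers it with w = 1.
        trivial : n ℕ.< G → Result
        trivial n<G = conclude 1 (λ _ → 1) (λ _ → ℕ.≤-refl , 1≤n)
          (ℕ.≤-trans (ℕ.<⇒≤ n<G) (ℕ.≤-trans (ℕ.m≤n*m G 4) (ℕ.≤-reflexive (sym (ℕ.*-identityʳ (4 ℕ.* G))))))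
          (from 0 λ m _ → subst (_≤ ⟪ errorBound ℓ ⟫)
            (sym (trans (cong (distℤ (x m) *_) (trans (cong ⟪_⟫ (ℕ.^-zeroˡ K)) ι1≡1)) (*-identityʳ (distℤ (x m)))))
            (≤-trans (distℤ≤1 (x m)) (1≤⟪⟫ (ℕ.≤-trans (s≤s z≤n) (ℕ.m≤n+m 3 (residueBound ℓ))))))
          where
          x : ℕ → ℚ
          x = seq (Σℝ {K ℕ.+ e} (λ j → √ 1) -ℝ α)

        at : (∃[ I ] size I ℕ.≤ n × n ℕ.< size (suc I)) → Result
        at (I , lo , hi) = let (b , bounds , close) = approximate ℓ I α e in
          conclude (2 ℕ.^ I) b (λ j → proj₁ (bounds j) , ℕ.≤-trans (proj₂ (bounds j)) lo)
            (ℕ.≤-trans (ℕ.<⇒≤ hi) (ℕ.≤-reflexive (solve 2 (λ g s → g :* ((con 2 :* s) :* (con 2 :* s)) := con 4 :* g :* (s :* s)) refl G (2 ℕ.^ I))))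
            close
          where
          open ℕ.+-*-Solver

      approximate-sqrt : Result
      approximate-sqrt = [ trivial , (λ G≤n → at (crossing size n n (subst (ℕ._≤ n) (sym (ℕ.*-identityʳ G)) G≤n)
        (ℕ.≤-trans (n<2^n n) (ℕ.≤-trans (ℕ.m≤m*n (2 ℕ.^ n) (2 ℕ.^ n) {{ℕ.m^n≢0 2 n}}) (ℕ.m≤n*m (2 ℕ.^ n ℕ.* 2 ℕ.^ n) G {{ℕ.>-nonZero 1≤G}}))))) ]′
        (ℕ.<-≤-connex n G)

  -- Here ℓ + 1 is the logarithm of the overview, so twice the exponent γ is 2^(ℓ+1) - 1 = K.
  negγ-value : ∀ ℓ → - (+ (2 ℕ.^ ℓ) / 1 - ½) * ⟪ 2 ⟫ ≡ - ⟪ count⁺ (suc ℓ) ⟫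
  negγ-value ℓ = begin
    - (+ x / 1 - ½) * ⟪ 2 ⟫               ≡⟨ cong₂ (λ a b → - (a - ½) * b) (sym (ι≡/1 (+ x))) ⟪2⟫ ⟩
    - (⟪ x ⟫ - ½) * (1ℚ + 1ℚ)             ≡⟨ solve 1 (λ x → :- (x :- con ½) :* (con 1ℚ :+ con 1ℚ) := :- ((x :+ x) :- con 1ℚ)) refl ⟪ x ⟫ ⟩
    - ((⟪ x ⟫ + ⟪ x ⟫) - 1ℚ)              ≡⟨ cong (λ z → - (z - 1ℚ)) (trans (sym (⟪⟫-+ x x)) (cong ⟪_⟫ (trans (cong₂ ℕ._+_ (sym (count≡2^ ℓ)) (sym (count≡2^ ℓ))) (sym (suc-count⁺ (suc ℓ)))))) ⟩
    - (⟪ suc (count⁺ (suc ℓ)) ⟫ - 1ℚ)     ≡⟨ cong (λ z → - (z - 1ℚ)) (trans (⟪⟫-+ 1 (count⁺ (suc ℓ))) (cong (_+ ⟪ count⁺ (suc ℓ) ⟫) ι1≡1)) ⟩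
    - (1ℚ + ⟪ count⁺ (suc ℓ) ⟫ - 1ℚ)      ≡⟨ solve 1 (λ k → :- (con 1ℚ :+ k :- con 1ℚ) := :- k) refl ⟪ count⁺ (suc ℓ) ⟫ ⟩
    - ⟪ count⁺ (suc ℓ) ⟫                  ∎
    where
    open ≡-Reasoning
    open +-*-Solver
    x = 2 ℕ.^ ℓ

  count⁺-odd : ∀ ℓ → Coprime (count⁺ (suc ℓ)) 2
  count⁺-odd ℓ {d} (d∣k , d∣2) = ∣1⇒≡1 (∣m+n∣m⇒∣n (subst (d ∣_) eq (∣-trans d∣2 (m∣m*n (count ℓ)))) d∣k)
    where
    eq : 2 ℕ.* count ℓ ≡ count⁺ (suc ℓ) ℕ.+ 1
    eq = trans (cong (count ℓ ℕ.+_) (ℕ.+-identityʳ (count ℓ))) (trans (sym (suc-count⁺ (suc ℓ))) (ℕ.+-comm 1 (count⁺ (suc ℓ))))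

  -- The power is defined from the exponent in lowest terms. Since K is odd, -K/2 is reduced with
  -- denominator 2, and the exponent is identified with that fraction by comparing doubles.
  ^ℚ-negγ : ∀ ℓ n .{{_ : ℕ.NonZero n}} m →
    seq (n ^ℚ (- (+ (2 ℕ.^ ℓ) / 1 - ½))) m ≡ rootSeq 2 1 (n ℕ.^ count⁺ (suc ℓ)) {{ℕ.m^n≢0 n (count⁺ (suc ℓ))}} m
  ^ℚ-negγ ℓ n m = go (count⁺ (suc ℓ)) (ℕ.≤-pred (subst (2 ℕ.≤_) (sym (suc-count⁺ (suc ℓ))) (ℕ.+-mono-≤ 1≤ 1≤))) (count⁺-odd ℓ)
    (- (+ (2 ℕ.^ ℓ) / 1 - ½)) (negγ-value ℓ)
    where
    1≤ : 1 ℕ.≤ count ℓ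
    1≤ = subst (1 ℕ.≤_) (sym (count≡2^ ℓ)) (ℕ.m^n>0 2 ℓ)
    go : ∀ k → 1 ℕ.≤ k → .(Coprime k 2) → ∀ p → p * ⟪ 2 ⟫ ≡ - ⟪ k ⟫ → seq (n ^ℚ p) m ≡ rootSeq 2 1 (n ℕ.^ k) {{ℕ.m^n≢0 n k}} m
    go (suc a) _ c p eq = cong (λ s → seq (n ^ℚ s) m) {p} {r} (half (trans eq (sym value)))
      where
      r : ℚ
      r = mkℚ -[1+ a ] 1 c
      value : r * ⟪ 2 ⟫ ≡ - ⟪ suc a ⟫
      value = trans (cong (_* ⟪ 2 ⟫) (sym (↥p/↧p≡p r))) (trans (sym (neg-distribˡ-* (+ suc a / 2) ⟪ 2 ⟫)) (cong -_ (/suc-* (suc a) 1)))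
      half : p * ⟪ 2 ⟫ ≡ r * ⟪ 2 ⟫ → p ≡ r
      half eq = ≤-antisym (*-cancelʳ ⟪ 2 ⟫ (0<⟪suc⟫ 1) (≤-reflexive eq)) (*-cancelʳ ⟪ 2 ⟫ (0<⟪suc⟫ 1) (≤-reflexive (sym eq)))

  -- Multiplied by 4, the claim is k + 2 ≤ 4 · 2^ℓ; `k` is here one less than the number of roots.
  γ-lower : ∀ ℓ k → suc (suc k) ℕ.≤ 2 ℕ.^ suc (suc ℓ) → + k / 4 ≤ + (2 ℕ.^ ℓ) / 1 - ½
  γ-lower ℓ k le = *-cancelʳ ⟪ 4 ⟫ (0<⟪suc⟫ 3) (begin
    (+ k / 4) * ⟪ 4 ⟫                        ≡⟨ /suc-* k 3 ⟩
    ⟪ k ⟫                                    ≤⟨ ≤-cert (⟪ 4 ℕ.* x ⟫ - ⟪ 2 ℕ.+ k ⟫) (0≤- (⟪⟫-mono (subst (2 ℕ.+ k ℕ.≤_) (sym (ℕ.*-assoc 2 2 x)) le))) certificate ⟩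
    (⟪ x ⟫ - ½) * ⟪ 4 ⟫                      ≡⟨ cong (λ z → (z - ½) * ⟪ 4 ⟫) (ι≡/1 (+ x)) ⟩
    (+ x / 1 - ½) * ⟪ 4 ⟫                    ∎)
    where
    open ≤-Reasoning
    open +-*-Solver
    x = 2 ℕ.^ ℓ
    certificate : (⟪ x ⟫ - ½) * ⟪ 4 ⟫ ≡ ⟪ k ⟫ + (⟪ 4 ℕ.* x ⟫ - ⟪ 2 ℕ.+ k ⟫)
    certificate = trans (cong ((⟪ x ⟫ - ½) *_) (ι≡/1 (+ 4)))
      (trans (solve 2 (λ x k → (x :- con ½) :* con (+ 4 / 1) := k :+ (con (+ 4 / 1) :* x :- (con (+ 2 / 1) :+ k))) refl ⟪ x ⟫ ⟪ k ⟫)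
        (cong₂ (λ u v → ⟪ k ⟫ + (u - v)) (sym (trans (⟪⟫-* 4 x) (cong (_* ⟪ x ⟫) (ι≡/1 (+ 4))))) (sym (trans (⟪⟫-+ 2 k) (cong (_+ ⟪ k ⟫) (ι≡/1 (+ 2)))))))

  -- The logarithm is found in the form ℓ + 1, which is possible as k + 1 ≥ 2 and makes the
  -- truncated subtraction in `γ` exact.
  level : ∀ k → 1 ℕ.≤ k → ∃[ ℓ ] 2 ℕ.^ suc ℓ ℕ.≤ k ℕ.+ 1 × k ℕ.+ 1 ℕ.< 2 ℕ.^ suc (suc ℓ)
  level k 1≤k = crossing (λ ℓ → 2 ℕ.^ suc ℓ) (k ℕ.+ 1) (k ℕ.+ 1) (ℕ.+-monoˡ-≤ 1 1≤k)
    (ℕ.<-≤-trans (n<2^n (k ℕ.+ 1)) (ℕ.^-monoʳ-≤ 2 (ℕ.n≤1+n (k ℕ.+ 1))))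

  γ-value : ∀ k ℓ → 2 ℕ.^ suc ℓ ℕ.≤ k ℕ.+ 1 × k ℕ.+ 1 ℕ.< 2 ℕ.^ suc (suc ℓ) → γ k ≡ + (2 ℕ.^ ℓ) / 1 - ½
  γ-value k ℓ (lo , hi) = cong (λ L → + (2 ℕ.^ (L ℕ.∸ 1)) / 1 - ½) (⌊log₂⌋-unique (suc ℓ) (k ℕ.+ 1) lo hi)

  γ-bound : ∀ k → 1 ℕ.≤ k → (+ k ℤ.- + 1) / 4 ≤ γ k
  γ-bound (suc k) 1≤k = let (ℓ , lo , hi) = level (suc k) 1≤k in
    subst ((+ k / 4) ≤_) (sym (γ-value (suc k) ℓ (lo , hi))) (γ-lower ℓ k (subst (ℕ._≤ 2 ℕ.^ suc (suc ℓ)) (cong suc (ℕ.+-comm k 1)) (ℕ.<⇒≤ hi)))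

  Approximable : ℕ → ℚ → Set
  Approximable k g = Σ[ D ∈ ℝ ] (0ℝ <ℝ D × ((α : ℝ) (n : ℕ) .{{_ : ℕ.NonZero n}} →
    Σ[ b ∈ (Fin k → ℕ) ] ((∀ j → 1 ℕ.≤ b j × b j ℕ.≤ n) × (‖ Σℝ (λ j → √ (b j)) -ℝ α ‖ ≤ℝ D *ℝ n ^ℚ (- g)))))

  approximable : ∀ k → 1 ℕ.≤ k → Approximable k (γ k)
  approximable k 1≤k =
    let (ℓ , lo , hi) = level k 1≤k
    in subst₂ Approximable (ℕ.m+[n∸m]≡n (count⁺≤ ℓ lo)) (sym (γ-value k ℓ (lo , hi))) (at ℓ (k ℕ.∸ count⁺ (suc ℓ)))
    where
    count⁺≤ : ∀ ℓ → 2 ℕ.^ suc ℓ ℕ.≤ k ℕ.+ 1 → count⁺ (suc ℓ) ℕ.≤ k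
    count⁺≤ ℓ lo = ℕ.≤-pred (subst₂ ℕ._≤_ (trans (sym (count≡2^ (suc ℓ))) (sym (suc-count⁺ (suc ℓ)))) (ℕ.+-comm k 1) lo)
    at : ∀ ℓ e → Approximable (count⁺ (suc ℓ) ℕ.+ e) (+ (2 ℕ.^ ℓ) / 1 - ½)
    at ℓ e = fromℚ ⟪ constantD (suc ℓ) e ⟫
      , (1ℚ , 0<1 , 0 , λ _ _ → subst (_≤ ⟪ constantD (suc ℓ) e ⟫) (sym (+-identityˡ 1ℚ)) (1≤⟪⟫ (1≤constantD (suc ℓ) e)))
      , λ α n → approximate-sqrt (suc ℓ) e α n (n ^ℚ (- (+ (2 ℕ.^ ℓ) / 1 - ½))) (^ℚ-negγ ℓ n)

open import Data.Nat using (ℕ; NonZero; _≤_)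
open import Data.Integer using (+_; _-_)
open import Data.Rational using (_/_; -_) renaming (_≤_ to _≤ℚ_)
open import Data.Fin using (Fin)
open import Data.Product using (Σ-syntax; ∃-syntax; _×_)

theorem1p2 : (k : ℕ) .{{_ : NonZero k}} →
    (Σ[ D ∈ ℝ ] (0ℝ <ℝ D ×
    ((α : ℝ) (n : ℕ) .{{_ : NonZero n}} →
    Σ[ b ∈ (Fin k → ℕ) ]
    ((∀ j → 1 ≤ b j × b j ≤ n) ×
    (‖ Σℝ (λ j → √ (b j)) -ℝ α ‖ ≤ℝ D *ℝ n ^ℚ (- γ k))))))
    × (((+ k - + 1) / 4) ≤ℚ γ k)
theorem1p2 k = Conclusion.approximable k (ℕ.>-nonZero⁻¹ k) , Conclusion.γ-bound k (ℕ.>-nonZero⁻¹ k)
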